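{- Let $k\ge 3$ and $1\le j\le k-1$ be fixed integers. In the random $k$-uniform hypergraph process $\{\mathcal{H}^k(n,M)\}_M$ on vertex set $\{1,\ldots,n\}$, let $\tau_c=\tau_c(n,j,k)$ be the first step $M$ at which $\mathcal{H}^k(n,M)$ is $j$-connected, and let $\tau_i=\tau_i(n,j,k)$ be the first step $M$ at which $\mathcal{H}^k(n,M)$ has no isolated $j$-set. Then with high probability (i.e.\ with probability tending to $1$ as $n\to\infty$) we have $\tau_c=\tau_i$.
   Context: A $k$-uniform hypergraph consists of a vertex set $V$ and a set of edges, each edge being a $k$-element subset of $V$. The random hypergraph process $\{\mathcal{H}^k(n,M)\}_M$ is defined by: $\mathcal{H}^k(n,0)$ is the hypergraph on $\{1,\ldots,n\}$ with no edges, and for $1\le M\le\binom{n}{k}$, $\mathcal{H}^k(n,M)$ is obtained from $\mathcal{H}^k(n,M-1)$ by adding a $k$-set chosen uniformly at random among those not already present as edges. A $j$-set is a set of $j$ vertices. Two $j$-sets $J_1,J_2$ are $j$-connected if there is a sequence of edges $E_1,\ldots,E_m$ with $J_1\subseteq E_1$, $J_2\subseteq E_m$ and $|E_i\cap E_{i+1}|\ge j$ for all $1\le i\le m-1$. A $j$-component is a maximal set of pairwise $j$-connected $j$-sets. A hypergraph is $j$-connected if there is one $j$-component which contains all $j$-sets of vertices. A $j$-set is isolated if it is contained in no edge. Both properties are monotone increasing, so $\tau_c,\tau_i$ are well defined. -}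

module Defs where

open import Data.Nat using (ℕ; zero; suc; _≤_; _<_; _≟_)
open import Data.List using (List; []; _∷_; _++_; map; filter; take)
open import Data.Vec using (Vec; []; _∷_)
open import Data.Fin.Subset using (Subset; Side; inside; outside; _⊆_; _∩_; ∣_∣)
open import Data.List.Membership.Propositional using (_∈_)
open import Data.Product using (Σ; ∃; ∃-syntax; _×_)
open import Relation.Binary.PropositionalEquality using (_≡_)
open import Relation.Nullary using (¬_)

allSubsets : (n : ℕ) → List (Subset n)
allSubsets zero = [] ∷ []
allSubsets (suc n) = map (inside ∷_) (allSubsets n) ++ map (outside ∷_) (allSubsets n)

kSets : (n k : ℕ) → List (Subset n)
kSets n k = filter (λ s → ∣ s ∣ ≟ k) (allSubsets n)

Hypergraph : ℕ → Set
Hypergraph n = List (Subset n)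

data Reach {n : ℕ} (H : Hypergraph n) (j : ℕ) (J : Subset n) : Subset n → Set where
  start : ∀ {e} → e ∈ H → J ⊆ e → Reach H j J e
  step  : ∀ {e e'} → Reach H j J e → e' ∈ H → j ≤ ∣ e ∩ e' ∣ → Reach H j J e'

JConnectedSets : {n : ℕ} → Hypergraph n → ℕ → Subset n → Subset n → Set
JConnectedSets H j J₁ J₂ = ∃[ e ] (Reach H j J₁ e × J₂ ⊆ e)

-- the hypergraph is j-connected: one j-component contains all j-sets,
-- i.e. every two j-sets (also J with itself) are j-connected
JConnected : {n : ℕ} → Hypergraph n → ℕ → Set
JConnected {n} H j = ∀ (J₁ J₂ : Subset n) → ∣ J₁ ∣ ≡ j → ∣ J₂ ∣ ≡ j → JConnectedSets H j J₁ J₂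

Isolated : {n : ℕ} → Hypergraph n → Subset n → Set
Isolated H J = ∀ e → e ∈ H → ¬ (J ⊆ e)

NoIsolatedJSet : {n : ℕ} → Hypergraph n → ℕ → Set
NoIsolatedJSet {n} H j = ∀ (J : Subset n) → ∣ J ∣ ≡ j → ¬ Isolated H J

-- An ordering σ of all k-sets determines the process: H(n,M) = take M σ.
-- M is the first step at which property P holds.
FirstHit : {n : ℕ} → (Hypergraph n → Set) → List (Subset n) → ℕ → Set
FirstHit P σ M = P (take M σ) × (∀ M' → M' < M → ¬ P (take M' σ))

TauEq : {n : ℕ} → ℕ → List (Subset n) → Set
TauEq j σ = ∀ Mc Mi → FirstHit (λ H → JConnected H j) σ Mc
                     → FirstHit (λ H → NoIsolatedJSet H j) σ Mi → Mc ≡ Mi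

{-# OPTIONS --safe #-}
module Submission where

-- Expose the k-sets in random order, and let D be the number of k-sets containing a given j-set.  There are times
-- M₁ < M₂ between which the last isolated j-set disappears with high probability: a union bound shows that none is
-- left at M₂, the second moment method that one is left at M₁.
--
-- Consider the link of a (j-1)-set S when the last isolated j-set disappears.  If all links are connected, then any
-- two j-sets differing in one element are j-connected, and hence all j-sets are.  Otherwise some link has a component
-- with s vertices, 2 ≤ s, which contains at most half of the vertices.  It is explored by fewer than s edges that are
-- present at M₂, while the k-sets containing S and exactly one vertex of the component are absent at M₁; there are
-- (1 - o(1)) s D of them for bounded s, and at least a constant times s D in general.  Exploring along a queue keeps the
-- number of candidates for the edges down to n ^ j D ^ m O(1) ^ s, where m is their number.  With M₁ at (4/7) j log₂ n
-- times the number of k-sets over D, the expected number of such components is n ^ j (log n) ^ O(s) n ^ (- (4/7) j s)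
-- for bounded s, and the sum over all s tends to 0.
--
-- For the exponential function 1/3 ≤ (1 - 1/x) ^ x ≤ 1/2 suffices: M₁ can be chosen between the two requirements
-- (that components with 2 vertices vanish and that isolated j-sets exist) because 2 ^ -2 < 3 ^ -1.

open import Defs
open import Data.Bool using (Bool; true; false; not; _∧_; _∨_; if_then_else_)
import Data.Bool as Bool
open import Data.Bool.ListAction using (all; any)
open import Data.Bool.Properties using (∧-zeroʳ)
open import Data.Empty using (⊥-elim)
open import Data.Fin using (Fin; zero; suc)
open import Data.Fin.Subset using (Subset; inside; outside; ⊥; _⊆_; _∩_; _∪_; _─_; _-_; ∁; ∣_∣; ⁅_⁆; Nonempty) renaming (_∈_ to _∈ˢ_; _∉_ to _∉ˢ_)
open import Data.Fin.Subset.Properties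
open import Data.List using (List; []; _∷_; _++_; map; concatMap; length; filter; take; drop; downFrom; allFin)
open import Data.List.Membership.Propositional using (_∈_; _∉_; find; lose)
open import Data.List.Membership.Propositional.Properties using (∈-map⁺; ∈-map⁻; ∈-++⁺ˡ; ∈-++⁺ʳ; ∈-++⁻; ∈-filter⁺; ∈-filter⁻; ∈-concat⁻′; ∈-concatMap⁺; ∈-allFin; ∈-downFrom⁺)
open import Data.List.Properties using (∷-injective; map-∘; length-map; length-++; length-tabulate; take++drop≡id)
open import Data.List.Relation.Binary.Permutation.Propositional using (_↭_; ↭-refl; ↭-sym; ↭-trans; prep; swap; ↭⇒↭ₛ)
open import Data.List.Relation.Binary.Permutation.Propositional.Properties using (∈-resp-↭)
import Data.List.Relation.Binary.Permutation.Setoid.Properties as Permₛ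
open import Data.List.Relation.Unary.All as All using (All; []; _∷_)
import Data.List.Relation.Unary.All.Properties as Allₚ
open import Data.List.Relation.Unary.AllPairs as AllPairs using ([]; _∷_)
import Data.List.Relation.Unary.AllPairs.Properties as AllPairsₚ
open import Data.List.Relation.Unary.Any using (here; there; any?)
open import Data.List.Relation.Unary.Unique.Propositional using (Unique)
import Data.List.Relation.Unary.Unique.Propositional.Properties as Uniqueₚ
open import Data.Nat using (ℕ; zero; suc; _+_; _*_; _^_; _∸_; _≤_; _<_; _!; z≤n; s≤s; pred; _≡ᵇ_; _≤?_; _⊔_; _/_; _%_; ⌊_/2⌋; ⌈_/2⌉; NonZero; >-nonZero)
import Data.Nat as ℕ
open import Data.Nat.DivMod using (m≡m%n+[m/n]*n; m%n<n; m/n*n≤m)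
open import Data.Nat.Properties
open import Data.Nat.Tactic.RingSolver using (solve-∀)
open import Data.Product using (∃-syntax; _×_; _,_; proj₁; proj₂)
open import Data.Sum using (_⊎_; inj₁; inj₂; [_,_]′)
open import Data.Vec using ([]; _∷_; here; there)
import Data.Vec.Properties as Vecₚ
open import Function using (_∘_)
open import Relation.Binary.Definitions using (DecidableEquality)
open import Relation.Binary.PropositionalEquality using (_≡_; _≢_; refl; sym; trans; cong; cong₂; subst; setoid; module ≡-Reasoning)
open import Relation.Nullary using (Dec; yes; no; does; ¬_; ¬?; contradiction)
open import Relation.Nullary.Decidable using (_×-dec_; decidable-stable; dec-true; dec-false)
open import Relation.Unary using (Decidable)

-- The step at which the last isolated j-set disappears is random, so events at that step cannot be
-- counted directly. A component of a link that is present at that step leaves two traces at fixed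
-- times: its boundary sets are absent already at `M₁`, and its exploring edges are present still at
-- `M₂`. A union bound over such traces covers the whole window between the two times. Charging
-- presence at `M₂` costs a power of log n per edge, which is harmless since the absence of the
-- boundary gains a power of n per vertex.
--
-- Vertex sets in links are used rather than families of j-sets because their boundary is counted
-- exactly, by one product of binomials, and stays proportional to the number of vertices up to half
-- of all of them; a family of j-sets would call for an isoperimetric inequality instead.
--
-- Probabilities are numbers of orderings out of `N !`, and all estimates are multiplied out: a
-- power such as `β ^ E` on the left of an inequality is a denominator.

private variable
  A A′ : Set
  n : ℕ

-- Counting orderings

∑ : (A → ℕ) → List A → ℕ
∑ f []       = 0
∑ f (x ∷ xs) = f x + ∑ f xs

⟦_⟧ : Bool → ℕ
⟦ true ⟧  = 1
⟦ false ⟧ = 0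

# : (A → Bool) → List A → ℕ
# P = ∑ (λ x → ⟦ P x ⟧)

∑-cong : {f g : A → ℕ} → (∀ x → f x ≡ g x) → ∀ xs → ∑ f xs ≡ ∑ g xs
∑-cong h []       = refl
∑-cong h (x ∷ xs) = cong₂ _+_ (h x) (∑-cong h xs)

∑-cong-∈ : {f g : A → ℕ} → ∀ xs → (∀ x → x ∈ xs → f x ≡ g x) → ∑ f xs ≡ ∑ g xs
∑-cong-∈ []       h = refl
∑-cong-∈ (x ∷ xs) h = cong₂ _+_ (h x (here refl)) (∑-cong-∈ xs (λ y y∈ → h y (there y∈)))

∑-mono-∈ : {f g : A → ℕ} → ∀ xs → (∀ x → x ∈ xs → f x ≤ g x) → ∑ f xs ≤ ∑ g xs
∑-mono-∈ []       h = z≤n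
∑-mono-∈ (x ∷ xs) h = +-mono-≤ (h x (here refl)) (∑-mono-∈ xs (λ y y∈ → h y (there y∈)))

∑-++ : (f : A → ℕ) → ∀ xs ys → ∑ f (xs ++ ys) ≡ ∑ f xs + ∑ f ys
∑-++ f []       ys = refl
∑-++ f (x ∷ xs) ys = trans (cong (f x +_) (∑-++ f xs ys)) (sym (+-assoc (f x) _ _))

∑-map : (f : A′ → ℕ) (g : A → A′) → ∀ xs → ∑ f (map g xs) ≡ ∑ (f ∘ g) xs
∑-map f g []       = refl
∑-map f g (x ∷ xs) = cong (f (g x) +_) (∑-map f g xs)

∑-concatMap : (f : A′ → ℕ) (g : A → List A′) → ∀ xs → ∑ f (concatMap g xs) ≡ ∑ (λ x → ∑ f (g x)) xs
∑-concatMap f g []       = refl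
∑-concatMap f g (x ∷ xs) = trans (∑-++ f (g x) (concatMap g xs)) (cong (∑ f (g x) +_) (∑-concatMap f g xs))

∑-+ : (f g : A → ℕ) → ∀ xs → ∑ (λ x → f x + g x) xs ≡ ∑ f xs + ∑ g xs
∑-+ f g []       = refl
∑-+ f g (x ∷ xs) rewrite ∑-+ f g xs = lem (f x) (g x) (∑ f xs) (∑ g xs)
  where
  lem : ∀ a b c d → a + b + (c + d) ≡ a + c + (b + d)
  lem = solve-∀

∑-*ˡ : ∀ c (f : A → ℕ) → ∀ xs → ∑ (λ x → c * f x) xs ≡ c * ∑ f xs
∑-*ˡ c f []       = sym (*-zeroʳ c)
∑-*ˡ c f (x ∷ xs) = trans (cong (c * f x +_) (∑-*ˡ c f xs)) (sym (*-distribˡ-+ c (f x) _))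

∑-*ʳ : ∀ c (f : A → ℕ) → ∀ xs → ∑ (λ x → f x * c) xs ≡ ∑ f xs * c
∑-*ʳ c f []       = refl
∑-*ʳ c f (x ∷ xs) = trans (cong (f x * c +_) (∑-*ʳ c f xs)) (sym (*-distribʳ-+ c (f x) _))

∑-const : ∀ c (xs : List A) → ∑ (λ _ → c) xs ≡ length xs * c
∑-const c []       = refl
∑-const c (x ∷ xs) = cong (c +_) (∑-const c xs)

∑-swap : (f : A → A′ → ℕ) → ∀ xs ys → ∑ (λ x → ∑ (f x) ys) xs ≡ ∑ (λ y → ∑ (λ x → f x y) xs) ys
∑-swap f []       ys = sym (trans (∑-const 0 ys) (*-zeroʳ (length ys)))
∑-swap f (x ∷ xs) ys = trans (cong (∑ (f x) ys +_) (∑-swap f xs ys)) (sym (∑-+ (f x) _ ys))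

⟦∧⟧≤ʳ : ∀ a b → ⟦ a ∧ b ⟧ ≤ ⟦ b ⟧
⟦∧⟧≤ʳ true  b = ≤-refl
⟦∧⟧≤ʳ false b = z≤n

⟦∨⟧≤ : ∀ a b → ⟦ a ∨ b ⟧ ≤ ⟦ a ⟧ + ⟦ b ⟧
⟦∨⟧≤ true  b = s≤s z≤n
⟦∨⟧≤ false b = ≤-refl

⟦any⟧≤# : (P : A → Bool) → ∀ xs → ⟦ any P xs ⟧ ≤ # P xs
⟦any⟧≤# P []       = z≤n
⟦any⟧≤# P (x ∷ xs) = ≤-trans (⟦∨⟧≤ (P x) _) (+-monoʳ-≤ ⟦ P x ⟧ (⟦any⟧≤# P xs))

#-complement : (P : A → Bool) → ∀ xs → # P xs + # (not ∘ P) xs ≡ length xs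
#-complement P []       = refl
#-complement P (x ∷ xs) with P x
... | true  = cong suc (#-complement P xs)
... | false = trans (+-suc _ _) (cong suc (#-complement P xs))

∑-if : (P : A → Bool) (u w : ℕ) → ∀ xs → ∑ (λ x → if P x then u else w) xs ≡ # P xs * u + # (not ∘ P) xs * w
∑-if P u w []       = refl
∑-if P u w (x ∷ xs) rewrite ∑-if P u w xs with P x
... | true  = sym (+-assoc u _ _)
... | false = lem w (# P xs * u) (# (not ∘ P) xs * w)
  where
  lem : ∀ a b c → a + (b + c) ≡ b + (a + c)
  lem = solve-∀

select : List A → List (A × List A)
select []       = []
select (x ∷ xs) = (x , xs) ∷ map (λ p → proj₁ p , x ∷ proj₂ p) (select xs)

-- The orderings of `U`. The number is the length of `U` and only makes the recursion structural.
perms : ℕ → List A → List (List A)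
perms zero    U = [] ∷ []
perms (suc N) U = concatMap (λ p → map (proj₁ p ∷_) (perms N (proj₂ p))) (select U)

∑-select : (f : A → ℕ) → ∀ U {p} → p ∈ select U → ∑ f U ≡ f (proj₁ p) + ∑ f (proj₂ p)
∑-select f (x ∷ xs) (here refl) = refl
∑-select f (x ∷ xs) (there p∈) with ∈-map⁻ _ p∈
... | (y , ys) , y∈ , refl rewrite ∑-select f xs y∈ = lem (f x) (f y) (∑ f ys)
  where
  lem : ∀ a b c → a + (b + c) ≡ b + (a + c)
  lem = solve-∀

∑-proj₁-select : (f : A → ℕ) → ∀ U → ∑ (f ∘ proj₁) (select U) ≡ ∑ f U
∑-proj₁-select f []       = refl
∑-proj₁-select f (x ∷ xs) = cong (f x +_) (trans (∑-map (f ∘ proj₁) _ (select xs)) (∑-proj₁-select f xs))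

length-∑ : (U : List A) → ∑ (λ _ → 1) U ≡ length U
length-∑ U = trans (∑-const 1 U) (*-identityʳ _)

length-select : ∀ (U : List A) {p N} → length U ≡ suc N → p ∈ select U → length (proj₂ p) ≡ N
length-select U {p} eq p∈ =
  suc-injective (trans (cong suc (sym (length-∑ (proj₂ p)))) (trans (sym (∑-select (λ _ → 1) U p∈)) (trans (length-∑ U) eq)))

∑-perms : (f : List A → ℕ) → ∀ N U →
  ∑ f (perms (suc N) U) ≡ ∑ (λ p → ∑ (f ∘ (proj₁ p ∷_)) (perms N (proj₂ p))) (select U)
∑-perms f N U = trans (∑-concatMap f _ (select U)) (∑-cong (λ p → ∑-map f _ (perms N (proj₂ p))) (select U))

-- Conditioning on the first element: the counts of orderings below are inductions along this
-- inequality or the equation that follows it.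
∑-perms-≤ : (f : List A → ℕ) (b : A → ℕ) → ∀ N U →
  (∀ x V → (x , V) ∈ select U → ∑ (f ∘ (x ∷_)) (perms N V) ≤ b x) →
  ∑ f (perms (suc N) U) ≤ ∑ b U
∑-perms-≤ f b N U h = begin
  ∑ f (perms (suc N) U)  ≡⟨ ∑-perms f N U ⟩
  ∑ (λ p → ∑ (f ∘ (proj₁ p ∷_)) (perms N (proj₂ p))) (select U)          ≤⟨ ∑-mono-∈ (select U) (λ (x , V) → h x V) ⟩
  ∑ (b ∘ proj₁) (select U)  ≡⟨ ∑-proj₁-select b U ⟩
  ∑ b U  ∎
  where open ≤-Reasoning

∑-perms-≡ : (f : List A → ℕ) (b : A → ℕ) → ∀ N U →
  (∀ x V → (x , V) ∈ select U → ∑ (f ∘ (x ∷_)) (perms N V) ≡ b x) →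
  ∑ f (perms (suc N) U) ≡ ∑ b U
∑-perms-≡ f b N U h =
  trans (∑-perms f N U) (trans (∑-cong-∈ (select U) (λ (x , V) → h x V)) (∑-proj₁-select b U))

-- The falling factorial c (c - 1) ... (c - m + 1), that is, the number of injections of m points
-- into c points; it is 0 for c < m.
falling : ℕ → ℕ → ℕ
falling c       zero    = 1
falling zero    (suc m) = 0
falling (suc c) (suc m) = suc c * falling c m

-- Injections of m + 1 points into c + 1 points, split by whether the last of the c + 1 points is
-- hit.
falling-suc : ∀ c m → suc m * falling c m + falling c (suc m) ≡ falling (suc c) (suc m)
falling-suc zero    zero    = refl
falling-suc zero    (suc m) = trans (+-identityʳ _) (*-zeroʳ (suc (suc m)))
falling-suc (suc c) zero    = refl
falling-suc (suc c) (suc m) = begin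
  suc (suc m) * (suc c * falling c m) + suc c * falling c (suc m)  ≡⟨ lem c m (falling c m) (falling c (suc m)) ⟩
  suc c * (suc m * falling c m + falling c (suc m)) + suc c * falling c m ≡⟨ cong (λ z → suc c * z + suc c * falling c m) (falling-suc c m) ⟩
  suc c * falling (suc c) (suc m) + suc c * falling c m            ≡⟨ +-comm (suc c * falling (suc c) (suc m)) _ ⟩
  suc (suc c) * falling (suc c) (suc m)  ∎
  where
  open ≡-Reasoning
  lem : ∀ c m u w → suc (suc m) * (suc c * u) + suc c * w ≡ suc c * (suc m * u + w) + suc c * u
  lem = solve-∀

*falling-pred : ∀ c m → m * falling c (pred m) + falling c m ≤ falling (suc c) m
*falling-pred c zero    = ≤-refl
*falling-pred c (suc m) = ≤-reflexive (falling-suc c m)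

falling-*-! : ∀ {M N} → M ≤ N → falling N M * (N ∸ M) ! ≡ N !
falling-*-! {zero}  {N}     _         = +-identityʳ (N !)
falling-*-! {suc M} {suc N} (s≤s M≤N) = trans (*-assoc (suc N) (falling N M) _) (cong (suc N *_) (falling-*-! M≤N))

falling-monoˡ : ∀ {c d} M → c ≤ d → falling c M ≤ falling d M
falling-monoˡ zero          c≤d       = ≤-refl
falling-monoˡ (suc M) z≤n             = z≤n
falling-monoˡ (suc M) (s≤s c≤d)       = *-mono-≤ (s≤s c≤d) (falling-monoˡ M c≤d)

*!-pred : ∀ b → b * (pred b) ! ≤ b !
*!-pred zero    = z≤n
*!-pred (suc b) = ≤-refl

-- With N = m + c, the quotient of the falling factorials of M and N is a product of terms (M - l) /
-- (N - l). Lowering numerator and denominator together keeps each of them at most α / β, because α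
-- ≤ β.
falling-ratio : ∀ {α β} → α ≤ β → ∀ m M c → M * β ≤ α * (m + c) → falling M m * c ! * β ^ m ≤ α ^ m * (m + c) !
falling-ratio α≤β zero    M       c h = ≤-reflexive (lem (c !))
  where
  lem : ∀ x → (x + 0) * 1 ≡ x + 0
  lem = solve-∀
falling-ratio α≤β (suc m) zero    c h = z≤n
falling-ratio {α} {β} α≤β (suc m) (suc M) c h = begin
  suc M * falling M m * c ! * (β * β ^ m)        ≡⟨ lem (suc M) (falling M m) (c !) β (β ^ m) ⟩
  (suc M * β) * (falling M m * c ! * β ^ m)      ≤⟨ *-mono-≤ h (falling-ratio α≤β m M c h′) ⟩
  (α * (suc m + c)) * (α ^ m * (m + c) !)   ≡⟨ lem′ α (suc m + c) (α ^ m) ((m + c) !) ⟩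
  α * α ^ m * ((suc m + c) * (m + c) !)     ∎
  where
  open ≤-Reasoning
  lem : ∀ a b c d e → a * b * c * (d * e) ≡ (a * d) * (b * c * e)
  lem = solve-∀
  lem′ : ∀ a b c d → (a * b) * (c * d) ≡ a * c * (b * d)
  lem′ = solve-∀
  h′ : M * β ≤ α * (m + c)
  h′ = +-cancelˡ-≤ β _ _ (≤-trans h (≤-trans (≤-reflexive (*-suc α (m + c))) (+-monoˡ-≤ _ α≤β)))

avoids : ℕ → (A → Bool) → List A → Bool
avoids M B σ = all (not ∘ B) (take M σ)

-- All elements of `T` come among the first `M`, expressed as: none of them comes later. In this
-- form the condition passes to the tail of an ordering whether or not its head is in `T`.
contains : ℕ → (A → Bool) → List A → Bool
contains M T σ = all (not ∘ T) (drop M σ)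

#T-select : (T : A → Bool) → ∀ U {x V} → (x , V) ∈ select U → T x ≡ true → # T V ≡ pred (# T U)
#T-select T U {x} {V} xV eq = cong pred {x = suc (# T V)} (sym (trans (∑-select _ U xV) (cong (λ b → ⟦ b ⟧ + # T V) eq)))

#F-select : (T : A → Bool) → ∀ U {x V} → (x , V) ∈ select U → T x ≡ false → # T V ≡ # T U
#F-select T U {x} {V} xV eq = sym (trans (∑-select _ U xV) (cong (λ b → ⟦ b ⟧ + # T V) eq))

∑-0 : (f : A → ℕ) → (∀ x → f x ≡ 0) → ∀ xs → ∑ f xs ≡ 0
∑-0 f h xs = trans (∑-cong h xs) (trans (∑-const 0 xs) (*-zeroʳ (length xs)))

module _ (T : A → Bool) where

  -- The elements of `T` are injected into the first `M` positions and the others are ordered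
  -- arbitrarily.
  #contains : ∀ N U M → length U ≡ N → # (contains M T) (perms N U) ≤ falling M (# T U) * (# (not ∘ T) U) !
  #contains zero    [] zero    refl = ≤-refl
  #contains zero    [] (suc M) refl = ≤-refl
  #contains (suc N) U  zero    eq   = begin
    # (contains 0 T) (perms (suc N) U)         ≤⟨ ∑-perms-≤ _ (λ x → if T x then 0 else falling 0 m * (pred b) !) N U bnd ⟩
    ∑ (λ x → if T x then 0 else falling 0 m * (pred b) !) U ≡⟨ ∑-if T 0 _ U ⟩
    m * 0 + b * (falling 0 m * (pred b) !)          ≡⟨ lem m b (falling 0 m) ((pred b) !) ⟩
    falling 0 m * (b * (pred b) !)  ≤⟨ *-monoʳ-≤ (falling 0 m) (*!-pred b) ⟩
    falling 0 m * b !  ∎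
    where
    open ≤-Reasoning
    m = # T U
    b = # (not ∘ T) U
    lem : ∀ m b f g → m * 0 + b * (f * g) ≡ f * (b * g)
    lem = solve-∀
    bnd : ∀ x V → (x , V) ∈ select U → ∑ ((λ σ → ⟦ contains 0 T σ ⟧) ∘ (x ∷_)) (perms N V) ≤ (if T x then 0 else falling 0 m * (pred b) !)
    bnd x V xV with T x in Tx
    ... | true  = ≤-reflexive (∑-0 _ (λ _ → refl) (perms N V))
    ... | false = ≤-trans (#contains N V 0 (length-select U eq xV))
                    (≤-reflexive (cong₂ (λ p q → falling 0 p * q !) (#F-select T U xV Tx) (#T-select (not ∘ T) U xV (cong not Tx))))
  #contains (suc N) U (suc M) eq = begin
    # (contains (suc M) T) (perms (suc N) U)   ≤⟨ ∑-perms-≤ _ (λ x → if T x then u else w) N U bnd ⟩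
    ∑ (λ x → if T x then u else w) U           ≡⟨ ∑-if T u w U ⟩
    m * u + b * w  ≡⟨ lem m b (falling M (pred m)) (b !) (falling M m) ((pred b) !) ⟩
    m * falling M (pred m) * b ! + falling M m * (b * (pred b) !) ≤⟨ +-monoʳ-≤ (m * falling M (pred m) * b !) (*-monoʳ-≤ (falling M m) (*!-pred b)) ⟩
    m * falling M (pred m) * b ! + falling M m * b !     ≡⟨ *-distribʳ-+ (b !) (m * falling M (pred m)) (falling M m) ⟨
    (m * falling M (pred m) + falling M m) * b !         ≤⟨ *-monoˡ-≤ (b !) (*falling-pred M m) ⟩
    falling (suc M) m * b !  ∎
    where
    open ≤-Reasoning
    m = # T U
    b = # (not ∘ T) U
    u = falling M (pred m) * b !
    w = falling M m * (pred b) !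
    lem : ∀ m b f g h i → m * (f * g) + b * (h * i) ≡ m * f * g + h * (b * i)
    lem = solve-∀
    bnd : ∀ x V → (x , V) ∈ select U → # (contains M T) (perms N V) ≤ (if T x then u else w)
    bnd x V xV with T x in Tx
    ... | true  = ≤-trans (#contains N V M (length-select U eq xV))
                    (≤-reflexive (cong₂ (λ p q → falling M p * q !) (#T-select T U xV Tx) (#F-select (not ∘ T) U xV (cong not Tx))))
    ... | false = ≤-trans (#contains N V M (length-select U eq xV))
                    (≤-reflexive (cong₂ (λ p q → falling M p * q !) (#F-select T U xV Tx) (#T-select (not ∘ T) U xV (cong not Tx))))

length-perms : ∀ N (U : List A) → length U ≡ N → ∑ (λ _ → 1) (perms N U) ≡ N !
length-perms zero    U eq = refl
length-perms (suc N) U eq = begin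
  ∑ (λ _ → 1) (perms (suc N) U) ≡⟨ ∑-perms-≡ _ (λ _ → N !) N U (λ x V xV → length-perms N V (length-select U eq xV)) ⟩
  ∑ (λ _ → N !) U               ≡⟨ ∑-const (N !) U ⟩
  length U * N !  ≡⟨ cong (_* N !) eq ⟩
  suc N * N !  ∎
  where open ≡-Reasoning

#avoids : (B : A → Bool) → ∀ N U M → length U ≡ N → M ≤ N → # (avoids M B) (perms N U) ≡ falling (# (not ∘ B) U) M * (N ∸ M) !
#avoids B N       U  zero    eq M≤N  = trans (length-perms N U eq) (sym (+-identityʳ (N !)))
#avoids B (suc N) U  (suc M) eq (s≤s M≤N) = begin
  # (avoids (suc M) B) (perms (suc N) U) ≡⟨ ∑-perms-≡ _ (λ x → if B x then 0 else w) N U bnd ⟩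
  ∑ (λ x → if B x then 0 else w) U       ≡⟨ ∑-if B 0 w U ⟩
  # B U * 0 + b * w  ≡⟨ lem (# B U) b (falling (pred b) M) ((N ∸ M) !) ⟩
  (b * falling (pred b) M) * (N ∸ M) !        ≡⟨ cong (_* (N ∸ M) !) (falling-pred b) ⟩
  falling b (suc M) * (N ∸ M) !               ∎
  where
  open ≡-Reasoning
  b = # (not ∘ B) U
  w = falling (pred b) M * (N ∸ M) !
  lem : ∀ m b f g → m * 0 + b * (f * g) ≡ (b * f) * g
  lem = solve-∀
  falling-pred : ∀ b → b * falling (pred b) M ≡ falling b (suc M)
  falling-pred zero    = refl
  falling-pred (suc b) = refl
  bnd : ∀ x V → (x , V) ∈ select U → ∑ ((λ σ → ⟦ avoids (suc M) B σ ⟧) ∘ (x ∷_)) (perms N V) ≡ (if B x then 0 else w)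
  bnd x V xV with B x in Bx
  ... | true  = ∑-0 _ (λ _ → refl) (perms N V)
  ... | false = trans (#avoids B N V M (length-select U eq xV) M≤N)
                  (cong (λ p → falling p M * (N ∸ M) !) (#T-select (not ∘ B) U xV (cong not Bx)))

module _ (T B : A → Bool) (disjoint : ∀ x → B x ≡ true → T x ≡ false) where

  free : A → Bool
  free x = not (T x) ∧ not (B x)

  #¬T : ∀ U → # (not ∘ T) U ≡ # free U + # B U
  #¬T U = trans (∑-cong pt U) (∑-+ _ _ U)
    where
    pt : ∀ x → ⟦ not (T x) ⟧ ≡ ⟦ free x ⟧ + ⟦ B x ⟧
    pt x with B x in Bx
    ... | true  rewrite disjoint x Bx = refl
    ... | false with T x
    ...   | true  = refl
    ...   | false = refl

  module _ {α β : ℕ} (α≤β : α ≤ β) where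

    -- Avoidance multiplies the bound of `#contains` by (α / β) ^ E. At least `E` of the first `M₁`
    -- positions hold no element of `T`; at each of these the next element must be a free one among
    -- the free ones and those of `B`, a proportion of at most α / β, and using up free elements
    -- only lowers it. After `E` such positions avoidance is forgotten.
    #avoids∧contains : ∀ N U E M₁ M₂ → length U ≡ N → E + # T U ≤ M₁ → M₁ ≤ M₂ → M₁ ≤ N →
      # free U * β ≤ α * (# free U + # B U) →
      # (λ σ → avoids M₁ B σ ∧ contains M₂ T σ) (perms N U) * β ^ E
        ≤ falling M₂ (# T U) * (# free U + # B U) ! * α ^ E
    #avoids∧contains N U zero M₁ M₂ eq _ _ _ _ = *-monoˡ-≤ 1 (begin
      # (λ σ → avoids M₁ B σ ∧ contains M₂ T σ) (perms N U) ≤⟨ ∑-mono-∈ (perms N U) (λ σ _ → ⟦∧⟧≤ʳ (avoids M₁ B σ) _) ⟩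
      # (contains M₂ T) (perms N U)  ≤⟨ #contains T N U M₂ eq ⟩
      falling M₂ (# T U) * (# (not ∘ T) U) !  ≡⟨ cong (λ z → falling M₂ (# T U) * z !) (#¬T U) ⟩
      falling M₂ (# T U) * (# free U + # B U) !  ∎)
      where open ≤-Reasoning
    #avoids∧contains (suc N) U (suc E) (suc M₁) (suc M₂) eq (s≤s E+m≤) (s≤s M₁≤M₂) (s≤s M₁≤N) ratio = begin
      # ev (perms (suc N) U) * β ^ suc E ≡⟨ ∑-*ʳ (β ^ suc E) _ (perms (suc N) U) ⟨
      ∑ (λ σ → ⟦ ev σ ⟧ * β ^ suc E) (perms (suc N) U) ≤⟨ ∑-perms-≤ _ bd N U bnd ⟩
      ∑ bd U  ≡⟨ ∑-bd U ⟩
      m * (u * α ^ suc E) + c * (β * (w * α ^ E)) ≡⟨ lem m u (α ^ suc E) c β w (α ^ E) ⟩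
      m * u * α ^ suc E + c * β * w * α ^ E ≤⟨ +-monoʳ-≤ (m * u * α ^ suc E) (*-monoˡ-≤ (α ^ E) cβw≤) ⟩
      m * u * α ^ suc E + α * (falling M₂ m * (c + a) !) * α ^ E ≡⟨ lem₂ m (falling M₂ (pred m)) ((c + a) !) α (α ^ E) (falling M₂ m) ⟩
      (m * falling M₂ (pred m) + falling M₂ m) * (c + a) ! * α ^ suc E ≤⟨ *-monoˡ-≤ (α ^ suc E) (*-monoˡ-≤ ((c + a) !) (*falling-pred M₂ m)) ⟩
      falling (suc M₂) m * (c + a) ! * α ^ suc E ∎
      where
      open ≤-Reasoning
      ev = λ σ → avoids (suc M₁) B σ ∧ contains (suc M₂) T σ
      m = # T U
      c = # free U
      a = # B U
      u = falling M₂ (pred m) * (c + a) !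
      w = falling M₂ m * (pred c + a) !
      bd : A → ℕ
      bd x = if T x then u * α ^ suc E else (if B x then 0 else β * (w * α ^ E))
      lem : ∀ m u x c β w y → m * (u * x) + c * (β * (w * y)) ≡ m * u * x + c * β * w * y
      lem = solve-∀
      lem₂ : ∀ m f g α y h → m * (f * g) * (α * y) + α * (h * g) * y ≡ (m * f + h) * g * (α * y)
      lem₂ = solve-∀
      ∑-bd : ∀ U → ∑ bd U ≡ # T U * (u * α ^ suc E) + # free U * (β * (w * α ^ E))
      ∑-bd U = trans (∑-cong pt U) (trans (∑-+ _ _ U) (cong₂ _+_ (∑-*ʳ _ _ U) (∑-*ʳ _ _ U)))
        where
        pt : ∀ x → bd x ≡ ⟦ T x ⟧ * (u * α ^ suc E) + ⟦ free x ⟧ * (β * (w * α ^ E))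
        pt x with T x
        ... | true  = sym (trans (+-identityʳ _) (+-identityʳ _))
        ... | false with B x
        ...   | true  = refl
        ...   | false = sym (+-identityʳ _)
      c*! : ∀ c → c * β ≤ α * (c + a) → c * β * (pred c + a) ! ≤ α * (c + a) !
      c*! zero    _ = z≤n
      c*! (suc c) h = ≤-trans (*-monoˡ-≤ ((c + a) !) h) (≤-reflexive (*-assoc α _ _))
      cβw≤ : c * β * w ≤ α * (falling M₂ m * (c + a) !)
      cβw≤ = begin
        c * β * (falling M₂ m * (pred c + a) !)   ≡⟨ lem₃ (c * β) (falling M₂ m) ((pred c + a) !) ⟩
        falling M₂ m * (c * β * (pred c + a) !)   ≤⟨ *-monoʳ-≤ (falling M₂ m) (c*! c ratio) ⟩
        falling M₂ m * (α * (c + a) !)            ≡⟨ lem₃ (falling M₂ m) α ((c + a) !) ⟩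
        α * (falling M₂ m * (c + a) !)            ∎
        where
        lem₃ : ∀ x y z → x * (y * z) ≡ y * (x * z)
        lem₃ = solve-∀
      ratio-pred : ∀ c → c * β ≤ α * (c + a) → pred c * β ≤ α * (pred c + a)
      ratio-pred zero    h = h
      ratio-pred (suc c) h = +-cancelˡ-≤ β _ _ (≤-trans h (≤-trans (≤-reflexive (*-suc α (c + a))) (+-monoˡ-≤ _ α≤β)))
      bnd : ∀ x V → (x , V) ∈ select U → ∑ ((λ σ → ⟦ ev σ ⟧ * β ^ suc E) ∘ (x ∷_)) (perms N V) ≤ bd x
      bnd x V xV with T x in Tx | B x in Bx
      ... | true  | true  with () ← trans (sym (disjoint x Bx)) Tx
      ... | true  | false = begin
        ∑ (λ σ → ⟦ avoids M₁ B σ ∧ contains M₂ T σ ⟧ * β ^ suc E) (perms N V) ≡⟨ ∑-*ʳ (β ^ suc E) _ (perms N V) ⟩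
        # (λ σ → avoids M₁ B σ ∧ contains M₂ T σ) (perms N V) * β ^ suc E
          ≤⟨ #avoids∧contains N V (suc E) M₁ M₂ (length-select U eq xV)
               (subst (λ z → suc E + z ≤ M₁) (sym mV) (≤-trans (m-pred _ (subst (1 ≤_) (sym mU) (s≤s z≤n))) E+m≤)) M₁≤M₂ M₁≤N
               (subst (λ z → z * β ≤ α * (z + # B V)) (sym cV) (subst (λ z → c * β ≤ α * (c + z)) (sym aV) ratio)) ⟩
        falling M₂ (# T V) * (# free V + # B V) ! * α ^ suc E
          ≡⟨ cong₂ (λ p q → falling M₂ p * q ! * α ^ suc E) mV (cong₂ _+_ cV aV) ⟩
        u * α ^ suc E ∎
        where
        mV = #T-select T U xV Tx
        mU = trans (∑-select _ U xV) (cong (λ b → ⟦ b ⟧ + # T V) Tx)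
        aV = #F-select B U xV Bx
        cV = #F-select free U xV (cong (λ b → not b ∧ not (B x)) Tx)
        m-pred : ∀ m → 1 ≤ m → suc E + pred m ≤ E + m
        m-pred (suc m) _ = ≤-reflexive (sym (+-suc E m))
      ... | false | true  = ≤-reflexive (∑-0 _ (λ _ → refl) (perms N V))
      ... | false | false = begin
        ∑ (λ σ → ⟦ avoids M₁ B σ ∧ contains M₂ T σ ⟧ * β ^ suc E) (perms N V) ≡⟨ ∑-*ʳ (β ^ suc E) _ (perms N V) ⟩
        X * (β * β ^ E)   ≡⟨ lem₄ X β (β ^ E) ⟩
        β * (X * β ^ E)   ≤⟨ *-monoʳ-≤ β (#avoids∧contains N V E M₁ M₂ (length-select U eq xV)
               (subst (λ z → E + z ≤ M₁) (sym mV) E+m≤) M₁≤M₂ M₁≤N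
               (subst (λ z → z * β ≤ α * (z + # B V)) (sym cV) (subst (λ z → pred c * β ≤ α * (pred c + z)) (sym aV) (ratio-pred c ratio)))) ⟩
        β * (falling M₂ (# T V) * (# free V + # B V) ! * α ^ E)
          ≡⟨ cong (β *_) (cong₂ (λ p q → falling M₂ p * q ! * α ^ E) mV (cong₂ _+_ cV aV)) ⟩
        β * (w * α ^ E)   ∎
        where
        X = # (λ σ → avoids M₁ B σ ∧ contains M₂ T σ) (perms N V)
        mV = #F-select T U xV Tx
        aV = #F-select B U xV Bx
        cV = #T-select free U xV (cong₂ (λ b b′ → not b ∧ not b′) Tx Bx)
        lem₄ : ∀ x y z → x * (y * z) ≡ y * (x * z)
        lem₄ = solve-∀

select-↭ : ∀ (U : List A) {p} → p ∈ select U → proj₁ p ∷ proj₂ p ↭ U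
select-↭ (x ∷ xs) (here refl) = ↭-refl
select-↭ (x ∷ xs) (there p∈) with ∈-map⁻ _ p∈
... | (y , ys) , y∈ , refl = ↭-trans (swap y x ↭-refl) (prep x (select-↭ xs y∈))

perms-↭ : ∀ N (U : List A) → length U ≡ N → ∀ {σ} → σ ∈ perms N U → σ ↭ U
perms-↭ zero    []  eq (here refl) = ↭-refl
perms-↭ (suc N) U eq σ∈ with ∈-concat⁻′ (map _ (select U)) σ∈
... | _ , σ∈′ , xs∈ with ∈-map⁻ _ xs∈
...   | (x , V) , xV , refl with ∈-map⁻ _ σ∈′
...     | τ , τ∈ , refl = ↭-trans (prep x (perms-↭ N V (length-select U eq xV) τ∈)) (select-↭ U xV)

map-proj₁-select : ∀ (U : List A) → map proj₁ (select U) ≡ U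
map-proj₁-select []       = refl
map-proj₁-select (x ∷ xs) = cong (x ∷_) (trans (sym (map-∘ (select xs))) (map-proj₁-select xs))

Unique-select : ∀ (U : List A) → Unique U → All (Unique ∘ proj₂) (select U)
Unique-select []       uq = []
Unique-select (x ∷ xs) (x∉ ∷ uq) = uq ∷ Allₚ.map⁺ (All.tabulate λ {p} p∈ →
  All.tabulate (λ y∈ → All.lookup x∉ (∈⁻ p∈ y∈)) ∷ All.lookup (Unique-select xs uq) p∈)
  where
  ∈⁻ : ∀ {p y} → p ∈ select xs → y ∈ proj₂ p → y ∈ xs
  ∈⁻ {p} p∈ y∈ = ∈-resp-↭ (select-↭ xs p∈) (there y∈)

-- Orderings with different first elements differ. Without this, counting list entries would not be
-- counting orderings.
Unique-perms : ∀ N (U : List A) → Unique U → Unique (perms N U)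
Unique-perms zero    U uq = [] ∷ []
Unique-perms {A = A} (suc N) U uq = Uniqueₚ.concat⁺ each
    (AllPairsₚ.map⁺ (AllPairs.map disj (AllPairsₚ.map⁻ (subst Unique (sym (map-proj₁-select U)) uq))))
  where
  f : A × List A → List (List A)
  f = λ p → map (proj₁ p ∷_) (perms N (proj₂ p))
  each : All Unique (map f (select U))
  each = Allₚ.map⁺ (All.map (λ uq′ → Uniqueₚ.map⁺ (proj₂ ∘ ∷-injective) (Unique-perms N _ uq′)) (Unique-select U uq))
  disj : ∀ {p q} → proj₁ p ≢ proj₁ q → ∀ {σ} → σ ∈ f p × σ ∈ f q → _
  disj p≢q (σ∈p , σ∈q) with ∈-map⁻ _ σ∈p | ∈-map⁻ _ σ∈q
  ... | _ , _ , refl | _ , _ , eq = p≢q (proj₁ (∷-injective eq))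

-- The second moment method

2ab≤a²+b² : ∀ a b → 2 * (a * b) ≤ a * a + b * b
2ab≤a²+b² a b = [ ordered a b , flipped ]′ (≤-total a b)
  where
  lem : ∀ a d → 2 * (a * (a + d)) + d * d ≡ a * a + (a + d) * (a + d)
  lem = solve-∀
  ordered : ∀ a b → a ≤ b → 2 * (a * b) ≤ a * a + b * b
  ordered a b a≤b = subst (λ b → 2 * (a * b) ≤ a * a + b * b) (m+[n∸m]≡n a≤b)
    (≤-trans (m≤m+n _ _) (≤-reflexive (lem a (b ∸ a))))
  flipped : b ≤ a → 2 * (a * b) ≤ a * a + b * b
  flipped b≤a = ≤-trans (≤-reflexive (cong (2 *_) (*-comm a b))) (≤-trans (ordered b a b≤a) (≤-reflexive (+-comm (b * b) _)))

module _ (Ω : List A) (X : A → ℕ) (F : ℕ) (lenΩ : ∑ (λ _ → 1) Ω ≡ F) where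

  -- With μ the sum of `X`, so that the mean is μ / F, the square (F X - μ)² is at least μ² wherever
  -- X = 0. Summing this over `Ω` gives the claim; the mixed term stands on the left to avoid
  -- subtraction.
  chebyshev : # (λ ω → X ω ≡ᵇ 0) Ω * (∑ X Ω * ∑ X Ω) + F * (∑ X Ω * ∑ X Ω) ≤ F * F * ∑ (λ ω → X ω * X ω) Ω
  chebyshev = +-cancelˡ-≤ (F * (μ * μ)) _ _ (begin
    F * (μ * μ) + (# (λ ω → X ω ≡ᵇ 0) Ω * (μ * μ) + F * (μ * μ)) ≡⟨ lem F μ (# (λ ω → X ω ≡ᵇ 0) Ω) ⟩
    2 * F * μ * μ + # (λ ω → X ω ≡ᵇ 0) Ω * (μ * μ)
      ≡⟨ cong₂ _+_ (∑-*ˡ (2 * F * μ) X Ω) (∑-*ʳ (μ * μ) _ Ω) ⟨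
    ∑ (λ ω → 2 * F * μ * X ω) Ω + ∑ (λ ω → ⟦ X ω ≡ᵇ 0 ⟧ * (μ * μ)) Ω ≡⟨ ∑-+ _ _ Ω ⟨
    ∑ (λ ω → 2 * F * μ * X ω + ⟦ X ω ≡ᵇ 0 ⟧ * (μ * μ)) Ω ≤⟨ ∑-mono-∈ Ω (λ ω _ → pt (X ω)) ⟩
    ∑ (λ ω → (μ * μ) * 1 + F * F * (X ω * X ω)) Ω ≡⟨ ∑-+ _ _ Ω ⟩
    ∑ (λ ω → (μ * μ) * 1) Ω + ∑ (λ ω → F * F * (X ω * X ω)) Ω ≡⟨ cong₂ _+_ (∑-*ˡ (μ * μ) _ Ω) (∑-*ˡ (F * F) _ Ω) ⟩
    μ * μ * ∑ (λ _ → 1) Ω + F * F * ∑ (λ ω → X ω * X ω) Ω ≡⟨ cong (λ z → z + F * F * ∑ (λ ω → X ω * X ω) Ω) (trans (cong (μ * μ *_) lenΩ) (*-comm (μ * μ) F)) ⟩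
    F * (μ * μ) + F * F * ∑ (λ ω → X ω * X ω) Ω ∎)
    where
    open ≤-Reasoning
    μ = ∑ X Ω
    lem : ∀ F μ z → F * (μ * μ) + (z * (μ * μ) + F * (μ * μ)) ≡ 2 * F * μ * μ + z * (μ * μ)
    lem = solve-∀
    lem₀ : ∀ F μ → 2 * F * μ * 0 + (μ * μ + 0) ≡ μ * μ * 1 + F * F * 0
    lem₀ = solve-∀
    lem₁ : ∀ F μ x → 2 * F * μ * x + 0 ≡ 2 * ((F * x) * μ)
    lem₁ = solve-∀
    lem₂ : ∀ F μ x → (F * x) * (F * x) + μ * μ ≡ μ * μ * 1 + F * F * (x * x)
    lem₂ = solve-∀
    pt : ∀ x → 2 * F * μ * x + ⟦ x ≡ᵇ 0 ⟧ * (μ * μ) ≤ (μ * μ) * 1 + F * F * (x * x)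
    pt zero    = ≤-reflexive (lem₀ F μ)
    pt (suc x) = ≤-trans (≤-reflexive (lem₁ F μ (suc x))) (≤-trans (2ab≤a²+b² (F * suc x) μ) (≤-reflexive (lem₂ F μ (suc x))))

  -- For `b` events with `c₁` outcomes each, any two of which share at most `c₂`: the diagonal
  -- contributes 1 / e to the relative variance because the mean is at least e, and the pairs
  -- contribute 1 / e because they are nearly independent.
  secondMoment : ∀ b c₁ c₂ e → ∑ X Ω ≡ b * c₁ → ∑ (λ ω → X ω * X ω) Ω ≤ b * c₁ + b * b * c₂ →
    e * (F * c₂) ≤ suc e * (c₁ * c₁) → e * F ≤ b * c₁ → 0 < b * c₁ →
    e * # (λ ω → X ω ≡ᵇ 0) Ω ≤ 2 * F
  secondMoment b c₁ c₂ e ∑X ∑X² h₂ h₁ pos = *-cancelʳ-≤ _ _ (b * c₁ * (b * c₁)) {{m*n≢0 _ _ {{>-nonZero pos}} {{>-nonZero pos}}}}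
    (+-cancelʳ-≤ (e * (F * (b * c₁ * (b * c₁)))) _ _ (begin
    e * Z * (b * c₁ * (b * c₁)) + e * (F * (b * c₁ * (b * c₁))) ≡⟨ lem e Z (b * c₁ * (b * c₁)) (F * (b * c₁ * (b * c₁))) ⟩
    e * (Z * (b * c₁ * (b * c₁)) + F * (b * c₁ * (b * c₁))) ≤⟨ *-monoʳ-≤ e (subst (λ μ → Z * (μ * μ) + F * (μ * μ) ≤ F * F * ∑ (λ ω → X ω * X ω) Ω) ∑X chebyshev) ⟩
    e * (F * F * ∑ (λ ω → X ω * X ω) Ω) ≤⟨ *-monoʳ-≤ e (*-monoʳ-≤ (F * F) ∑X²) ⟩
    e * (F * F * (b * c₁ + b * b * c₂)) ≡⟨ lem₁ e F b c₁ c₂ ⟩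
    F * (e * F) * (b * c₁) + F * (b * b) * (e * (F * c₂)) ≤⟨ +-mono-≤ (*-monoˡ-≤ (b * c₁) (*-monoʳ-≤ F h₁)) (*-monoʳ-≤ (F * (b * b)) h₂) ⟩
    F * (b * c₁) * (b * c₁) + F * (b * b) * (suc e * (c₁ * c₁)) ≡⟨ lem₂ F b c₁ e ⟩
    2 * F * (b * c₁ * (b * c₁)) + e * (F * (b * c₁ * (b * c₁))) ∎))
    where
    open ≤-Reasoning
    Z = # (λ ω → X ω ≡ᵇ 0) Ω
    lem : ∀ e z y w → e * z * y + e * w ≡ e * (z * y + w)
    lem = solve-∀
    lem₁ : ∀ e F b c₁ c₂ → e * (F * F * (b * c₁ + b * b * c₂)) ≡ F * (e * F) * (b * c₁) + F * (b * b) * (e * (F * c₂))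
    lem₁ = solve-∀
    lem₂ : ∀ F b c e → F * (b * c) * (b * c) + F * (b * b) * (suc e * (c * c)) ≡ 2 * F * (b * c * (b * c)) + e * (F * (b * c * (b * c)))
    lem₂ = solve-∀

-- Counting subsets

does-true : {P : Set} (d : Dec P) → does d ≡ true → P
does-true (yes p) _ = p

∑-filter : {P : A → Set} (P? : Decidable P) (f : A → ℕ) → ∀ xs → ∑ f (filter P? xs) ≡ ∑ (λ x → if does (P? x) then f x else 0) xs
∑-filter P? f []       = refl
∑-filter P? f (x ∷ xs) with does (P? x)
... | true  = cong (f x +_) (∑-filter P? f xs)
... | false = ∑-filter P? f xs

module _ (_≟_ : DecidableEquality A) where

  member : List A → A → Bool
  member es x = any (λ e → does (x ≟ e)) es

  member-∉ : ∀ es {x} → x ∉ es → member es x ≡ false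
  member-∉ []       x∉ = refl
  member-∉ (e ∷ es) {x} x∉ rewrite dec-false (x ≟ e) (x∉ ∘ here) = member-∉ es (x∉ ∘ there)

  ∈-member : ∀ es {x} → member es x ≡ true → x ∈ es
  ∈-member (e ∷ es) {x} h with x ≟ e
  ... | yes x≡e = here x≡e
  ... | no  _   = there (∈-member es h)

  #-≟≡0 : ∀ {U e} → e ∉ U → # (λ x → does (x ≟ e)) U ≡ 0
  #-≟≡0 {[]}    e∉ = refl
  #-≟≡0 {x ∷ U} {e} e∉ rewrite dec-false (x ≟ e) (λ x≡e → e∉ (here (sym x≡e))) = #-≟≡0 (e∉ ∘ there)

  #-≟≡1 : ∀ {U e} → Unique U → e ∈ U → # (λ x → does (x ≟ e)) U ≡ 1
  #-≟≡1 {x ∷ U} uq@(_ ∷ _) (here refl) rewrite dec-true (x ≟ x) refl = cong suc (#-≟≡0 (Uniqueₚ.Unique[x∷xs]⇒x∉xs uq))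
  #-≟≡1 {x ∷ U} {e} (x∉ ∷ uq) (there e∈) rewrite dec-false (x ≟ e) (All.lookup x∉ e∈) = #-≟≡1 uq e∈

  #-≟≤1 : ∀ {U e} → Unique U → # (λ x → does (x ≟ e)) U ≤ 1
  #-≟≤1 {[]}        uq = z≤n
  #-≟≤1 {x ∷ U} {e} uq@(_ ∷ uq′) with x ≟ e
  ... | yes refl = ≤-reflexive (cong suc (#-≟≡0 (Uniqueₚ.Unique[x∷xs]⇒x∉xs uq)))
  ... | no  _    = #-≟≤1 uq′

  #-member : ∀ {U} es → Unique U → Unique es → All (_∈ U) es → # (member es) U ≡ length es
  #-member {U} []       uqU uq        es∈ = trans (∑-const 0 U) (*-zeroʳ (length U))
  #-member {U} (e ∷ es) uqU uq@(_ ∷ uq′) (e∈ ∷ es∈) = begin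
    # (member (e ∷ es)) U  ≡⟨ ∑-cong pt U ⟩
    ∑ (λ x → ⟦ does (x ≟ e) ⟧ + ⟦ member es x ⟧) U ≡⟨ ∑-+ _ _ U ⟩
    # (λ x → does (x ≟ e)) U + # (member es) U    ≡⟨ cong₂ _+_ (#-≟≡1 uqU e∈) (#-member es uqU uq′ es∈) ⟩
    suc (length es)  ∎
    where
    open ≡-Reasoning
    pt : ∀ x → ⟦ member (e ∷ es) x ⟧ ≡ ⟦ does (x ≟ e) ⟧ + ⟦ member es x ⟧
    pt x with x ≟ e
    ... | yes refl rewrite member-∉ es (Uniqueₚ.Unique[x∷xs]⇒x∉xs uq) = refl
    ... | no  _    = refl

infix 4 _≟ˢ_
_≟ˢ_ : DecidableEquality (Subset n)
_≟ˢ_ = Vecₚ.≡-dec Bool._≟_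

∈-allSubsets : (K : Subset n) → K ∈ allSubsets n
∈-allSubsets []            = here refl
∈-allSubsets (inside  ∷ K) = ∈-++⁺ˡ (∈-map⁺ _ (∈-allSubsets K))
∈-allSubsets (outside ∷ K) = ∈-++⁺ʳ (map (inside ∷_) (allSubsets _)) (∈-map⁺ _ (∈-allSubsets K))

∈-kSets⁺ : {K : Subset n} {k : ℕ} → ∣ K ∣ ≡ k → K ∈ kSets n k
∈-kSets⁺ {K = K} {k} = ∈-filter⁺ (λ s → ∣ s ∣ ℕ.≟ k) (∈-allSubsets K)

∈-kSets⁻ : {K : Subset n} {k : ℕ} → K ∈ kSets n k → ∣ K ∣ ≡ k
∈-kSets⁻ {n = n} {k = k} K∈ = proj₂ (∈-filter⁻ (λ s → ∣ s ∣ ℕ.≟ k) {xs = allSubsets n} K∈)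

Unique-allSubsets : ∀ n → Unique (allSubsets n)
Unique-allSubsets zero    = [] ∷ []
Unique-allSubsets (suc n) = Uniqueₚ.++⁺ (Uniqueₚ.map⁺ Vecₚ.∷-injectiveʳ (Unique-allSubsets n))
  (Uniqueₚ.map⁺ Vecₚ.∷-injectiveʳ (Unique-allSubsets n)) disj
  where
  disj : ∀ {K} → K ∈ map (inside ∷_) (allSubsets n) × K ∈ map (outside ∷_) (allSubsets n) → _
  disj (a , b) with ∈-map⁻ _ a | ∈-map⁻ _ b
  ... | _ , _ , refl | _ , _ , ()

Unique-kSets : ∀ n k → Unique (kSets n k)
Unique-kSets n k = Uniqueₚ.filter⁺ (λ s → ∣ s ∣ ℕ.≟ k) (Unique-allSubsets n)

bin : ℕ → ℕ → ℕ
bin n       zero    = 1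
bin zero    (suc k) = 0
bin (suc n) (suc k) = bin n k + bin n (suc k)

#-kSets : (P : Subset n → Bool) → ∀ k → # P (kSets n k) ≡ # (λ K → (∣ K ∣ ≡ᵇ k) ∧ P K) (allSubsets n)
#-kSets {n} P k = trans (∑-filter (λ s → ∣ s ∣ ℕ.≟ k) _ (allSubsets n)) (∑-cong pt (allSubsets n))
  where
  pt : ∀ K → (if ∣ K ∣ ≡ᵇ k then ⟦ P K ⟧ else 0) ≡ ⟦ (∣ K ∣ ≡ᵇ k) ∧ P K ⟧
  pt K with ∣ K ∣ ≡ᵇ k
  ... | true  = refl
  ... | false = refl

#-allSubsets : (P : Subset (suc n) → Bool) →
  # P (allSubsets (suc n)) ≡ # (P ∘ (inside ∷_)) (allSubsets n) + # (P ∘ (outside ∷_)) (allSubsets n)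
#-allSubsets {n} P = trans (∑-++ _ (map (inside ∷_) (allSubsets n)) _) (cong₂ _+_ (∑-map _ _ (allSubsets n)) (∑-map _ _ (allSubsets n)))

length-kSets : ∀ n k → length (kSets n k) ≡ bin n k
length-kSets n k = trans (sym (length-∑ (kSets n k))) (trans (#-kSets {n} (λ _ → true) k) (go n k))
  where
  go : ∀ n k → # (λ K → (∣ K ∣ ≡ᵇ k) ∧ true) (allSubsets n) ≡ bin n k
  go zero    zero    = refl
  go zero    (suc k) = refl
  go (suc n) zero    = trans (#-allSubsets {n} _) (cong₂ _+_ (∑-0 _ (λ _ → refl) (allSubsets n)) (go n 0))
  go (suc n) (suc k) = trans (#-allSubsets {n} _) (cong₂ _+_ (go n k) (go n (suc k)))

-- binOff c x w is the binomial coefficient of c over w - x, and 0 if w < x.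
binOff : ℕ → ℕ → ℕ → ℕ
binOff c zero    w       = bin c w
binOff c (suc x) zero    = 0
binOff c (suc x) (suc w) = binOff c x w

binOff-0 : ∀ c x → binOff (suc c) x 0 ≡ binOff c x 0
binOff-0 c zero    = refl
binOff-0 c (suc x) = refl

binOff-suc : ∀ c x w → binOff (suc c) x (suc w) ≡ binOff c x w + binOff c x (suc w)
binOff-suc c zero    w       = refl
binOff-suc c (suc x) zero    = binOff-0 c x
binOff-suc c (suc x) (suc w) = binOff-suc c x w

binOff-+ : ∀ c x w → binOff c x (x + w) ≡ bin c w
binOff-+ c zero    w = refl
binOff-+ c (suc x) w = binOff-+ c x w

-- `S` and `A` are disjoint and exactly `c` vertices lie in neither. The inductive form lets counts
-- recurse vertex by vertex.
data Split : {n : ℕ} → Subset n → Subset n → ℕ → Set where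
  nil  : Split [] [] 0
  inS  : {S A : Subset n} {c : ℕ} → Split S A c → Split (inside ∷ S) (outside ∷ A) c
  inA  : {S A : Subset n} {c : ℕ} → Split S A c → Split (outside ∷ S) (inside ∷ A) c
  rest : {S A : Subset n} {c : ℕ} → Split S A c → Split (outside ∷ S) (outside ∷ A) (suc c)

-- A set `K` of this kind is `S`, a choice of i elements of `A`, and a choice of the remaining w -
-- ∣S∣ - i elements among the `c` others. Supersets are the case of empty `A`, boundary sets the
-- case i = 1.
#-split : {S A : Subset n} {c : ℕ} → Split S A c → ∀ i w →
  # (λ K → (∣ K ∣ ≡ᵇ w) ∧ (∣ K ∩ A ∣ ≡ᵇ i) ∧ does (S ⊆? K)) (allSubsets n) ≡ bin ∣ A ∣ i * binOff c (∣ S ∣ + i) w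
#-split nil zero    zero    = refl
#-split nil zero    (suc w) = refl
#-split nil (suc i) zero    = refl
#-split nil (suc i) (suc w) = refl
#-split {suc n} (inS {S = S} {A} {c} sp) i zero    = trans (#-allSubsets {n} _) (trans
  (cong₂ _+_ (∑-0 _ (λ _ → refl) (allSubsets n)) (∑-0 _ (λ K → cong ⟦_⟧ (trans (cong ((∣ K ∣ ≡ᵇ 0) ∧_) (∧-zeroʳ _)) (∧-zeroʳ _))) (allSubsets n)))
  (sym (*-zeroʳ (bin ∣ A ∣ i))))
#-split {suc n} (inS {S = S} {A} {c} sp) i (suc w) = trans (#-allSubsets {n} _) (trans
  (cong₂ _+_ (#-split sp i w) (∑-0 _ (λ K → cong ⟦_⟧ (trans (cong ((∣ K ∣ ≡ᵇ suc w) ∧_) (∧-zeroʳ _)) (∧-zeroʳ _))) (allSubsets n)))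
  (+-identityʳ _))
#-split {suc n} (inA {S = S} {A} {c} sp) zero w = trans (#-allSubsets {n} _) (trans
  (cong₂ _+_ (∑-0 _ (λ K → cong ⟦_⟧ (∧-zeroʳ _)) (allSubsets n)) (#-split sp 0 w))
  refl)
#-split {suc n} (inA {S = S} {A} {c} sp) (suc i) zero = trans (#-allSubsets {n} _) (trans
  (cong₂ _+_ (∑-0 _ (λ K → refl) (allSubsets n)) (#-split sp (suc i) 0))
  (trans (cong (bin ∣ A ∣ (suc i) *_) z) (trans (*-zeroʳ (bin ∣ A ∣ (suc i))) (sym (trans (cong ((bin (suc ∣ A ∣) (suc i)) *_) z) (*-zeroʳ (bin (suc ∣ A ∣) (suc i))))))))
  where
  z : binOff c (∣ S ∣ + suc i) 0 ≡ 0
  z rewrite +-suc ∣ S ∣ i = refl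
#-split {suc n} (inA {S = S} {A} {c} sp) (suc i) (suc w) = trans (#-allSubsets {n} _) (trans
  (cong₂ _+_ (#-split sp i w) (#-split sp (suc i) (suc w)))
  (trans (cong ((bin ∣ A ∣ i) * binOff c (∣ S ∣ + i) w +_) (cong (bin ∣ A ∣ (suc i) *_) z))
   (trans (sym (*-distribʳ-+ (binOff c (∣ S ∣ + i) w) (bin ∣ A ∣ i) (bin ∣ A ∣ (suc i)))) (cong ((bin (suc ∣ A ∣) (suc i)) *_) (sym z)))))
  where
  z : binOff c (∣ S ∣ + suc i) (suc w) ≡ binOff c (∣ S ∣ + i) w
  z rewrite +-suc ∣ S ∣ i = refl
#-split {suc n} (rest {S = S} {A} {c} sp) i zero = trans (#-allSubsets {n} _) (trans
  (cong₂ _+_ (∑-0 _ (λ K → refl) (allSubsets n)) (#-split sp i 0))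
  (cong (bin ∣ A ∣ i *_) (sym (binOff-0 c (∣ S ∣ + i)))))
#-split {suc n} (rest {S = S} {A} {c} sp) i (suc w) = trans (#-allSubsets {n} _) (trans
  (cong₂ _+_ (#-split sp i w) (#-split sp i (suc w)))
  (trans (sym (*-distribˡ-+ (bin ∣ A ∣ i) _ _)) (cong (bin ∣ A ∣ i *_) (sym (binOff-suc c (∣ S ∣ + i) w)))))

split-─ : (S X : Subset n) → S ⊆ X → Split S (X ─ S) (n ∸ ∣ X ∣)
split-─ []            []            _ = nil
split-─ (inside  ∷ S) (inside  ∷ X) h = inS (split-─ S X (drop-∷-⊆ h))
split-─ (inside  ∷ S) (outside ∷ X) h with () ← h here
split-─ (outside ∷ S) (inside  ∷ X) h = inA (split-─ S X (drop-∷-⊆ h))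
split-─ (outside ∷ S) (outside ∷ X) h = subst (Split _ _) (sym (+-∸-assoc 1 (∣p∣≤n X))) (rest (split-─ S X (drop-∷-⊆ h)))

split-⊥ : (S : Subset n) → Split S ⊥ (n ∸ ∣ S ∣)
split-⊥ []            = nil
split-⊥ (inside  ∷ S) = inS (split-⊥ S)
split-⊥ (outside ∷ S) = subst (Split _ _) (sym (+-∸-assoc 1 (∣p∣≤n S))) (rest (split-⊥ S))

⊇ᵇ : Subset n → Subset n → Bool
⊇ᵇ J K = does (J ⊆? K)

#-supersets : (J : Subset n) → ∀ t → # (⊇ᵇ J) (kSets n (∣ J ∣ + t)) ≡ bin (n ∸ ∣ J ∣) t
#-supersets {n} J t = begin
  # (⊇ᵇ J) (kSets n (∣ J ∣ + t))  ≡⟨ #-kSets (⊇ᵇ J) (∣ J ∣ + t) ⟩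
  # (λ K → (∣ K ∣ ≡ᵇ ∣ J ∣ + t) ∧ ⊇ᵇ J K) (allSubsets n) ≡⟨ ∑-cong pt (allSubsets n) ⟩
  # (λ K → (∣ K ∣ ≡ᵇ ∣ J ∣ + t) ∧ (∣ K ∩ ⊥ ∣ ≡ᵇ 0) ∧ ⊇ᵇ J K) (allSubsets n) ≡⟨ #-split (split-⊥ J) 0 (∣ J ∣ + t) ⟩
  1 * binOff (n ∸ ∣ J ∣) (∣ J ∣ + 0) (∣ J ∣ + t)      ≡⟨ *-identityˡ _ ⟩
  binOff (n ∸ ∣ J ∣) (∣ J ∣ + 0) (∣ J ∣ + t)          ≡⟨ cong (λ z → binOff (n ∸ ∣ J ∣) z (∣ J ∣ + t)) (+-identityʳ ∣ J ∣) ⟩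
  binOff (n ∸ ∣ J ∣) ∣ J ∣ (∣ J ∣ + t)  ≡⟨ binOff-+ (n ∸ ∣ J ∣) ∣ J ∣ t ⟩
  bin (n ∸ ∣ J ∣) t  ∎
  where
  open ≡-Reasoning
  pt : ∀ K → ⟦ (∣ K ∣ ≡ᵇ ∣ J ∣ + t) ∧ ⊇ᵇ J K ⟧ ≡ ⟦ (∣ K ∣ ≡ᵇ ∣ J ∣ + t) ∧ (∣ K ∩ ⊥ ∣ ≡ᵇ 0) ∧ ⊇ᵇ J K ⟧
  pt K rewrite ∩-zeroʳ K | ∣⊥∣≡0 n = refl

-- Demanding exactly one vertex of `X ─ S`, not just some, makes the count a plain product, and the
-- other vertices of `K` lie outside `X`, so that sets inside `X` do not interfere.
boundary : Subset n → Subset n → Subset n → Bool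
boundary S X K = (∣ K ∩ (X ─ S) ∣ ≡ᵇ 1) ∧ ⊇ᵇ S K

bin-1 : ∀ n → bin n 1 ≡ n
bin-1 zero    = refl
bin-1 (suc n) = cong suc (bin-1 n)

#-boundary : (S X : Subset n) → S ⊆ X → ∀ t → # (boundary S X) (kSets n (∣ S ∣ + 1 + t)) ≡ ∣ X ─ S ∣ * bin (n ∸ ∣ X ∣) t
#-boundary {n} S X S⊆X t = begin
  # (boundary S X) (kSets n (∣ S ∣ + 1 + t))  ≡⟨ #-kSets (boundary S X) (∣ S ∣ + 1 + t) ⟩
  # (λ K → (∣ K ∣ ≡ᵇ ∣ S ∣ + 1 + t) ∧ boundary S X K) (allSubsets n) ≡⟨ #-split (split-─ S X S⊆X) 1 (∣ S ∣ + 1 + t) ⟩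
  bin ∣ X ─ S ∣ 1 * binOff (n ∸ ∣ X ∣) (∣ S ∣ + 1) (∣ S ∣ + 1 + t)    ≡⟨ cong₂ _*_ (bin-1 ∣ X ─ S ∣) (binOff-+ (n ∸ ∣ X ∣) (∣ S ∣ + 1) t) ⟩
  ∣ X ─ S ∣ * bin (n ∸ ∣ X ∣) t  ∎
  where open ≡-Reasoning

-- Exploring links

∈─⇒∉ : {x : Fin n} (p q : Subset n) → x ∈ˢ p ─ q → x ∉ˢ q
∈─⇒∉ (_ ∷ p) (outside ∷ q) (there x∈) (there x∈q) = ∈─⇒∉ p q x∈ x∈q
∈─⇒∉ (_ ∷ p) (inside  ∷ q) (there x∈) (there x∈q) = ∈─⇒∉ p q x∈ x∈q

∣p∪q∣≡∣p∣+∣q─p∣ : (p q : Subset n) → ∣ p ∪ q ∣ ≡ ∣ p ∣ + ∣ q ─ p ∣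
∣p∪q∣≡∣p∣+∣q─p∣ []            []            = refl
∣p∪q∣≡∣p∣+∣q─p∣ (inside  ∷ p) (_       ∷ q) = cong suc (∣p∪q∣≡∣p∣+∣q─p∣ p q)
∣p∪q∣≡∣p∣+∣q─p∣ (outside ∷ p) (inside  ∷ q) = trans (cong suc (∣p∪q∣≡∣p∣+∣q─p∣ p q)) (sym (+-suc ∣ p ∣ ∣ q ─ p ∣))
∣p∪q∣≡∣p∣+∣q─p∣ (outside ∷ p) (outside ∷ q) = ∣p∪q∣≡∣p∣+∣q─p∣ p q

∪-⊆ : {p q r : Subset n} → p ⊆ r → q ⊆ r → p ∪ q ⊆ r
∪-⊆ {p = p} {q} p⊆r q⊆r x∈ with x∈p∪q⁻ p q x∈
... | inj₁ x∈p = p⊆r x∈p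
... | inj₂ x∈q = q⊆r x∈q

∪⁅⁆-⊆ : {p r : Subset n} {x : Fin n} → p ⊆ r → x ∈ˢ r → p ∪ ⁅ x ⁆ ⊆ r
∪⁅⁆-⊆ {r = r} {x} p⊆r x∈r = ∪-⊆ p⊆r (λ y∈ → subst (_∈ˢ r) (sym (x∈⁅y⁆⇒x≡y x y∈)) x∈r)

∣S∣+∣X─S∣ : {S X : Subset n} → S ⊆ X → ∣ S ∣ + ∣ X ─ S ∣ ≡ ∣ X ∣
∣S∣+∣X─S∣ {S = S} {X} S⊆X = trans (sym (∣p∪q∣≡∣p∣+∣q─p∣ S X))
  (cong ∣_∣ (⊆-antisym (∪-⊆ S⊆X ⊆-refl) (q⊆p∪q S X)))

∣p∪⁅x⁆∣ : (p : Subset n) {x : Fin n} → x ∉ˢ p → ∣ p ∪ ⁅ x ⁆ ∣ ≡ suc ∣ p ∣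
∣p∪⁅x⁆∣ p {x} x∉ = trans (∣p∪q∣≡∣p∣+∣q─p∣ p ⁅ x ⁆) (trans (cong (∣ p ∣ +_) one) (+-comm ∣ p ∣ 1))
  where
  one : ∣ ⁅ x ⁆ ─ p ∣ ≡ 1
  one = trans (cong ∣_∣ (⊆-antisym (p─q⊆p ⁅ x ⁆ p)
    (λ y∈ → x∈p∧x∉q⇒x∈p─q y∈ (subst (_∉ˢ p) (sym (x∈⁅y⁆⇒x≡y x y∈)) x∉)))) (∣⁅x⁆∣≡1 x)

∣p∣>0⇒nonempty : (p : Subset n) → 0 < ∣ p ∣ → Nonempty p
∣p∣>0⇒nonempty {n} p pos with nonempty? p
... | yes ne = ne
... | no ¬ne = contradiction (subst (0 <_) (trans (cong ∣_∣ (Empty-unique ¬ne)) (∣⊥∣≡0 n)) pos) (<-irrefl refl)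

¬⊆⇒0<∣─∣ : (p q : Subset n) → ¬ (p ⊆ q) → 0 < ∣ p ─ q ∣
¬⊆⇒0<∣─∣ {n} p q ¬⊆ with nonempty? (p ─ q)
... | yes (x , x∈) = subst (_≤ ∣ p ─ q ∣) (∣⁅x⁆∣≡1 x) (p⊆q⇒∣p∣≤∣q∣ (λ y∈ → subst (_∈ˢ p ─ q) (sym (x∈⁅y⁆⇒x≡y x y∈)) x∈))
... | no ¬ne = contradiction (λ {x} x∈ → decidable-stable (x ∈? q) (λ x∉ → ¬ne (x , x∈p∧x∉q⇒x∈p─q x∈ x∉))) ¬⊆

⊈-sym : {p q : Subset n} → ∣ p ∣ ≡ ∣ q ∣ → ¬ (q ⊆ p) → ¬ (p ⊆ q)
⊈-sym {p = p} {q} eq q⊈p p⊆q = <-irrefl (trans eq (sym (∣S∣+∣X─S∣ p⊆q))) (m<m+n ∣ p ∣ (¬⊆⇒0<∣─∣ q p q⊈p))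

-- `K` has two vertices in `X ─ S`. This is used for the edges of a closed component and for the
-- edges that explore it: the sets required to be absent and those required to be present are
-- disjoint.
inner⇒¬boundary : {S X K : Subset n} → S ⊆ K → K ⊆ X → 2 + ∣ S ∣ ≤ ∣ K ∣ → boundary S X K ≡ false
inner⇒¬boundary {S = S} {X} {K} S⊆K K⊆X 2+∣S∣≤∣K∣ = cong (_∧ ⊇ᵇ S K) (≢1 ∣ K ∩ (X ─ S) ∣ (begin
  2  ≤⟨ +-cancelˡ-≤ ∣ S ∣ _ _ (≤-trans (≤-reflexive (+-comm ∣ S ∣ 2)) (≤-trans 2+∣S∣≤∣K∣ (≤-reflexive (sym (∣S∣+∣X─S∣ S⊆K))))) ⟩
  ∣ K ─ S ∣        ≤⟨ p⊆q⇒∣p∣≤∣q∣ (λ x∈ → x∈p∩q⁺ (p─q⊆p K S x∈ , x∈p∧x∉q⇒x∈p─q (K⊆X (p─q⊆p K S x∈)) (∈─⇒∉ K S x∈))) ⟩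
  ∣ K ∩ (X ─ S) ∣  ∎))
  where
  open ≤-Reasoning
  ≢1 : ∀ a → 2 ≤ a → (a ≡ᵇ 1) ≡ false
  ≢1 (suc (suc a)) _ = refl
  ≢1 (suc zero) (s≤s ())

elems : Subset n → List (Fin n)
elems []            = []
elems (inside  ∷ p) = zero ∷ map suc (elems p)
elems (outside ∷ p) = map suc (elems p)

length-elems : (p : Subset n) → length (elems p) ≡ ∣ p ∣
length-elems []            = refl
length-elems (inside  ∷ p) = cong suc (trans (length-map suc (elems p)) (length-elems p))
length-elems (outside ∷ p) = trans (length-map suc (elems p)) (length-elems p)

∈-elems⁺ : {p : Subset n} {x : Fin n} → x ∈ˢ p → x ∈ elems p
∈-elems⁺ {p = inside  ∷ p} here       = here refl
∈-elems⁺ {p = inside  ∷ p} (there x∈) = there (∈-map⁺ suc (∈-elems⁺ x∈))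
∈-elems⁺ {p = outside ∷ p} (there x∈) = ∈-map⁺ suc (∈-elems⁺ x∈)

∈-elems⁻ : {p : Subset n} {x : Fin n} → x ∈ elems p → x ∈ˢ p
∈-elems⁻ {p = inside  ∷ p} (here refl) = here
∈-elems⁻ {p = inside  ∷ p} (there x∈) with _ , y∈ , refl ← ∈-map⁻ suc x∈ = there (∈-elems⁻ y∈)
∈-elems⁻ {p = outside ∷ p} x∈ with _ , y∈ , refl ← ∈-map⁻ suc x∈ = there (∈-elems⁻ y∈)

module _ (k : ℕ) (S : Subset n) where

  extension? : (X : Subset n) (v : Fin n) (e : Subset n) → Dec ((S ∪ ⁅ v ⁆ ⊆ e) × ¬ (e ⊆ X))
  extension? X v e = (S ∪ ⁅ v ⁆ ⊆? e) ×-dec ¬? (e ⊆? X)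

  extensions : Subset n → Fin n → List (Subset n)
  extensions X v = filter (extension? X v) (kSets n k)

  -- A run explores the link of S: X is the set of vertices seen so far (including S), the queue holds the
  -- vertices that may still have unexplored edges, and T collects the edges used.  Each of at most f steps
  -- drops the first vertex of the queue or uses an edge through it that leaves X.
  runs : ℕ → Subset n → List (Fin n) → List (Subset n) → List (Subset n × List (Subset n))
  runs f       X []      T = (X , T) ∷ []
  runs zero    X (v ∷ Q) T = []
  runs (suc f) X (v ∷ Q) T =
    runs f X Q T ++ concatMap (λ e → runs f (X ∪ e) (elems (e ─ X) ++ v ∷ Q) (e ∷ T)) (extensions X v)

module Explore {k : ℕ} {S : Subset n} {H : Hypergraph n} (H⊆ : ∀ {e} → e ∈ H → ∣ e ∣ ≡ k)
  (C : Fin n → Set) (closedC : ∀ {e x u} → e ∈ H → S ⊆ e → x ∈ˢ e → C x → u ∈ˢ e → u ∉ˢ S → C u) where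

  -- The outcome of exploring from a given state. In `isRun` the fuel is measured by length Q + 2
  -- (∣Xf∣ - ∣X∣): dropping a vertex lowers it by 1, and an edge with δ new vertices lengthens the
  -- queue by δ but lowers the second term by 2 δ. Since the final `Xf` enters and not n, a
  -- component of s vertices is reached within 2 s steps.
  record Explored (X : Subset n) (Q : List (Fin n)) (T : List (Subset n)) : Set where
    field
      Xf     : Subset n
      Tf     : List (Subset n)
      X⊆Xf   : X ⊆ Xf
      Tf⊆H   : All (_∈ H) Tf
      isRun  : ∀ f → length Q + 2 * ∣ Xf ∣ ≤ f + 2 * ∣ X ∣ → (Xf , Tf) ∈ runs k S f X Q T
      allC   : ∀ {u} → u ∈ˢ Xf → u ∉ˢ S → C u
      closed : ∀ {u e} → u ∈ Q ⊎ (u ∈ˢ Xf × u ∉ˢ X) → e ∈ H → S ∪ ⁅ u ⁆ ⊆ e → e ⊆ Xf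

  open Explored

  -- Use edges of `H` through the head of the queue as long as one leaves `X`, then drop the head.
  -- The bound `g` is the fuel measure with n in place of the still unknown size of `Xf`.
  explore : ∀ g X Q T → S ⊆ X → 2 * (n ∸ ∣ X ∣) + length Q ≤ g → (∀ {u} → u ∈ˢ X → u ∉ˢ S → C u) →
    (∀ {u} → u ∈ Q → C u) → All (_∈ H) T → Explored X Q T
  explore g X [] T _ _ CX CQ T⊆H = record
    { Xf = X ; Tf = T ; X⊆Xf = λ x → x ; Tf⊆H = T⊆H ; isRun = λ _ _ → here refl ; allC = CX
    ; closed = λ { (inj₂ (u∈ , u∉)) → contradiction u∈ u∉ } }
  explore zero X (v ∷ Q) T _ m≤g with () ← ≤-trans (m≤n+m (suc (length Q)) (2 * (n ∸ ∣ X ∣))) m≤g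
  explore (suc g) X (v ∷ Q) T S⊆X m≤g CX CQ T⊆H with any? (extension? k S X v) H
  ... | no none = record
    { Xf = Xf ex ; Tf = Tf ex ; X⊆Xf = X⊆Xf ex ; Tf⊆H = Tf⊆H ex ; isRun = run ; allC = allC ex ; closed = cl }
    where
    ex : Explored X Q T
    ex = explore g X Q T S⊆X (≤-pred (subst (_≤ suc g) (+-suc _ _) m≤g)) CX (CQ ∘ there) T⊆H
    run : ∀ f → suc (length Q) + 2 * ∣ Xf ex ∣ ≤ f + 2 * ∣ X ∣ → (Xf ex , Tf ex) ∈ runs k S f X (v ∷ Q) T
    run zero h = contradiction (≤-trans h (*-monoʳ-≤ 2 (p⊆q⇒∣p∣≤∣q∣ (X⊆Xf ex)))) (<⇒≱ (s≤s (m≤n+m _ (length Q))))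
    run (suc f) (s≤s h) = ∈-++⁺ˡ (isRun ex f h)
    cl : ∀ {u e} → u ∈ v ∷ Q ⊎ (u ∈ˢ Xf ex × u ∉ˢ X) → e ∈ H → S ∪ ⁅ u ⁆ ⊆ e → e ⊆ Xf ex
    -- `v` is dropped only when all edges through it lie in `X`, and `X` only grows afterwards.
    cl (inj₁ (here refl)) e∈ ⊆e = ⊆-trans (decidable-stable (_ ⊆? X) (λ ¬⊆ → none (lose e∈ (⊆e , ¬⊆)))) (X⊆Xf ex)
    cl (inj₁ (there u∈))  e∈ ⊆e = closed ex (inj₁ u∈) e∈ ⊆e
    cl (inj₂ u∈)          e∈ ⊆e = closed ex (inj₂ u∈) e∈ ⊆e
  ... | yes found with e , e∈ , Sv⊆e , e⊈X ← find found = record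
    { Xf = Xf ex ; Tf = Tf ex ; X⊆Xf = ⊆-trans (p⊆p∪q e) (X⊆Xf ex) ; Tf⊆H = Tf⊆H ex ; isRun = run ; allC = allC ex ; closed = cl }
    where
    Q′ = elems (e ─ X) ++ v ∷ Q
    δ = ∣ e ─ X ∣
    lenQ′ : length Q′ ≡ δ + suc (length Q)
    lenQ′ = trans (length-++ (elems (e ─ X))) (cong (_+ suc (length Q)) (length-elems (e ─ X)))
    size : ∣ X ∪ e ∣ ≡ ∣ X ∣ + δ
    size = ∣p∪q∣≡∣p∣+∣q─p∣ X e
    δ>0 : 0 < δ
    δ>0 = ¬⊆⇒0<∣─∣ e X e⊈X
    rem : (n ∸ ∣ X ∪ e ∣) + δ ≡ n ∸ ∣ X ∣
    rem = trans (cong (λ z → n ∸ z + δ) size) (trans (cong (_+ δ) (sym (∸-+-assoc n ∣ X ∣ δ)))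
      (m∸n+n≡m (m+n≤o⇒n≤o∸m ∣ X ∣ (subst (_≤ n) size (∣p∣≤n (X ∪ e))))))
      where
      m+n≤o⇒n≤o∸m : ∀ m {n o} → m + n ≤ o → n ≤ o ∸ m
      m+n≤o⇒n≤o∸m m {n} {o} h = m+n≤o⇒m≤o∸n n (subst (_≤ o) (+-comm m n) h)
    measure : 2 * (n ∸ ∣ X ∪ e ∣) + length Q′ ≤ g
    measure = ≤-pred (begin
      suc (2 * (n ∸ ∣ X ∪ e ∣) + length Q′)  ≡⟨ cong (λ z → suc (2 * (n ∸ ∣ X ∪ e ∣) + z)) lenQ′ ⟩
      suc (2 * (n ∸ ∣ X ∪ e ∣) + (δ + suc (length Q)))     ≡⟨ lem (n ∸ ∣ X ∪ e ∣) δ (suc (length Q)) ⟩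
      1 + (2 * (n ∸ ∣ X ∪ e ∣) + δ + suc (length Q))       ≤⟨ +-monoˡ-≤ _ δ>0 ⟩
      δ + (2 * (n ∸ ∣ X ∪ e ∣) + δ + suc (length Q))       ≡⟨ lem₂ (n ∸ ∣ X ∪ e ∣) δ (suc (length Q)) ⟩
      2 * (n ∸ ∣ X ∪ e ∣ + δ) + suc (length Q)             ≡⟨ cong (λ z → 2 * z + suc (length Q)) rem ⟩
      2 * (n ∸ ∣ X ∣) + suc (length Q)  ≤⟨ m≤g ⟩
      suc g  ∎)
      where
      open ≤-Reasoning
      lem : ∀ r d q → suc (2 * r + (d + q)) ≡ 1 + (2 * r + d + q)
      lem = solve-∀
      lem₂ : ∀ r d q → d + (2 * r + d + q) ≡ 2 * (r + d) + q
      lem₂ = solve-∀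
    v∈e : v ∈ˢ e
    v∈e = Sv⊆e (x∈p∪q⁺ (inj₂ (x∈⁅x⁆ v)))
    S⊆e : S ⊆ e
    S⊆e = Sv⊆e ∘ x∈p∪q⁺ ∘ inj₁
    Ce : ∀ {u} → u ∈ˢ e → u ∉ˢ S → C u
    Ce = closedC e∈ S⊆e v∈e (CQ (here refl))
    CX′ : ∀ {u} → u ∈ˢ X ∪ e → u ∉ˢ S → C u
    CX′ u∈ u∉S with x∈p∪q⁻ X e u∈
    ... | inj₁ u∈X = CX u∈X u∉S
    ... | inj₂ u∈e = Ce u∈e u∉S
    CQ′ : ∀ {u} → u ∈ Q′ → C u
    CQ′ u∈ with ∈-++⁻ (elems (e ─ X)) u∈
    ... | inj₂ u∈Q = CQ u∈Q
    ... | inj₁ u∈new = Ce (p─q⊆p e X (∈-elems⁻ u∈new)) (∈─⇒∉ e X (∈-elems⁻ u∈new) ∘ S⊆X)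
    ex : Explored (X ∪ e) Q′ (e ∷ T)
    ex = explore g (X ∪ e) Q′ (e ∷ T) (⊆-trans S⊆X (p⊆p∪q e)) measure CX′ CQ′ (e∈ ∷ T⊆H)
    run : ∀ f → suc (length Q) + 2 * ∣ Xf ex ∣ ≤ f + 2 * ∣ X ∣ → (Xf ex , Tf ex) ∈ runs k S f X (v ∷ Q) T
    run zero h = contradiction (≤-trans h (*-monoʳ-≤ 2 (p⊆q⇒∣p∣≤∣q∣ (⊆-trans (p⊆p∪q e) (X⊆Xf ex))))) (<⇒≱ (s≤s (m≤n+m _ (length Q))))
    run (suc f) (s≤s h) = ∈-++⁺ʳ (runs k S f X Q T) (∈-concatMap⁺ _ (lose (∈-filter⁺ (extension? k S X v) (∈-kSets⁺ (H⊆ e∈)) (Sv⊆e , e⊈X))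
      (isRun ex f (begin
        length Q′ + 2 * ∣ Xf ex ∣ ≡⟨ cong (_+ 2 * ∣ Xf ex ∣) lenQ′ ⟩
        δ + suc (length Q) + 2 * ∣ Xf ex ∣ ≡⟨ lem δ (length Q) (2 * ∣ Xf ex ∣) ⟩
        (1 + δ) + (length Q + 2 * ∣ Xf ex ∣) ≤⟨ +-mono-≤ (+-monoˡ-≤ δ δ>0) h ⟩
        (δ + δ) + (f + 2 * ∣ X ∣) ≡⟨ lem₂ δ f ∣ X ∣ ⟩
        f + 2 * (∣ X ∣ + δ) ≡⟨ cong (λ z → f + 2 * z) size ⟨
        f + 2 * ∣ X ∪ e ∣ ∎))))
      where
      open ≤-Reasoning
      lem : ∀ d q x → d + suc q + x ≡ (1 + d) + (q + x)
      lem = solve-∀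
      lem₂ : ∀ d f x → (d + d) + (f + 2 * x) ≡ f + 2 * (x + d)
      lem₂ = solve-∀
    cl : ∀ {u e′} → u ∈ v ∷ Q ⊎ (u ∈ˢ Xf ex × u ∉ˢ X) → e′ ∈ H → S ∪ ⁅ u ⁆ ⊆ e′ → e′ ⊆ Xf ex
    cl (inj₁ u∈)          = closed ex (inj₁ (∈-++⁺ʳ (elems (e ─ X)) u∈))
    cl {u} (inj₂ (u∈ , u∉X)) with u ∈? e
    ... | yes u∈e = closed ex (inj₁ (∈-++⁺ˡ (∈-elems⁺ (x∈p∧x∉q⇒x∈p─q u∈e u∉X))))
    ... | no  u∉e = closed ex (inj₂ (u∈ , λ u∈∪ → [ u∉X , u∉e ]′ (x∈p∪q⁻ X e u∈∪)))

-- From connected links to j-connectedness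

module _ {H : Hypergraph n} {j : ℕ} where

  -- At the joint both edges contain `J₂`, so they share at least j vertices.
  Reach-trans : ∀ {J₁ J₂ e e′} → Reach H j J₁ e → J₂ ⊆ e → j ≤ ∣ J₂ ∣ → Reach H j J₂ e′ → Reach H j J₁ e′
  Reach-trans r J₂⊆e j≤ (start e′∈ J₂⊆e′)  = step r e′∈ (≤-trans j≤ (p⊆q⇒∣p∣≤∣q∣ (λ x∈ → x∈p∩q⁺ (J₂⊆e x∈ , J₂⊆e′ x∈))))
  Reach-trans r J₂⊆e j≤ (step r′ e′∈ j≤∩) = step (Reach-trans r J₂⊆e j≤ r′) e′∈ j≤∩

  JConnectedSets-trans : ∀ {J₁ J₂ J₃} → j ≤ ∣ J₂ ∣ → JConnectedSets H j J₁ J₂ → JConnectedSets H j J₂ J₃ → JConnectedSets H j J₁ J₃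
  JConnectedSets-trans j≤ (e , r , J₂⊆e) (e′ , r′ , J₃⊆e′) = e′ , Reach-trans r J₂⊆e j≤ r′ , J₃⊆e′

Reach⇒covered : {H : Hypergraph n} {j : ℕ} {J e : Subset n} → Reach H j J e → ∃[ e′ ] (e′ ∈ H × J ⊆ e′)
Reach⇒covered (start e∈ J⊆) = _ , e∈ , J⊆
Reach⇒covered (step r _ _)  = Reach⇒covered r

JConnected⇒NoIsolatedJSet : {H : Hypergraph n} {j : ℕ} → JConnected H j → NoIsolatedJSet H j
JConnected⇒NoIsolatedJSet conn J ∣J∣ iso =
  let _ , r , _ = conn J J ∣J∣ ∣J∣
      e , e∈ , J⊆ = Reach⇒covered r
  in iso e e∈ J⊆

covered : {H : Hypergraph n} {j : ℕ} → NoIsolatedJSet H j → ∀ {J} → ∣ J ∣ ≡ j → ∃[ e ] (e ∈ H × J ⊆ e)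
covered {H = H} noIso {J} ∣J∣ with any? (J ⊆?_) H
... | yes found = find found
... | no  none  = ⊥-elim (noIso J ∣J∣ (λ e e∈ J⊆ → none (lose {P = J ⊆_} e∈ J⊆)))

∣p∣+∣q∣≤∣r∣ : {p q r : Subset n} → p ⊆ r → q ⊆ r → ¬ Nonempty (p ∩ q) → ∣ p ∣ + ∣ q ∣ ≤ ∣ r ∣
∣p∣+∣q∣≤∣r∣ {p = p} {q} {r} p⊆r q⊆r disj = begin
  ∣ p ∣ + ∣ q ∣     ≤⟨ +-monoʳ-≤ ∣ p ∣ (p⊆q⇒∣p∣≤∣q∣ (λ x∈q → x∈p∧x∉q⇒x∈p─q x∈q (λ x∈p → disj (_ , x∈p∩q⁺ (x∈p , x∈q))))) ⟩
  ∣ p ∣ + ∣ q ─ p ∣ ≡⟨ ∣p∪q∣≡∣p∣+∣q─p∣ p q ⟨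
  ∣ p ∪ q ∣         ≤⟨ p⊆q⇒∣p∣≤∣q∣ (∪-⊆ p⊆r q⊆r) ⟩
  ∣ r ∣             ∎
  where open ≤-Reasoning

module _ {k i : ℕ} (2+i≤k : 2 + i ≤ k) {H : Hypergraph n} (H⊆ : ∀ {e} → e ∈ H → ∣ e ∣ ≡ k)
  (noIso : NoIsolatedJSet H (suc i))
  (noSmall : ∀ S v s Xf Tf → ∣ S ∣ ≡ i → v ∉ˢ S → 2 ≤ s → 2 * s ≤ n ∸ i →
    (Xf , Tf) ∈ runs k S (2 * s) (S ∪ ⁅ v ⁆) (v ∷ []) [] → ∣ Xf ∣ ≡ i + s →
    All (_∈ H) Tf → ¬ All (λ e → boundary S Xf e ≡ false) H) where

  private
    Conn : Subset n → Subset n → Set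
    Conn = JConnectedSets H (suc i)

  module _ {S : Subset n} (∣S∣ : ∣ S ∣ ≡ i) where

    private
      size : ∀ {u} → u ∉ˢ S → ∣ S ∪ ⁅ u ⁆ ∣ ≡ suc i
      size u∉ = trans (∣p∪⁅x⁆∣ S u∉) (cong suc ∣S∣)

    -- Connections are carried in both directions because paths through components of `v` and `w`
    -- are later composed at a common vertex, one of them backwards.
    Joined : Fin n → Fin n → Set
    Joined v u = u ∉ˢ S × Conn (S ∪ ⁅ v ⁆) (S ∪ ⁅ u ⁆) × Conn (S ∪ ⁅ u ⁆) (S ∪ ⁅ v ⁆)

    Joined-edge : ∀ v {e x u} → e ∈ H → S ⊆ e → x ∈ˢ e → Joined v x → u ∈ˢ e → u ∉ˢ S → Joined v u
    Joined-edge v {e} e∈ S⊆e x∈e (x∉S , vx , xv) u∈e u∉S = u∉S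
      , JConnectedSets-trans (≤-reflexive (sym (size x∉S))) vx (e , start e∈ (∪⁅⁆-⊆ S⊆e x∈e) , ∪⁅⁆-⊆ S⊆e u∈e)
      , JConnectedSets-trans (≤-reflexive (sym (size x∉S))) (e , start e∈ (∪⁅⁆-⊆ S⊆e u∈e) , ∪⁅⁆-⊆ S⊆e x∈e) xv

    module _ {v : Fin n} (v∉S : v ∉ˢ S) where

      open Explore {k = k} {S = S} H⊆ (Joined v) (Joined-edge v)

      abstract
        component : Explored (S ∪ ⁅ v ⁆) (v ∷ []) []
        component = explore _ (S ∪ ⁅ v ⁆) (v ∷ []) [] (p⊆p∪q ⁅ v ⁆) ≤-refl CX (λ { (here refl) → self }) []
          where
          self : Joined v v
          self with e , e∈ , ⊆e ← covered noIso (size v∉S) = v∉S , (e , start e∈ ⊆e , ⊆e) , (e , start e∈ ⊆e , ⊆e)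
          CX : ∀ {u} → u ∈ˢ S ∪ ⁅ v ⁆ → u ∉ˢ S → Joined v u
          CX u∈ u∉S with x∈p∪q⁻ S ⁅ v ⁆ u∈
          ... | inj₁ u∈S = contradiction u∈S u∉S
          ... | inj₂ u∈v with refl ← x∈⁅y⁆⇒x≡y v u∈v = self

      open Explored component

      S⊆Xf : S ⊆ Xf
      S⊆Xf = ⊆-trans (p⊆p∪q ⁅ v ⁆) X⊆Xf

      closed-Xf : ∀ {u e} → u ∈ˢ Xf → u ∉ˢ S → e ∈ H → S ⊆ e → u ∈ˢ e → e ⊆ Xf
      closed-Xf {u} u∈ u∉S e∈ S⊆e u∈e with u ∈? (S ∪ ⁅ v ⁆)
      ... | no  u∉ = closed (inj₂ (u∈ , u∉)) e∈ (∪⁅⁆-⊆ S⊆e u∈e)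
      ... | yes u∈Sv with x∈p∪q⁻ S ⁅ v ⁆ u∈Sv
      ...   | inj₁ u∈S = contradiction u∈S u∉S
      ...   | inj₂ u∈v = closed (inj₁ (here (x∈⁅y⁆⇒x≡y v u∈v))) e∈ (∪⁅⁆-⊆ S⊆e u∈e)

      noBoundary : All (λ e → boundary S Xf e ≡ false) H
      noBoundary = All.tabulate (λ {e} e∈ → cases e∈ (nonempty? (e ∩ (Xf ─ S))) (S ⊆? e))
        where
        cases : ∀ {e} → e ∈ H → Dec (Nonempty (e ∩ (Xf ─ S))) → Dec (S ⊆ e) → boundary S Xf e ≡ false
        cases {e} e∈ (no empty)     _        = cong (_∧ ⊇ᵇ S e) (cong (_≡ᵇ 1) (trans (cong ∣_∣ (Empty-unique empty)) (∣⊥∣≡0 n)))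
        cases {e} e∈ (yes _)        (no S⊈e) = trans (cong ((∣ e ∩ (Xf ─ S) ∣ ≡ᵇ 1) ∧_) (dec-false (S ⊆? e) S⊈e)) (∧-zeroʳ _)
        cases {e} e∈ (yes (u , u∈)) (yes S⊆e) = inner⇒¬boundary S⊆e (closed-Xf (p─q⊆p Xf S u∈A) (∈─⇒∉ Xf S u∈A) e∈ S⊆e u∈e)
                                         (subst (2 + ∣ S ∣ ≤_) (sym (H⊆ e∈)) (subst (λ z → 2 + z ≤ k) (sym ∣S∣) 2+i≤k))
          where
          u∈e = proj₁ (x∈p∩q⁻ e (Xf ─ S) u∈)
          u∈A = proj₂ (x∈p∩q⁻ e (Xf ─ S) u∈)

      -- The component of `v` in the link of `S` is closed, so none of its boundary sets is an edge.
      -- If it had at most half of the vertices, its exploration would be excluded by `noSmall`.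
      component-large : n ∸ i < 2 * ∣ Xf ─ S ∣
      component-large = ≰⇒> λ small → noSmall S v s Xf Tf ∣S∣ v∉S 2≤s small (isRun (2 * s) enough) ∣Xf∣ Tf⊆H noBoundary
        where
        s = ∣ Xf ─ S ∣
        ∣Xf∣ : ∣ Xf ∣ ≡ i + s
        ∣Xf∣ = trans (sym (∣S∣+∣X─S∣ S⊆Xf)) (cong (_+ s) ∣S∣)
        2≤s : 2 ≤ s
        -- Absence of isolated j-sets excludes components with one vertex: an edge covers `S` and
        -- `v`, lies in the component and has at least two vertices outside `S`.
        2≤s with e , e∈ , ⊆e ← covered noIso (size v∉S) = +-cancelˡ-≤ i _ _ (begin
          i + 2     ≡⟨ +-comm i 2 ⟩
          2 + i     ≤⟨ 2+i≤k ⟩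
          k         ≡⟨ H⊆ e∈ ⟨
          ∣ e ∣     ≤⟨ p⊆q⇒∣p∣≤∣q∣ (closed (inj₁ (here refl)) e∈ ⊆e) ⟩
          ∣ Xf ∣    ≡⟨ ∣Xf∣ ⟩
          i + s     ∎)
          where open ≤-Reasoning
        enough : 1 + 2 * ∣ Xf ∣ ≤ 2 * s + 2 * ∣ S ∪ ⁅ v ⁆ ∣
        enough = begin
          1 + 2 * ∣ Xf ∣  ≡⟨ cong (λ z → 1 + 2 * z) ∣Xf∣ ⟩
          1 + 2 * (i + s)               ≤⟨ n≤1+n _ ⟩
          suc (1 + 2 * (i + s))         ≡⟨ lem i s ⟩
          2 * s + 2 * suc i             ≡⟨ cong (λ z → 2 * s + 2 * z) (size v∉S) ⟨
          2 * s + 2 * ∣ S ∪ ⁅ v ⁆ ∣     ∎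
          where
          open ≤-Reasoning
          lem : ∀ i s → suc (1 + 2 * (i + s)) ≡ 2 * s + 2 * suc i
          lem = solve-∀

    -- Two components with more than half of the vertices outside `S` each have a common vertex.
    joined : ∀ {v w} → v ∉ˢ S → w ∉ˢ S → Conn (S ∪ ⁅ v ⁆) (S ∪ ⁅ w ⁆)
    joined {v} {w} v∉ w∉ with nonempty? ((Explore.Explored.Xf (component v∉) ─ S) ∩ (Explore.Explored.Xf (component w∉) ─ S))
    ... | yes (u , u∈) with u∈v , u∈w ← x∈p∩q⁻ (_ ─ S) (_ ─ S) u∈ =
      JConnectedSets-trans (≤-reflexive (sym (size (∈─⇒∉ _ S u∈v))))
        (proj₁ (proj₂ (Explore.Explored.allC (component v∉) (p─q⊆p _ S u∈v) (∈─⇒∉ _ S u∈v))))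
        (proj₂ (proj₂ (Explore.Explored.allC (component w∉) (p─q⊆p _ S u∈w) (∈─⇒∉ _ S u∈w))))
    ... | no disj = contradiction both (<⇒≱ (+-mono-< (component-large v∉) (component-large w∉)))
      where
      Xv = Explore.Explored.Xf (component v∉)
      Xw = Explore.Explored.Xf (component w∉)
      ⊆∁ : ∀ X → X ─ S ⊆ ∁ S
      ⊆∁ X x∈ = x∉p⇒x∈∁p (∈─⇒∉ X S x∈)
      both : 2 * ∣ Xv ─ S ∣ + 2 * ∣ Xw ─ S ∣ ≤ (n ∸ i) + (n ∸ i)
      both = begin
        2 * ∣ Xv ─ S ∣ + 2 * ∣ Xw ─ S ∣ ≡⟨ *-distribˡ-+ 2 ∣ Xv ─ S ∣ _ ⟨
        2 * (∣ Xv ─ S ∣ + ∣ Xw ─ S ∣)   ≤⟨ *-monoʳ-≤ 2 (∣p∣+∣q∣≤∣r∣ (⊆∁ Xv) (⊆∁ Xw) disj) ⟩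
        2 * ∣ ∁ S ∣  ≡⟨ cong (2 *_) (trans (∣∁p∣≡n∸∣p∣ S) (cong (n ∸_) ∣S∣)) ⟩
        2 * (n ∸ i)  ≡⟨ cong ((n ∸ i) +_) (+-identityʳ (n ∸ i)) ⟩
        (n ∸ i) + (n ∸ i)               ∎
        where open ≤-Reasoning

  private
    -- Replace some x of `J₁ ─ J₂` by some y of `J₂ ─ J₁`. Both sets contain `J₁ - x`, in whose link
    -- x and y are joined, and the new set is closer to `J₂`.
    exchange : ∀ g J₁ J₂ → ∣ J₁ ∣ ≡ suc i → ∣ J₂ ∣ ≡ suc i → ∣ J₂ ─ J₁ ∣ ≤ g → Conn J₁ J₂
    exchange g J₁ J₂ ∣J₁∣ ∣J₂∣ ≤g with J₂ ⊆? J₁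
    ... | yes J₂⊆J₁ with e , e∈ , J₁⊆e ← covered noIso ∣J₁∣ = e , start e∈ J₁⊆e , ⊆-trans J₂⊆J₁ J₁⊆e
    exchange zero J₁ J₂ ∣J₁∣ ∣J₂∣ ≤g | no J₂⊈J₁ = contradiction ≤g (<⇒≱ (¬⊆⇒0<∣─∣ J₂ J₁ J₂⊈J₁))
    exchange (suc g) J₁ J₂ ∣J₁∣ ∣J₂∣ ≤g | no J₂⊈J₁
      with y , y∈ ← ∣p∣>0⇒nonempty (J₂ ─ J₁) (¬⊆⇒0<∣─∣ J₂ J₁ J₂⊈J₁)
         | x , x∈ ← ∣p∣>0⇒nonempty (J₁ ─ J₂) (¬⊆⇒0<∣─∣ J₁ J₂ (⊈-sym (trans ∣J₁∣ (sym ∣J₂∣)) J₂⊈J₁))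
      = JConnectedSets-trans (≤-reflexive (sym ∣J′∣)) (subst (λ J → Conn J J′) S∪x (joined ∣S∣ x∉S y∉S))
            (exchange g J′ J₂ ∣J′∣ ∣J₂∣ (≤-pred (≤-trans closer ≤g)))
      where
      S = J₁ - x
      J′ = S ∪ ⁅ y ⁆
      x∈J₁ : x ∈ˢ J₁
      x∈J₁ = p─q⊆p J₁ J₂ x∈
      x∉S : x ∉ˢ S
      x∉S x∈S = ∈─⇒∉ J₁ ⁅ x ⁆ x∈S (x∈⁅x⁆ x)
      y∉S : y ∉ˢ S
      y∉S y∈S = ∈─⇒∉ J₂ J₁ y∈ (p─q⊆p J₁ ⁅ x ⁆ y∈S)
      back : J₁ ⊆ S ∪ ⁅ x ⁆
      back {u} u∈ with u ∈? ⁅ x ⁆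
      ... | yes u∈x = x∈p∪q⁺ (inj₂ u∈x)
      ... | no  u∉x = x∈p∪q⁺ (inj₁ (x∈p∧x∉q⇒x∈p─q u∈ u∉x))
      S∪x : S ∪ ⁅ x ⁆ ≡ J₁
      S∪x = ⊆-antisym (∪⁅⁆-⊆ (p─q⊆p J₁ ⁅ x ⁆) x∈J₁) back
      ∣S∣ : ∣ S ∣ ≡ i
      ∣S∣ = suc-injective (trans (sym (∣p∪⁅x⁆∣ S x∉S)) (trans (cong ∣_∣ S∪x) ∣J₁∣))
      ∣J′∣ : ∣ J′ ∣ ≡ suc i
      ∣J′∣ = trans (∣p∪⁅x⁆∣ S y∉S) (cong suc ∣S∣)
      closer : ∣ J₂ ─ J′ ∣ < ∣ J₂ ─ J₁ ∣
      closer = p⊂q⇒∣p∣<∣q∣ (sub , y , y∈ , λ y∈′ → ∈─⇒∉ J₂ J′ y∈′ (x∈p∪q⁺ (inj₂ (x∈⁅x⁆ y))))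
        where
        sub : J₂ ─ J′ ⊆ J₂ ─ J₁
        sub {u} u∈ = x∈p∧x∉q⇒x∈p─q (p─q⊆p J₂ J′ u∈) λ u∈J₁ → ∈─⇒∉ J₂ J′ u∈ (x∈p∪q⁺ (inj₁ (x∈p∧x∉q⇒x∈p─q u∈J₁ (u∉x u∈J₁))))
          where
          u∉x : u ∈ˢ J₁ → u ∉ˢ ⁅ x ⁆
          u∉x _ u∈x with refl ← x∈⁅y⁆⇒x≡y x u∈x = ∈─⇒∉ J₁ J₂ x∈ (p─q⊆p J₂ J′ u∈)

  connected : JConnected H (suc i)
  connected J₁ J₂ ∣J₁∣ ∣J₂∣ = exchange _ J₁ J₂ ∣J₁∣ ∣J₂∣ ≤-refl

-- Weighing explorations

^-distribʳ-* : ∀ e a b → (a * b) ^ e ≡ a ^ e * b ^ e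
^-distribʳ-* zero    a b = refl
^-distribʳ-* (suc e) a b = trans (cong (a * b *_) (^-distribʳ-* e a b)) (lem a b (a ^ e) (b ^ e))
  where
  lem : ∀ a b c d → a * b * (c * d) ≡ a * c * (b * d)
  lem = solve-∀

bernoulli : ∀ r u d → u ^ suc r + suc r * d * u ^ r ≤ (u + d) ^ suc r
bernoulli zero    u d = ≤-reflexive (lem u d)
  where
  lem : ∀ u d → u * 1 + (d + 0) * 1 ≡ (u + d) * 1
  lem = solve-∀
bernoulli (suc r) u d = begin
  u * u ^ suc r + suc (suc r) * d * u ^ suc r ≤⟨ m≤m+n _ (d * (suc r * d * u ^ r)) ⟩
  u * u ^ suc r + suc (suc r) * d * u ^ suc r + d * (suc r * d * u ^ r) ≡⟨ lem r u d (u ^ r) ⟩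
  (u + d) * (u ^ suc r + suc r * d * u ^ r) ≤⟨ *-monoʳ-≤ (u + d) (bernoulli r u d) ⟩
  (u + d) * (u + d) ^ suc r ∎
  where
  open ≤-Reasoning
  lem : ∀ r u d x → u * (u * x) + suc (suc r) * d * (u * x) + d * (suc r * d * x) ≡ (u + d) * (u * x + suc r * d * x)
  lem = solve-∀

-- With N = u + d: two terms of the binomial expansion of (u + d) ^ R suffice, since R d ≥ u makes
-- the second at least as large as the first.
2*[N-d]^R≤N^R : ∀ R d u → u + d ≤ R * d → 0 < u + d → 2 * u ^ R ≤ (u + d) ^ R
2*[N-d]^R≤N^R zero    d u h pos with () ← ≤-trans pos h
2*[N-d]^R≤N^R (suc r) d u h _ = begin
  2 * u ^ suc r  ≡⟨ lem u (u ^ r) ⟩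
  u ^ suc r + u * u ^ r  ≤⟨ +-monoʳ-≤ (u ^ suc r) (*-monoˡ-≤ (u ^ r) (≤-trans (m≤m+n u d) h)) ⟩
  u ^ suc r + suc r * d * u ^ r        ≤⟨ bernoulli r u d ⟩
  (u + d) ^ suc r  ∎
  where
  open ≤-Reasoning
  lem : ∀ u x → 2 * (u * x) ≡ u * x + u * x
  lem = solve-∀

-- 1 - s x ≤ (1 - x) ^ s with x = d / (u + d)
bernoulli⁻ : ∀ s u d → (u + d ∸ s * d) * (u + d) ^ s ≤ u ^ s * (u + d)
bernoulli⁻ zero    u d = ≤-reflexive (*-comm (u + d) 1)
bernoulli⁻ (suc s) u d = begin
  (u + d ∸ suc s * d) * ((u + d) * (u + d) ^ s) ≡⟨ *-assoc (u + d ∸ suc s * d) (u + d) _ ⟨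
  (u + d ∸ suc s * d) * (u + d) * (u + d) ^ s   ≤⟨ *-monoˡ-≤ ((u + d) ^ s) key ⟩
  u * (u + d ∸ s * d) * (u + d) ^ s             ≡⟨ *-assoc u _ _ ⟩
  u * ((u + d ∸ s * d) * (u + d) ^ s)           ≤⟨ *-monoʳ-≤ u (bernoulli⁻ s u d) ⟩
  u * (u ^ s * (u + d))  ≡⟨ *-assoc u _ _ ⟨
  u * u ^ s * (u + d)  ∎
  where
  open ≤-Reasoning
  cross : ∀ {z} → z ≤ u + d → (z ∸ d) * (u + d) ≤ u * z
  cross {z} z≤ with ≤-total d z
  ... | inj₂ z≤d = ≤-trans (≤-reflexive (cong (_* (u + d)) (m≤n⇒m∸n≡0 z≤d))) z≤n
  ... | inj₁ d≤z = subst (λ z → (z ∸ d) * (u + d) ≤ u * z) (m∸n+n≡m d≤z) (begin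
    (w + d ∸ d) * (u + d) ≡⟨ cong (_* (u + d)) (m+n∸n≡m w d) ⟩
    w * (u + d)           ≡⟨ *-distribˡ-+ w u d ⟩
    w * u + w * d         ≤⟨ +-monoʳ-≤ (w * u) (*-monoˡ-≤ d w≤u) ⟩
    w * u + u * d         ≡⟨ cong (_+ u * d) (*-comm w u) ⟩
    u * w + u * d         ≡⟨ *-distribˡ-+ u w d ⟨
    u * (w + d)           ∎)
    where
    w = z ∸ d
    w≤u : w ≤ u
    w≤u = ≤-trans (∸-monoˡ-≤ d z≤) (≤-reflexive (m+n∸n≡m u d))
  key : (u + d ∸ suc s * d) * (u + d) ≤ u * (u + d ∸ s * d)
  key = ≤-trans (≤-reflexive (cong (_* (u + d)) (trans (cong (u + d ∸_) (+-comm d (s * d))) (sym (∸-+-assoc (u + d) (s * d) d)))))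
    (cross (m∸n≤m (u + d) (s * d)))

-- With x = d / N: first 1 - s x ≤ (1 - x) ^ s, then (1 - x) ^ R ≤ 1 / 2. So each of the s vertices
-- of a component gains a factor 2 in every `R` steps.
2^s*[N-sd]^R≤N^R : ∀ N d R s → 0 < N → d ≤ N → N ≤ R * d → 2 ^ s * (N ∸ s * d) ^ R ≤ N ^ R
2^s*[N-sd]^R≤N^R N d R s N>0 d≤N N≤Rd = *-cancelʳ-≤ _ _ (N ^ (s * R)) {{m^n≢0 N (s * R) {{>-nonZero N>0}}}} (begin
  2 ^ s * (N ∸ s * d) ^ R * N ^ (s * R)          ≡⟨ *-assoc (2 ^ s) _ _ ⟩
  2 ^ s * ((N ∸ s * d) ^ R * N ^ (s * R))        ≡⟨ cong (λ z → 2 ^ s * ((N ∸ s * d) ^ R * z)) (^-*-assoc N s R) ⟨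
  2 ^ s * ((N ∸ s * d) ^ R * (N ^ s) ^ R)        ≡⟨ cong (2 ^ s *_) (^-distribʳ-* R (N ∸ s * d) (N ^ s)) ⟨
  2 ^ s * ((N ∸ s * d) * N ^ s) ^ R              ≤⟨ *-monoʳ-≤ (2 ^ s) (^-monoˡ-≤ R
          (subst (λ z → (z ∸ s * d) * z ^ s ≤ u ^ s * z) u+d (bernoulli⁻ s u d))) ⟩
  2 ^ s * (u ^ s * N) ^ R  ≡⟨ cong (2 ^ s *_) (^-distribʳ-* R (u ^ s) N) ⟩
  2 ^ s * ((u ^ s) ^ R * N ^ R)  ≡⟨ cong (λ z → 2 ^ s * (z * N ^ R)) (trans (^-*-assoc u s R) (trans (cong (u ^_) (*-comm s R)) (sym (^-*-assoc u R s)))) ⟩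
  2 ^ s * ((u ^ R) ^ s * N ^ R)  ≡⟨ *-assoc (2 ^ s) _ _ ⟨
  2 ^ s * (u ^ R) ^ s * N ^ R  ≡⟨ cong (_* N ^ R) (^-distribʳ-* s 2 (u ^ R)) ⟨
  (2 * u ^ R) ^ s * N ^ R  ≤⟨ *-monoˡ-≤ (N ^ R) (^-monoˡ-≤ s
          (subst (λ z → 2 * u ^ R ≤ z ^ R) u+d (2*[N-d]^R≤N^R R d u (subst (_≤ R * d) (sym u+d) N≤Rd) (subst (0 <_) (sym u+d) N>0)))) ⟩
  (N ^ R) ^ s * N ^ R  ≡⟨ *-comm ((N ^ R) ^ s) _ ⟩
  N ^ R * (N ^ R) ^ s  ≡⟨ cong (N ^ R *_) (trans (^-*-assoc N R s) (cong (N ^_) (*-comm R s))) ⟩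
  N ^ R * N ^ (s * R)  ∎)
  where
  open ≤-Reasoning
  u = N ∸ d
  u+d : u + d ≡ N
  u+d = m∸n+n≡m d≤N

2^sμ*[N-sd]^Rμ≤N^Rμ : ∀ N d R s μ → 0 < N → d ≤ N → N ≤ R * d → 2 ^ (s * μ) * (N ∸ s * d) ^ (R * μ) ≤ N ^ (R * μ)
2^sμ*[N-sd]^Rμ≤N^Rμ N d R s μ N>0 d≤N N≤Rd = begin
  2 ^ (s * μ) * (N ∸ s * d) ^ (R * μ)      ≡⟨ cong₂ _*_ (^-*-assoc 2 s μ) (^-*-assoc (N ∸ s * d) R μ) ⟨
  (2 ^ s) ^ μ * ((N ∸ s * d) ^ R) ^ μ      ≡⟨ ^-distribʳ-* μ (2 ^ s) _ ⟨
  (2 ^ s * (N ∸ s * d) ^ R) ^ μ            ≤⟨ ^-monoˡ-≤ μ (2^s*[N-sd]^R≤N^R N d R s N>0 d≤N N≤Rd) ⟩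
  (N ^ R) ^ μ  ≡⟨ ^-*-assoc N R μ ⟩
  N ^ (R * μ)  ∎
  where open ≤-Reasoning

-- Summing over the runs of an exploration

module _ (k : ℕ) (S : Subset n) where

  -- What each state of a run satisfies. In `sizes`, every edge has brought a new vertex, so the
  -- edges do not outnumber the vertices outside `S`.
  record Tree (X : Subset n) (T : List (Subset n)) : Set where
    field
      S⊆X    : S ⊆ X
      unique : Unique T
      edges  : All (λ e → (∣ e ∣ ≡ k) × (S ⊆ e) × (e ⊆ X)) T
      sizes  : length T + ∣ S ∣ ≤ ∣ X ∣

  open Tree

  Tree-extend : ∀ {X T v e} → Tree X T → e ∈ extensions k S X v → Tree (X ∪ e) (e ∷ T)
  Tree-extend {X} {T} {v} {e} tr e∈ with e∈k , Sv⊆e , e⊈X ← ∈-filter⁻ (extension? k S X v) {xs = kSets n k} e∈ = record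
    { S⊆X    = ⊆-trans (S⊆X tr) (p⊆p∪q e)
    -- Earlier edges lie inside `X` and the new one does not.
    ; unique = All.map (λ { (_ , _ , e′⊆X) refl → e⊈X e′⊆X }) (edges tr) ∷ unique tr
    ; edges  = (∈-kSets⁻ e∈k , (λ x∈ → Sv⊆e (x∈p∪q⁺ (inj₁ x∈))) , q⊆p∪q X e)
             ∷ All.map (λ (∣e′∣ , S⊆e′ , e′⊆X) → ∣e′∣ , (λ {x} → S⊆e′ {x}) , λ {x} x∈ → p⊆p∪q e (e′⊆X x∈)) (edges tr)
    ; sizes  = begin
        suc (length T + ∣ S ∣)     ≤⟨ s≤s (sizes tr) ⟩
        1 + ∣ X ∣  ≤⟨ +-monoˡ-≤ ∣ X ∣ (¬⊆⇒0<∣─∣ e X e⊈X) ⟩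
        ∣ e ─ X ∣ + ∣ X ∣          ≡⟨ +-comm ∣ e ─ X ∣ ∣ X ∣ ⟩
        ∣ X ∣ + ∣ e ─ X ∣          ≡⟨ ∣p∪q∣≡∣p∣+∣q─p∣ X e ⟨
        ∣ X ∪ e ∣  ∎ }
    where open ≤-Reasoning

  length-extensions : ∀ t X {v} → k ≡ suc ∣ S ∣ + t → v ∉ˢ S → length (extensions k S X v) ≤ bin (n ∸ suc ∣ S ∣) t
  length-extensions t X {v} refl v∉S = begin
    length (extensions k S X v)  ≡⟨ length-∑ (extensions k S X v) ⟨
    ∑ (λ _ → 1) (extensions k S X v)  ≡⟨ ∑-filter (extension? k S X v) _ (kSets n k) ⟩
    ∑ (λ e → if does (extension? k S X v e) then 1 else 0) (kSets n k) ≤⟨ ∑-mono-∈ (kSets n k) (λ e _ → pt (⊇ᵇ (S ∪ ⁅ v ⁆) e) _) ⟩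
    # (⊇ᵇ (S ∪ ⁅ v ⁆)) (kSets n k)  ≡⟨ subst (λ z → # (⊇ᵇ (S ∪ ⁅ v ⁆)) (kSets n (z + t)) ≡ bin (n ∸ z) t) (∣p∪⁅x⁆∣ S v∉S) (#-supersets (S ∪ ⁅ v ⁆) t) ⟩
    bin (n ∸ suc ∣ S ∣) t  ∎
    where
    open ≤-Reasoning
    pt : ∀ a b → (if a ∧ b then 1 else 0) ≤ ⟦ a ⟧
    pt true  true  = ≤-refl
    pt true  false = z≤n
    pt false _     = z≤n

  module _ (c : Subset n × List (Subset n) → ℕ) {D α β F G : ℕ}
    (D-bound : ∀ X {v} → v ∉ˢ S → length (extensions k S X v) ≤ D)
    (c-bound : ∀ X T → Tree X T → c (X , T) * β ^ length T * G ≤ F * α ^ length T) where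

    -- If a final state with m edges weighs at most (F / G) (α / β) ^ m, then each step multiplies
    -- the total by 1 for dropping a vertex plus D (α / β) for the at most D edges. As the queue
    -- dictates the vertex, no step chooses where the next edge is attached.
    ∑-runs : ∀ f X Q T → Tree X T → All (_∉ˢ S) Q →
      ∑ c (runs k S f X Q T) * β ^ (length T + f) * G ≤ F * α ^ length T * (β + D * α) ^ f
    ∑-runs f X [] T tr Q∉ = begin
      (c (X , T) + 0) * β ^ (length T + f) * G   ≡⟨ cong₂ (λ y z → y * z * G) (+-identityʳ (c (X , T))) (^-distribˡ-+-* β (length T) f) ⟩
      c (X , T) * (β ^ length T * β ^ f) * G     ≡⟨ lem (c (X , T)) (β ^ length T) (β ^ f) G ⟩
      c (X , T) * β ^ length T * G * β ^ f       ≤⟨ *-mono-≤ (c-bound X T tr) (^-monoˡ-≤ f (m≤m+n β (D * α))) ⟩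
      F * α ^ length T * (β + D * α) ^ f         ∎
      where
      open ≤-Reasoning
      lem : ∀ a b c d → a * (b * c) * d ≡ a * b * d * c
      lem = solve-∀
    ∑-runs zero    X (v ∷ Q) T tr Q∉ = z≤n
    ∑-runs (suc f) X (v ∷ Q) T tr (v∉ ∷ Q∉) = begin
      ∑ c (runs k S f X Q T ++ concatMap next (extensions k S X v)) * β ^ (length T + suc f) * G
        ≡⟨ cong (λ z → z * β ^ (length T + suc f) * G) (trans (∑-++ c (runs k S f X Q T) _) (cong (∑ c (runs k S f X Q T) +_) (∑-concatMap c next (extensions k S X v)))) ⟩
      (∑ c (runs k S f X Q T) + ∑ (λ e → ∑ c (next e)) (extensions k S X v)) * β ^ (length T + suc f) * G
        ≡⟨ cong (λ z → (∑ c (runs k S f X Q T) + ∑ (λ e → ∑ c (next e)) (extensions k S X v)) * β ^ z * G) (+-suc (length T) f) ⟩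
      (∑ c (runs k S f X Q T) + ∑ (λ e → ∑ c (next e)) (extensions k S X v)) * (β * β ^ (length T + f)) * G
        ≡⟨ lem (∑ c (runs k S f X Q T)) (∑ (λ e → ∑ c (next e)) (extensions k S X v)) β (β ^ (length T + f)) G ⟩
      β * (∑ c (runs k S f X Q T) * β ^ (length T + f) * G) + ∑ (λ e → ∑ c (next e)) (extensions k S X v) * (β * β ^ (length T + f) * G)
        ≡⟨ cong (β * (∑ c (runs k S f X Q T) * β ^ (length T + f) * G) +_) (∑-*ʳ (β * β ^ (length T + f) * G) _ (extensions k S X v)) ⟨
      β * (∑ c (runs k S f X Q T) * β ^ (length T + f) * G) + ∑ (λ e → ∑ c (next e) * (β * β ^ (length T + f) * G)) (extensions k S X v)
        ≤⟨ +-mono-≤ (*-monoʳ-≤ β (∑-runs f X Q T tr Q∉)) (∑-mono-∈ (extensions k S X v) each) ⟩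
      β * (F * α ^ length T * P) + ∑ (λ e → F * (α * α ^ length T) * P) (extensions k S X v)
        ≡⟨ cong (β * (F * α ^ length T * P) +_) (∑-const _ (extensions k S X v)) ⟩
      β * (F * α ^ length T * P) + length (extensions k S X v) * (F * (α * α ^ length T) * P)
        ≤⟨ +-monoʳ-≤ (β * (F * α ^ length T * P)) (*-monoˡ-≤ (F * (α * α ^ length T) * P) (D-bound X v∉)) ⟩
      β * (F * α ^ length T * P) + D * (F * (α * α ^ length T) * P)
        ≡⟨ lem₂ β F (α ^ length T) P D α ⟩
      F * α ^ length T * ((β + D * α) * P) ∎
      where
      open ≤-Reasoning
      P = (β + D * α) ^ f
      next : Subset n → List (Subset n × List (Subset n))
      next e = runs k S f (X ∪ e) (elems (e ─ X) ++ v ∷ Q) (e ∷ T)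
      lem : ∀ a b β y G → (a + b) * (β * y) * G ≡ β * (a * y * G) + b * (β * y * G)
      lem = solve-∀
      lem₂ : ∀ β F a P D α → β * (F * a * P) + D * (F * (α * a) * P) ≡ F * a * ((β + D * α) * P)
      lem₂ = solve-∀
      each : ∀ e → e ∈ extensions k S X v → ∑ c (next e) * (β * β ^ (length T + f) * G) ≤ F * (α * α ^ length T) * P
      each e e∈ = ≤-trans (≤-reflexive (sym (*-assoc (∑ c (next e)) _ G)))
        (∑-runs f (X ∪ e) (elems (e ─ X) ++ v ∷ Q) (e ∷ T) (Tree-extend tr e∈)
          (Allₚ.++⁺ (All.tabulate (λ x∈ x∈S → ∈─⇒∉ e X (∈-elems⁻ x∈) (S⊆X tr x∈S))) (v∉ ∷ Q∉)))

module _ (k M₁ M₂ : ℕ) where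

  witness : Subset n → ℕ → List (Subset n) → Subset n × List (Subset n) → Bool
  witness S s σ (X , T) = (∣ X ∣ ≡ᵇ ∣ S ∣ + s) ∧ (avoids M₁ (boundary S X) σ ∧ contains M₂ (member _≟ˢ_ T) σ)

  small : Subset n → Fin n → ℕ → List (Subset n) → Bool
  small S v s σ = any (witness S s σ) (runs k S (2 * s) (S ∪ ⁅ v ⁆) (v ∷ []) [])

  module _ (S : Subset n) (t s R μ α : ℕ) (k≡ : k ≡ suc ∣ S ∣ + t) (1≤t : 1 ≤ t)
    (α≤D : α ≤ bin (n ∸ suc ∣ S ∣) t) (D>0 : 0 < bin (n ∸ suc ∣ S ∣) t)
    (M₂D≤αN : M₂ * bin (n ∸ suc ∣ S ∣) t ≤ α * length (kSets n k))
    (N≤Rd : length (kSets n k) ≤ R * bin (n ∸ (∣ S ∣ + s)) t) (d≤N : bin (n ∸ (∣ S ∣ + s)) t ≤ length (kSets n k))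
    (N>0 : 0 < length (kSets n k)) (Rμ+s≤M₁ : R * μ + s ≤ M₁) (M₁≤M₂ : M₁ ≤ M₂) (M₁≤N : M₁ ≤ length (kSets n k)) where

    private
      N = length (kSets n k)
      D = bin (n ∸ suc ∣ S ∣) t
      d = bin (n ∸ (∣ S ∣ + s)) t
      U = kSets n k
      E = R * μ

    -- Presence of `T` costs at most (α / D) ^ m for its m edges, as α / D bounds `M₂ / N`; absence
    -- of the a = s d boundary sets costs (1 - a / N) ^ E.
    witness-bound : ∀ X T → Tree k S X T →
      # (λ σ → witness S s σ (X , T)) (perms N U) * D ^ length T * N ^ E ≤ N ! * (N ∸ s * d) ^ E * α ^ length T
    witness-bound X T tr with ∣ X ∣ ≡ᵇ ∣ S ∣ + s in eq
    ... | false = ≤-trans (≤-reflexive (cong (λ z → z * D ^ length T * N ^ E) (∑-0 _ (λ _ → refl) (perms N U)))) z≤n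
    ... | true  = begin
      c * D ^ m * N ^ E  ≡⟨ lem c (D ^ m) (N ^ E) ⟩
      c * N ^ E * D ^ m  ≤⟨ *-monoˡ-≤ (D ^ m) cN^E≤ ⟩
      falling M₂ m * (fr + a) ! * (N ∸ a) ^ E * D ^ m ≡⟨ lem (falling M₂ m * (fr + a) !) ((N ∸ a) ^ E) (D ^ m) ⟩
      falling M₂ m * (fr + a) ! * D ^ m * (N ∸ a) ^ E ≤⟨ *-monoˡ-≤ ((N ∸ a) ^ E) (falling-ratio α≤D m M₂ (fr + a) (subst (λ z → M₂ * D ≤ α * z) N≡ M₂D≤αN)) ⟩
      α ^ m * (m + (fr + a)) ! * (N ∸ a) ^ E   ≡⟨ cong (λ z → α ^ m * z ! * (N ∸ a) ^ E) N≡ ⟨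
      α ^ m * N ! * (N ∸ a) ^ E  ≡⟨ lem₂ (α ^ m) (N !) ((N ∸ a) ^ E) ⟩
      N ! * (N ∸ a) ^ E * α ^ m  ≡⟨ cong (λ z → N ! * (N ∸ z) ^ E * α ^ m) a≡ ⟩
      N ! * (N ∸ s * d) ^ E * α ^ m            ∎
      where
      open ≤-Reasoning
      open Tree tr
      m  = length T
      TT = member _≟ˢ_ T
      B  = boundary S X
      c  = # (λ σ → avoids M₁ B σ ∧ contains M₂ TT σ) (perms N U)
      lem : ∀ a b c → a * b * c ≡ a * c * b
      lem = solve-∀
      lem₂ : ∀ a b c → a * b * c ≡ b * c * a
      lem₂ = solve-∀
      ∣X∣ : ∣ X ∣ ≡ ∣ S ∣ + s
      ∣X∣ = ≡ᵇ⇒≡ ∣ X ∣ (∣ S ∣ + s) (subst Bool.T (sym eq) _)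
      2+∣S∣≤ : 2 + ∣ S ∣ ≤ suc ∣ S ∣ + t
      2+∣S∣≤ = s≤s (≤-trans (≤-reflexive (+-comm 1 ∣ S ∣)) (+-monoʳ-≤ ∣ S ∣ 1≤t))
      disjoint : ∀ K → B K ≡ true → TT K ≡ false
      disjoint K BK with TT K in TK
      ... | false = refl
      ... | true  with ∣K∣ , S⊆K , K⊆X ← All.lookup edges (∈-member _≟ˢ_ T TK)
        with () ← trans (sym BK) (inner⇒¬boundary S⊆K K⊆X (subst (2 + ∣ S ∣ ≤_) (sym ∣K∣) (subst (2 + ∣ S ∣ ≤_) (sym k≡) 2+∣S∣≤)))
      fr = # (free TT B disjoint) U
      a  = # B U
      #TT : # TT U ≡ m
      #TT = #-member _≟ˢ_ T (Unique-kSets n k) unique (All.map (λ (∣e∣ , _) → ∈-kSets⁺ ∣e∣) edges)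
      N≡ : N ≡ m + (fr + a)
      N≡ = trans (sym (#-complement TT U)) (cong₂ _+_ #TT (#¬T TT B disjoint U))
      ∣X─S∣ : ∣ X ─ S ∣ ≡ s
      ∣X─S∣ = +-cancelˡ-≡ ∣ S ∣ _ _ (trans (∣S∣+∣X─S∣ S⊆X) ∣X∣)
      a≡ : a ≡ s * d
      a≡ = trans (subst (λ z → # B (kSets n z) ≡ ∣ X ─ S ∣ * bin (n ∸ ∣ X ∣) t) (trans (cong (_+ t) (+-comm ∣ S ∣ 1)) (sym k≡)) (#-boundary S X S⊆X t))
        (cong₂ (λ y z → y * bin (n ∸ z) t) ∣X─S∣ ∣X∣)
      m≤s : m ≤ s
      m≤s = +-cancelʳ-≤ ∣ S ∣ _ _ (≤-trans sizes (≤-reflexive (trans ∣X∣ (+-comm ∣ S ∣ s))))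
      -- Leaving out the m sets of `T`, none of which is a boundary set, only raises the share of
      -- boundary sets: fr / (fr + a) ≤ (m + fr) / N.
      ratio : fr * N ≤ (N ∸ a) * (fr + a)
      ratio = begin
        fr * N  ≡⟨ cong (fr *_) N≡ ⟩
        fr * (m + (fr + a))      ≤⟨ m≤m+n _ (m * a) ⟩
        fr * (m + (fr + a)) + m * a ≡⟨ lem₃ fr m a ⟩
        (m + fr) * (fr + a)      ≡⟨ cong (_* (fr + a)) (trans (sym (m+n∸n≡m (m + fr) a)) (cong (_∸ a) (trans (+-assoc m fr a) (sym N≡)))) ⟩
        (N ∸ a) * (fr + a)       ∎
        where
        lem₃ : ∀ f m a → f * (m + (f + a)) + m * a ≡ (m + f) * (f + a)
        lem₃ = solve-∀
      -- The edges of `T` take up at most s of the first `M₁` positions, which leaves `E` for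
      -- avoidance.
      cN^E≤ : c * N ^ E ≤ falling M₂ m * (fr + a) ! * (N ∸ a) ^ E
      cN^E≤ = subst (λ z → c * N ^ E ≤ falling M₂ z * (fr + a) ! * (N ∸ a) ^ E) #TT
        (#avoids∧contains TT B disjoint (m∸n≤m N a) N U E M₁ M₂ refl
          (≤-trans (+-monoʳ-≤ E (≤-trans (≤-reflexive #TT) m≤s)) Rμ+s≤M₁) M₁≤M₂ M₁≤N ratio)

    -- Each of the 2 s steps weighs 1 + D (α / D) = 1 + α: the number of candidates cancels against
    -- the probability of each. The boundary contributes 1 / 2 ^ (s μ).
    #small : ∀ {v} → v ∉ˢ S → # (small S v s) (perms N U) * 2 ^ (s * μ) ≤ N ! * suc α ^ (2 * s)
    #small {v} v∉S = *-cancelʳ-≤ _ _ (D ^ f * N ^ E) {{m*n≢0 _ _ {{m^n≢0 D f {{>-nonZero D>0}}}} {{m^n≢0 N E {{>-nonZero N>0}}}}}} (begin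
      # (small S v s) (perms N U) * 2 ^ (s * μ) * (D ^ f * N ^ E) ≤⟨ *-monoˡ-≤ (D ^ f * N ^ E) (*-monoˡ-≤ (2 ^ (s * μ)) union) ⟩
      ∑ c rs * 2 ^ (s * μ) * (D ^ f * N ^ E)  ≡⟨ lem (∑ c rs) (2 ^ (s * μ)) (D ^ f) (N ^ E) ⟩
      ∑ c rs * D ^ f * N ^ E * 2 ^ (s * μ)  ≤⟨ *-monoˡ-≤ (2 ^ (s * μ)) (∑-runs k S c {β = D} {F = N ! * (N ∸ s * d) ^ E} {G = N ^ E}
          (λ X → length-extensions k S t X k≡) witness-bound f _ _ [] tree₀ (v∉S ∷ [])) ⟩
      N ! * (N ∸ s * d) ^ E * 1 * (D + D * α) ^ f * 2 ^ (s * μ)   ≡⟨ lem₂ (N !) ((N ∸ s * d) ^ E) ((D + D * α) ^ f) (2 ^ (s * μ)) ⟩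
      N ! * (D + D * α) ^ f * (2 ^ (s * μ) * (N ∸ s * d) ^ E)     ≤⟨ *-monoʳ-≤ (N ! * (D + D * α) ^ f) (2^sμ*[N-sd]^Rμ≤N^Rμ N d R s μ N>0 d≤N N≤Rd) ⟩
      N ! * (D + D * α) ^ f * N ^ E  ≡⟨ cong (λ z → N ! * z * N ^ E) (trans (cong (_^ f) (sym (*-suc D α))) (^-distribʳ-* f D (suc α))) ⟩
      N ! * (D ^ f * suc α ^ f) * N ^ E  ≡⟨ lem₃ (N !) (D ^ f) (suc α ^ f) (N ^ E) ⟩
      N ! * suc α ^ f * (D ^ f * N ^ E)  ∎)
      where
      open ≤-Reasoning
      f  = 2 * s
      rs = runs k S f (S ∪ ⁅ v ⁆) (v ∷ []) []
      c : Subset n × List (Subset n) → ℕ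
      c z = # (λ σ → witness S s σ z) (perms N U)
      union : # (small S v s) (perms N U) ≤ ∑ c rs
      union = ≤-trans (∑-mono-∈ (perms N U) (λ σ _ → ⟦any⟧≤# (witness S s σ) rs)) (≤-reflexive (∑-swap _ (perms N U) rs))
      tree₀ : Tree k S (S ∪ ⁅ v ⁆) []
      tree₀ = record { S⊆X = p⊆p∪q ⁅ v ⁆ ; unique = [] ; edges = [] ; sizes = ∣p∣≤∣p∪q∣ S ⁅ v ⁆ }
      lem : ∀ a b c d → a * b * (c * d) ≡ a * c * d * b
      lem = solve-∀
      lem₂ : ∀ a b c d → a * b * 1 * c * d ≡ a * c * (d * b)
      lem₂ = solve-∀
      lem₃ : ∀ a b c d → a * (b * c) * d ≡ a * c * (b * d)
      lem₃ = solve-∀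

-- Isolated sets

!>0 : ∀ m → 0 < m !
!>0 zero    = s≤s z≤n
!>0 (suc m) = *-mono-≤ {1} {suc m} (s≤s z≤n) (!>0 m)

-- Applied to all 6 y factors 1 - 1 / (6 y), Bernoulli's inequality only gives the bound 0; applied
-- to a sixth of them it gives 5 / 6, and (5 / 6) ^ 6 ≥ 1 / 3.
5[6y]^y≤6[6y-1]^y : ∀ y → 0 < y → 5 * (6 * y) ^ y ≤ 6 * (6 * y ∸ 1) ^ y
5[6y]^y≤6[6y-1]^y y@(suc y′) _ = *-cancelʳ-≤ _ _ y (begin
  5 * (6 * y) ^ y * y  ≡⟨ lem ((6 * y) ^ y) y ⟩
  5 * y * (6 * y) ^ y  ≡⟨ cong (_* (6 * y) ^ y) (sym (trans (cong (_∸ y * 1) (lem₂ y)) (m+n∸n≡m (5 * y) (y * 1)))) ⟩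
  (6 * y ∸ y * 1) * (6 * y) ^ y  ≡⟨ cong (λ z → (z ∸ y * 1) * z ^ y) u+1 ⟨
  (u + 1 ∸ y * 1) * (u + 1) ^ y  ≤⟨ bernoulli⁻ y u 1 ⟩
  u ^ y * (u + 1)  ≡⟨ cong (u ^ y *_) u+1 ⟩
  u ^ y * (6 * y)  ≡⟨ lem₃ (u ^ y) y ⟩
  6 * u ^ y * y  ∎)
  where
  open ≤-Reasoning
  u = 6 * y ∸ 1
  u+1 : u + 1 ≡ 6 * y
  u+1 = m∸n+n≡m {6 * y} {1} (s≤s z≤n)
  lem : ∀ x y → 5 * x * y ≡ 5 * y * x
  lem = solve-∀
  lem₂ : ∀ y → 6 * y ≡ 5 * y + y * 1
  lem₂ = solve-∀
  lem₃ : ∀ x y → x * (6 * y) ≡ 6 * x * y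
  lem₃ = solve-∀

[6y]^M≤3^w[6y-1]^M : ∀ y w M → 0 < y → M ≤ w * (6 * y) → (6 * y) ^ M ≤ 3 ^ w * (6 * y ∸ 1) ^ M
[6y]^M≤3^w[6y-1]^M y w M y>0 M≤ = *-cancelʳ-≤ _ _ (a ^ r) {{m^n≢0 a r {{m*n≢0 6 y {{_}} {{>-nonZero y>0}}}}}} (begin
  a ^ M * a ^ r  ≡⟨ ^-distribˡ-+-* a M r ⟨
  a ^ (M + r)  ≡⟨ cong (a ^_) M+r ⟩
  a ^ (w * (6 * y))              ≡⟨ cong (a ^_) (*-comm w (6 * y)) ⟩
  a ^ (6 * y * w)  ≡⟨ ^-*-assoc a (6 * y) w ⟨
  (a ^ (6 * y)) ^ w              ≤⟨ ^-monoˡ-≤ w block ⟩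
  (3 * u ^ (6 * y)) ^ w          ≡⟨ ^-distribʳ-* w 3 (u ^ (6 * y)) ⟩
  3 ^ w * (u ^ (6 * y)) ^ w      ≡⟨ cong (3 ^ w *_) (trans (^-*-assoc u (6 * y) w) (cong (u ^_) (trans (*-comm (6 * y) w) (sym M+r)))) ⟩
  3 ^ w * u ^ (M + r)            ≡⟨ cong (3 ^ w *_) (^-distribˡ-+-* u M r) ⟩
  3 ^ w * (u ^ M * u ^ r)        ≤⟨ *-monoʳ-≤ (3 ^ w) (*-monoʳ-≤ (u ^ M) (^-monoˡ-≤ r (m∸n≤m a 1))) ⟩
  3 ^ w * (u ^ M * a ^ r)        ≡⟨ *-assoc (3 ^ w) _ _ ⟨
  3 ^ w * u ^ M * a ^ r          ∎)
  where
  open ≤-Reasoning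
  a = 6 * y
  u = 6 * y ∸ 1
  r = w * (6 * y) ∸ M
  M+r : M + r ≡ w * (6 * y)
  M+r = m+[n∸m]≡n M≤
  six : ∀ x → x ^ (6 * y) ≡ (x ^ y) ^ 6
  six x = trans (cong (x ^_) (*-comm 6 y)) (sym (^-*-assoc x y 6))
  block : a ^ (6 * y) ≤ 3 * u ^ (6 * y)
  block = *-cancelˡ-≤ (5 ^ 6) (begin
    5 ^ 6 * a ^ (6 * y)          ≡⟨ cong (5 ^ 6 *_) (six a) ⟩
    5 ^ 6 * (a ^ y) ^ 6          ≡⟨ ^-distribʳ-* 6 5 (a ^ y) ⟨
    (5 * a ^ y) ^ 6              ≤⟨ ^-monoˡ-≤ 6 (5[6y]^y≤6[6y-1]^y y y>0) ⟩
    (6 * u ^ y) ^ 6              ≡⟨ ^-distribʳ-* 6 6 (u ^ y) ⟩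
    -- 5 ^ 6 * 3 = 46875 = 6 ^ 6 + 219.
    6 ^ 6 * (u ^ y) ^ 6          ≤⟨ *-monoˡ-≤ ((u ^ y) ^ 6) (m≤m+n (6 ^ 6) 219) ⟩
    5 ^ 6 * 3 * (u ^ y) ^ 6      ≡⟨ *-assoc (5 ^ 6) 3 ((u ^ y) ^ 6) ⟩
    5 ^ 6 * (3 * (u ^ y) ^ 6)    ≡⟨ cong (λ z → 5 ^ 6 * (3 * z)) (six u) ⟨
    5 ^ 6 * (3 * u ^ (6 * y))    ∎)

-- Termwise (z - 1) / z ≤ x / (x + D), since every x + D that occurs is at least z D.
falling-lower : ∀ z D M x → z * D + M ≤ x + D → (z ∸ 1) ^ M * falling (x + D) M ≤ z ^ M * falling x M
falling-lower z D zero    x       h = ≤-refl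
falling-lower zero D (suc M) x    h = z≤n
falling-lower (suc z) D (suc M) zero h = contradiction h (<⇒≱ (≤-trans (m<m+n D {z * D + suc M} (≤-trans (s≤s z≤n) (m≤n+m (suc M) (z * D)))) (≤-reflexive (sym (+-assoc D (z * D) (suc M))))))
falling-lower (suc z) D (suc M) (suc x) h = begin
  z * z ^ M * (suc (x + D) * falling (x + D) M)   ≡⟨ lem z (z ^ M) (suc (x + D)) (falling (x + D) M) ⟩
  z * suc (x + D) * (z ^ M * falling (x + D) M)   ≤⟨ *-mono-≤ term (falling-lower (suc z) D M x h′) ⟩
  suc z * suc x * (suc z ^ M * falling x M)       ≡⟨ lem (suc z) (suc z ^ M) (suc x) (falling x M) ⟨
  suc z * suc z ^ M * (suc x * falling x M)       ∎
  where
  open ≤-Reasoning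
  lem : ∀ a b c d → a * b * (c * d) ≡ a * c * (b * d)
  lem = solve-∀
  h′ : suc z * D + M ≤ x + D
  h′ = ≤-pred (subst (_≤ suc (x + D)) (+-suc (suc z * D) M) h)
  zD≤ : z * D ≤ suc x
  zD≤ = +-cancelˡ-≤ D _ _ (≤-trans (m≤m+n (D + z * D) (suc M)) (≤-trans h (≤-reflexive (+-comm (suc x) D))))
  lem₂ : ∀ z x D → z * suc (x + D) ≡ z * suc x + z * D
  lem₂ = solve-∀
  term : z * suc (x + D) ≤ suc z * suc x
  term = ≤-trans (≤-reflexive (lem₂ z x D)) (≤-trans (+-monoʳ-≤ (z * suc x) zD≤) (≤-reflexive (+-comm (z * suc x) (suc x))))

-- Bounds the correlation of the isolation of two j-sets that have δ of their D containing k-sets in common.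
falling-correlation : ∀ N D δ M g x → g + D ≤ x + δ → N + 2 * M ≤ 2 * x → x + D ≤ N →
  falling g M * falling (x + D) M * N ^ M ≤ falling x M * falling x M * (N + 4 * δ) ^ M
falling-correlation N D δ zero    g       x _ _ _ = ≤-refl
falling-correlation N D δ (suc M) zero    x _ _ _ = z≤n
falling-correlation N D δ (suc M) (suc g) zero _ h _ = contradiction h (<⇒≱ (≤-trans (s≤s z≤n) (m≤n+m (2 * suc M) N)))
falling-correlation N D δ (suc M) (suc g) (suc x) (s≤s h₁) h₂ h₃ = begin
  suc g * falling g M * (suc (x + D) * falling (x + D) M) * (N * N ^ M)     ≡⟨ lem (suc g) (falling g M) (suc (x + D)) (falling (x + D) M) N (N ^ M) ⟩
  suc g * suc (x + D) * N * (falling g M * falling (x + D) M * N ^ M)       ≤⟨ *-mono-≤ term (falling-correlation N D δ M g x h₁ h₂′ (≤-trans (n≤1+n _) h₃)) ⟩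
  suc x * suc x * (N + 4 * δ) * (falling x M * falling x M * (N + 4 * δ) ^ M) ≡⟨ lem (suc x) (falling x M) (suc x) (falling x M) (N + 4 * δ) ((N + 4 * δ) ^ M) ⟨
  suc x * falling x M * (suc x * falling x M) * ((N + 4 * δ) * (N + 4 * δ) ^ M) ∎
  where
  open ≤-Reasoning
  lem : ∀ a b c d e f → a * b * (c * d) * (e * f) ≡ a * c * e * (b * d * f)
  lem = solve-∀
  lem₂ : ∀ N M x → N + 2 * suc M ≡ 2 + (N + 2 * M)
  lem₂ = solve-∀
  lem₃ : ∀ x → 2 * suc x ≡ 2 + 2 * x
  lem₃ = solve-∀
  h₂′ : N + 2 * M ≤ 2 * x
  h₂′ = +-cancelˡ-≤ 2 _ _ (≤-trans (≤-reflexive (sym (lem₂ N M x))) (≤-trans h₂ (≤-reflexive (lem₃ x))))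
  X = suc x
  lem₄ : ∀ g X D → g * (X + D) + (X * D + D * D) ≡ (g + D) * (X + D)
  lem₄ = solve-∀
  lem₅ : ∀ X D δ → (X + δ) * (X + D) ≡ X * X + δ * (X + D) + X * D
  lem₅ = solve-∀
  pair : suc g * (X + D) ≤ X * X + δ * (X + D)
  pair = +-cancelʳ-≤ (X * D) _ _ (begin
    suc g * (X + D) + X * D               ≤⟨ +-monoʳ-≤ (suc g * (X + D)) (m≤m+n (X * D) (D * D)) ⟩
    suc g * (X + D) + (X * D + D * D)     ≡⟨ lem₄ (suc g) X D ⟩
    (suc g + D) * (X + D)  ≤⟨ *-monoˡ-≤ (X + D) (s≤s h₁) ⟩
    (X + δ) * (X + D)  ≡⟨ lem₅ X D δ ⟩
    X * X + δ * (X + D) + X * D           ∎)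
  -- This turns the error δ N² into 4 δ X², which explains the 4 in N + 4 δ.
  N≤2X : N ≤ 2 * X
  N≤2X = ≤-trans (m≤m+n N _) h₂
  lem₆ : ∀ X N δ → X * X * N + δ * ((2 * X) * (2 * X)) ≡ X * X * (N + 4 * δ)
  lem₆ = solve-∀
  lem₇ : ∀ X N δ → (X * X + δ * N) * N ≡ X * X * N + δ * (N * N)
  lem₇ = solve-∀
  term : suc g * suc (x + D) * N ≤ X * X * (N + 4 * δ)
  term = begin
    suc g * (X + D) * N  ≤⟨ *-monoˡ-≤ N pair ⟩
    (X * X + δ * (X + D)) * N  ≤⟨ *-monoˡ-≤ N (+-monoʳ-≤ (X * X) (*-monoʳ-≤ δ h₃)) ⟩
    (X * X + δ * N) * N  ≡⟨ lem₇ X N δ ⟩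
    X * X * N + δ * (N * N)  ≤⟨ +-monoʳ-≤ (X * X * N) (*-monoʳ-≤ δ (*-mono-≤ N≤2X N≤2X)) ⟩
    X * X * N + δ * ((2 * X) * (2 * X))        ≡⟨ lem₆ X N δ ⟩
    X * X * (N + 4 * δ)  ∎

avoids-∨ : (P Q : A → Bool) → ∀ M σ → ⟦ avoids M P σ ⟧ * ⟦ avoids M Q σ ⟧ ≡ ⟦ avoids M (λ x → P x ∨ Q x) σ ⟧
avoids-∨ P Q zero    σ       = refl
avoids-∨ P Q (suc M) []      = refl
avoids-∨ P Q (suc M) (x ∷ σ) with P x | Q x
... | true  | _     = refl
... | false | true  = *-zeroʳ ⟦ avoids M P σ ⟧
... | false | false = avoids-∨ P Q M σ

#-∨ : (P Q : A → Bool) → ∀ xs → # (λ x → P x ∨ Q x) xs + # (λ x → P x ∧ Q x) xs ≡ # P xs + # Q xs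
#-∨ P Q xs = trans (sym (∑-+ _ _ xs)) (trans (∑-cong pt xs) (∑-+ _ _ xs))
  where
  pt : ∀ x → ⟦ P x ∨ Q x ⟧ + ⟦ P x ∧ Q x ⟧ ≡ ⟦ P x ⟧ + ⟦ Q x ⟧
  pt x with P x | Q x
  ... | true  | true  = refl
  ... | true  | false = refl
  ... | false | true  = refl
  ... | false | false = refl

module _ (n k : ℕ) where

  private
    N = length (kSets n k)
    U = kSets n k
    Ω = perms N U

  -- The probability that the first R μ sets all miss `J` is at most (1 - D / N) ^ (R μ), the case
  -- of a single vertex in the estimate for components.
  #isolated : ∀ (J : Subset n) t R μ → k ≡ ∣ J ∣ + t → (let D = bin (n ∸ ∣ J ∣) t) →
    0 < N → D ≤ N → N ≤ R * D → R * μ ≤ N → # (avoids (R * μ) (⊇ᵇ J)) Ω * 2 ^ μ ≤ N !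
  #isolated J t R μ k≡ N>0 D≤N N≤RD M≤N = *-cancelʳ-≤ _ _ (N ^ M) {{m^n≢0 N M {{>-nonZero N>0}}}} (begin
    # (avoids M (⊇ᵇ J)) Ω * 2 ^ μ * N ^ M        ≡⟨ cong (λ z → z * 2 ^ μ * N ^ M) (#avoids (⊇ᵇ J) N U M refl M≤N) ⟩
    falling c M * (N ∸ M) ! * 2 ^ μ * N ^ M           ≡⟨ lem (falling c M * (N ∸ M) !) (2 ^ μ) (N ^ M) ⟩
    falling c M * (N ∸ M) ! * N ^ M * 2 ^ μ           ≤⟨ *-monoˡ-≤ (2 ^ μ) (falling-ratio c≤N M c (N ∸ M) (≤-reflexive (cong (c *_) (sym M+)))) ⟩
    c ^ M * (M + (N ∸ M)) ! * 2 ^ μ              ≡⟨ cong₂ (λ y z → y ^ M * z ! * 2 ^ μ) c≡ M+ ⟩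
    (N ∸ 1 * D) ^ M * N ! * 2 ^ μ  ≡⟨ lem₂ ((N ∸ 1 * D) ^ M) (N !) (2 ^ μ) ⟩
    N ! * (2 ^ μ * (N ∸ 1 * D) ^ M)              ≡⟨ cong (λ z → N ! * (2 ^ z * (N ∸ 1 * D) ^ M)) (*-identityˡ μ) ⟨
    N ! * (2 ^ (1 * μ) * (N ∸ 1 * D) ^ M)        ≤⟨ *-monoʳ-≤ (N !) (2^sμ*[N-sd]^Rμ≤N^Rμ N D R 1 μ N>0 D≤N N≤RD) ⟩
    N ! * N ^ M  ∎)
    where
    open ≤-Reasoning
    M = R * μ
    D = bin (n ∸ ∣ J ∣) t
    c = # (not ∘ ⊇ᵇ J) U
    #D : # (⊇ᵇ J) U ≡ D
    #D = subst (λ z → # (⊇ᵇ J) (kSets n z) ≡ D) (sym k≡) (#-supersets J t)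
    D+c : D + c ≡ N
    D+c = trans (cong (_+ c) (sym #D)) (#-complement (⊇ᵇ J) U)
    c≤N : c ≤ N
    c≤N = ≤-trans (m≤n+m c D) (≤-reflexive D+c)
    c≡ : c ≡ N ∸ 1 * D
    c≡ = trans (sym (m+n∸m≡n D c)) (cong₂ _∸_ D+c (sym (*-identityˡ D)))
    M+ : M + (N ∸ M) ≡ N
    M+ = m+[n∸m]≡n M≤N
    lem : ∀ a b c → a * b * c ≡ a * c * b
    lem = solve-∀
    lem₂ : ∀ a b c → a * b * c ≡ b * (c * a)
    lem₂ = solve-∀

  module _ (j t M : ℕ) (k≡ : k ≡ suc j + t) (M≤N : M ≤ length (kSets n k)) (D≤N : bin (n ∸ j) (suc t) ≤ length (kSets n k)) where

    private
      D = bin (n ∸ j) (suc t)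
      δ = bin (n ∸ suc j) t

    #isolatedSets : List (Subset n) → ℕ
    #isolatedSets σ = # (λ J → avoids M (⊇ᵇ J) σ) (kSets n j)

    private
      b  = length (kSets n j)
      x  = N ∸ D
      c₁ = falling x M * (N ∸ M) !
      c₂ = falling (x + δ ∸ D) M * (N ∸ M) !

      k≡j : k ≡ j + suc t
      k≡j = trans k≡ (sym (+-suc j t))

      #D : ∀ {J} → J ∈ kSets n j → # (⊇ᵇ J) U ≡ D
      #D {J} J∈ with refl ← ∈-kSets⁻ {K = J} J∈ = subst (λ z → # (⊇ᵇ J) (kSets n z) ≡ D) (sym k≡j) (#-supersets J (suc t))

      single : ∀ {J} → J ∈ kSets n j → # (avoids M (⊇ᵇ J)) Ω ≡ c₁
      single {J} J∈ = trans (#avoids (⊇ᵇ J) N U M refl M≤N) (cong (λ z → falling z M * (N ∸ M) !)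
        (trans (sym (m+n∸m≡n (# (⊇ᵇ J) U) _)) (cong₂ _∸_ (#-complement (⊇ᵇ J) U) (#D J∈))))

      #both : ∀ {J₁ J₂} → J₁ ∈ kSets n j → J₂ ∈ kSets n j → J₁ ≢ J₂ → # (λ K → ⊇ᵇ J₁ K ∧ ⊇ᵇ J₂ K) U ≤ δ
      #both {J₁} {J₂} J₁∈ J₂∈ J₁≢J₂ with J₂ ⊆? J₁
      ... | yes J₂⊆J₁ = contradiction (⊆-antisym J₁⊆J₂ J₂⊆J₁) J₁≢J₂
        where
        J₁⊆J₂ : J₁ ⊆ J₂
        J₁⊆J₂ with J₁ ⊆? J₂
        ... | yes h = h
        ... | no  h = ⊥-elim (⊈-sym (trans (∈-kSets⁻ {K = J₂} J₂∈) (sym (∈-kSets⁻ {K = J₁} J₁∈))) h J₂⊆J₁)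
      ... | no J₂⊈J₁ with y , y∈ ← ∣p∣>0⇒nonempty (J₂ ─ J₁) (¬⊆⇒0<∣─∣ J₂ J₁ J₂⊈J₁) = begin
        # (λ K → ⊇ᵇ J₁ K ∧ ⊇ᵇ J₂ K) U      ≤⟨ ∑-mono-∈ U (λ K _ → pt K) ⟩
        # (⊇ᵇ (J₁ ∪ ⁅ y ⁆)) U              ≡⟨ subst (λ z → # (⊇ᵇ (J₁ ∪ ⁅ y ⁆)) (kSets n z) ≡ bin (n ∸ ∣ J₁ ∪ ⁅ y ⁆ ∣) t) (trans (cong (_+ t) size) (sym k≡)) (#-supersets (J₁ ∪ ⁅ y ⁆) t) ⟩
        bin (n ∸ ∣ J₁ ∪ ⁅ y ⁆ ∣) t         ≡⟨ cong (λ z → bin (n ∸ z) t) size ⟩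
        δ  ∎
        where
        open ≤-Reasoning
        size : ∣ J₁ ∪ ⁅ y ⁆ ∣ ≡ suc j
        size = trans (∣p∪⁅x⁆∣ J₁ (∈─⇒∉ J₂ J₁ y∈)) (cong suc (∈-kSets⁻ {K = J₁} J₁∈))
        pt : ∀ K → ⟦ ⊇ᵇ J₁ K ∧ ⊇ᵇ J₂ K ⟧ ≤ ⟦ ⊇ᵇ (J₁ ∪ ⁅ y ⁆) K ⟧
        pt K with J₁ ⊆? K | J₂ ⊆? K
        ... | no _   | _     = z≤n
        ... | yes _  | no _  = z≤n
        ... | yes J₁⊆K | yes J₂⊆K = ≤-reflexive (sym (cong ⟦_⟧ (dec-true (J₁ ∪ ⁅ y ⁆ ⊆? K) (∪⁅⁆-⊆ J₁⊆K (J₂⊆K (p─q⊆p J₂ J₁ y∈))))))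

      -- By inclusion and exclusion at most N - 2 D + δ k-sets contain neither j-set: those
      -- containing both contain a (j + 1)-set.
      pair : ∀ {J₁ J₂} → J₁ ∈ kSets n j → J₂ ∈ kSets n j → J₁ ≢ J₂ → # (avoids M (λ K → ⊇ᵇ J₁ K ∨ ⊇ᵇ J₂ K)) Ω ≤ c₂
      pair {J₁} {J₂} J₁∈ J₂∈ J₁≢J₂ = ≤-trans (≤-reflexive (#avoids B N U M refl M≤N))
        (*-monoˡ-≤ ((N ∸ M) !) (falling-monoˡ M (m+n≤o⇒m≤o∸n r (+-cancelʳ-≤ D _ _ r+D+D≤))))
        where
        open ≤-Reasoning
        B = λ K → ⊇ᵇ J₁ K ∨ ⊇ᵇ J₂ K
        B∧ = λ K → ⊇ᵇ J₁ K ∧ ⊇ᵇ J₂ K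
        r = # (not ∘ B) U
        lem : ∀ r u w → r + (u + w) ≡ u + r + w
        lem = solve-∀
        lem₂ : ∀ x D δ → x + D + δ ≡ x + δ + D
        lem₂ = solve-∀
        r+D+D≤ : r + D + D ≤ x + δ + D
        r+D+D≤ = begin
          r + D + D  ≡⟨ +-assoc r D D ⟩
          r + (D + D)  ≡⟨ cong (r +_) (cong₂ _+_ (#D J₁∈) (#D J₂∈)) ⟨
          r + (# (⊇ᵇ J₁) U + # (⊇ᵇ J₂) U) ≡⟨ cong (r +_) (#-∨ (⊇ᵇ J₁) (⊇ᵇ J₂) U) ⟨
          r + (# B U + # B∧ U)            ≡⟨ lem r (# B U) (# B∧ U) ⟩
          # B U + r + # B∧ U              ≡⟨ cong (_+ # B∧ U) (#-complement B U) ⟩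
          N + # B∧ U  ≤⟨ +-monoʳ-≤ N (#both J₁∈ J₂∈ J₁≢J₂) ⟩
          N + δ  ≡⟨ cong (_+ δ) (m∸n+n≡m D≤N) ⟨
          x + D + δ  ≡⟨ lem₂ x D δ ⟩
          x + δ + D  ∎

      mean : ∑ #isolatedSets Ω ≡ b * c₁
      mean = trans (∑-swap _ Ω (kSets n j)) (trans (∑-cong-∈ (kSets n j) (λ J → single)) (∑-const c₁ (kSets n j)))

      square : ∑ (λ σ → #isolatedSets σ * #isolatedSets σ) Ω ≤ b * c₁ + b * b * c₂
      square = begin
        ∑ (λ σ → #isolatedSets σ * #isolatedSets σ) Ω    ≡⟨ ∑-cong expand Ω ⟩
        ∑ (λ σ → ∑ (λ J₁ → ∑ (λ J₂ → ⟦ both J₁ J₂ σ ⟧) (kSets n j)) (kSets n j)) Ω ≡⟨ ∑-swap _ Ω (kSets n j) ⟩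
        ∑ (λ J₁ → ∑ (λ σ → ∑ (λ J₂ → ⟦ both J₁ J₂ σ ⟧) (kSets n j)) Ω) (kSets n j) ≡⟨ ∑-cong (λ J₁ → ∑-swap _ Ω (kSets n j)) (kSets n j) ⟩
        ∑ (λ J₁ → ∑ (λ J₂ → # (both J₁ J₂) Ω) (kSets n j)) (kSets n j) ≤⟨ ∑-mono-∈ (kSets n j) row ⟩
        ∑ (λ _ → c₁ + b * c₂) (kSets n j)  ≡⟨ ∑-const (c₁ + b * c₂) (kSets n j) ⟩
        b * (c₁ + b * c₂)  ≡⟨ trans (*-distribˡ-+ b c₁ (b * c₂)) (cong (b * c₁ +_) (sym (*-assoc b b c₂))) ⟩
        b * c₁ + b * b * c₂  ∎
        where
        open ≤-Reasoning
        both : Subset n → Subset n → List (Subset n) → Bool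
        both J₁ J₂ = avoids M (λ K → ⊇ᵇ J₁ K ∨ ⊇ᵇ J₂ K)
        expand : ∀ σ → #isolatedSets σ * #isolatedSets σ ≡ ∑ (λ J₁ → ∑ (λ J₂ → ⟦ both J₁ J₂ σ ⟧) (kSets n j)) (kSets n j)
        expand σ = trans (sym (∑-*ʳ (#isolatedSets σ) _ (kSets n j)))
          (∑-cong (λ J₁ → trans (sym (∑-*ˡ ⟦ avoids M (⊇ᵇ J₁) σ ⟧ _ (kSets n j)))
            (∑-cong (λ J₂ → avoids-∨ (⊇ᵇ J₁) (⊇ᵇ J₂) M σ) (kSets n j))) (kSets n j))
        cell : ∀ {J₁ J₂} → J₁ ∈ kSets n j → J₂ ∈ kSets n j → # (both J₁ J₂) Ω ≤ ⟦ does (J₂ ≟ˢ J₁) ⟧ * c₁ + c₂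
        cell {J₁} {J₂} J₁∈ J₂∈ with J₂ ≟ˢ J₁
        ... | no  J₂≢J₁ = pair J₁∈ J₂∈ (J₂≢J₁ ∘ sym)
        ... | yes refl = ≤-trans (∑-mono-∈ Ω (λ σ _ → ≤-trans (≤-reflexive (sym (avoids-∨ (⊇ᵇ J₁) (⊇ᵇ J₁) M σ))) (idem (avoids M (⊇ᵇ J₁) σ))))
                           (≤-trans (≤-reflexive (trans (single J₁∈) (sym (*-identityˡ c₁)))) (m≤m+n (1 * c₁) c₂))
          where
          idem : ∀ a → ⟦ a ⟧ * ⟦ a ⟧ ≤ ⟦ a ⟧
          idem true  = ≤-refl
          idem false = ≤-refl
        row : ∀ J₁ → J₁ ∈ kSets n j → ∑ (λ J₂ → # (both J₁ J₂) Ω) (kSets n j) ≤ c₁ + b * c₂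
        row J₁ J₁∈ = begin
          ∑ (λ J₂ → # (both J₁ J₂) Ω) (kSets n j)  ≤⟨ ∑-mono-∈ (kSets n j) (λ J₂ → cell J₁∈) ⟩
          ∑ (λ J₂ → ⟦ does (J₂ ≟ˢ J₁) ⟧ * c₁ + c₂) (kSets n j)          ≡⟨ ∑-+ _ _ (kSets n j) ⟩
          ∑ (λ J₂ → ⟦ does (J₂ ≟ˢ J₁) ⟧ * c₁) (kSets n j) + ∑ (λ _ → c₂) (kSets n j) ≡⟨ cong₂ _+_ (∑-*ʳ c₁ _ (kSets n j)) (∑-const c₂ (kSets n j)) ⟩
          # (λ J₂ → does (J₂ ≟ˢ J₁)) (kSets n j) * c₁ + b * c₂          ≤⟨ +-monoˡ-≤ (b * c₂) (*-monoˡ-≤ c₁ (#-≟≤1 _≟ˢ_ (Unique-kSets n j))) ⟩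
          1 * c₁ + b * c₂  ≡⟨ cong (_+ b * c₂) (*-identityˡ c₁) ⟩
          c₁ + b * c₂  ∎

    -- Each draw misses a given j-set with probability at least 1 - 1 / (6 y), and the `M` draws
    -- fill at most w blocks of 6 y. So the mean is at least b / 3 ^ w ≥ e. Pairs are correlated by
    -- at most (1 + 4 δ / N) ^ M, which is at most 1 + 1 / e.
    #noIsolated : ∀ e y w → 0 < e → 0 < y → 0 < N → N + 2 * M ≤ 2 * x → suc e * (M * (4 * δ)) ≤ N →
      M ≤ w * (6 * y) → 6 * y * D + M ≤ N → e * 3 ^ w ≤ b →
      e * # (λ σ → #isolatedSets σ ≡ᵇ 0) Ω ≤ 2 * N !
    #noIsolated e y w e>0 y>0 N>0 N+2M≤2x corr M≤ 6yD+M≤N e3^w≤b =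
      secondMoment Ω #isolatedSets (N !) (length-perms N U refl) b c₁ c₂ e mean square h₂ h₁
        (≤-trans (*-mono-≤ e>0 (!>0 N)) h₁)
      where
      open ≤-Reasoning
      h = (N ∸ M) !
      x+D : x + D ≡ N
      x+D = m∸n+n≡m D≤N
      F≡ : N ! ≡ falling N M * h
      F≡ = sym (falling-*-! M≤N)
      u = 6 * y ∸ 1
      u>0 : 0 < u
      u>0 = ∸-monoˡ-≤ 1 (*-mono-≤ {2} {6} {1} {y} (s≤s (s≤s z≤n)) y>0)
      fallingN≤ : falling N M ≤ 3 ^ w * falling x M
      fallingN≤ = *-cancelˡ-≤ (u ^ M) {{m^n≢0 u M {{>-nonZero u>0}}}} (begin
        u ^ M * falling N M  ≡⟨ cong (λ z → u ^ M * falling z M) x+D ⟨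
        u ^ M * falling (x + D) M  ≤⟨ falling-lower (6 * y) D M x (≤-trans 6yD+M≤N (≤-reflexive (sym x+D))) ⟩
        (6 * y) ^ M * falling x M  ≤⟨ *-monoˡ-≤ (falling x M) ([6y]^M≤3^w[6y-1]^M y w M y>0 M≤) ⟩
        3 ^ w * u ^ M * falling x M              ≡⟨ lem (3 ^ w) (u ^ M) (falling x M) ⟩
        u ^ M * (3 ^ w * falling x M)            ∎)
        where
        lem : ∀ a b c → a * b * c ≡ b * (a * c)
        lem = solve-∀
      h₁ : e * N ! ≤ b * c₁
      h₁ = begin
        e * N !  ≡⟨ cong (e *_) F≡ ⟩
        e * (falling N M * h)  ≤⟨ *-monoʳ-≤ e (*-monoˡ-≤ h fallingN≤) ⟩
        e * (3 ^ w * falling x M * h)            ≡⟨ lem e (3 ^ w) (falling x M) h ⟩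
        e * 3 ^ w * c₁  ≤⟨ *-monoˡ-≤ c₁ e3^w≤b ⟩
        b * c₁  ∎
        where
        lem : ∀ a b c d → a * (b * c * d) ≡ a * b * (c * d)
        lem = solve-∀
      -- `bernoulli⁻` gives (Y / N) ^ M ≤ Y / W, and the bound on `M * (4 * δ)` gives Y / W ≤ 1 + 1
      -- / e.
      Y = N + 4 * δ
      W = Y ∸ M * (4 * δ)
      corr₁ : M * (4 * δ) * suc e ≤ Y
      corr₁ = ≤-trans (≤-reflexive (*-comm _ (suc e))) (≤-trans corr (m≤m+n N (4 * δ)))
      Z≤Y : M * (4 * δ) ≤ Y
      Z≤Y = ≤-trans (m≤m*n (M * (4 * δ)) (suc e)) corr₁
      eY≤ : e * Y ≤ suc e * W
      eY≤ = +-cancelʳ-≤ (suc e * (M * (4 * δ))) _ _ (begin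
        e * Y + suc e * (M * (4 * δ))       ≤⟨ +-monoʳ-≤ (e * Y) (≤-trans corr (m≤m+n N (4 * δ))) ⟩
        e * Y + Y  ≡⟨ +-comm (e * Y) Y ⟩
        suc e * Y  ≡⟨ cong (suc e *_) (m∸n+n≡m Z≤Y) ⟨
        suc e * (W + M * (4 * δ))           ≡⟨ *-distribˡ-+ (suc e) W _ ⟩
        suc e * W + suc e * (M * (4 * δ))   ∎)
      W>0 : 0 < W
      W>0 with W in eq
      ... | suc _ = s≤s z≤n
      ... | zero = contradiction (≤-trans eY≤ (≤-reflexive (trans (cong (suc e *_) eq) (*-zeroʳ (suc e)))))
                     (<⇒≱ (*-mono-≤ e>0 (≤-trans N>0 (m≤m+n N (4 * δ)))))
      g = x + δ ∸ D
      D≤x+δ : D ≤ x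
      D≤x+δ = +-cancelˡ-≤ x _ _ (begin
        x + D             ≡⟨ x+D ⟩
        N  ≤⟨ m≤m+n N (2 * M) ⟩
        N + 2 * M         ≤⟨ N+2M≤2x ⟩
        2 * x             ≡⟨ cong (x +_) (+-identityʳ x) ⟩
        x + x             ∎)
      Fc₂W≤ : N ! * c₂ * W ≤ c₁ * c₁ * Y
      Fc₂W≤ = *-cancelʳ-≤ _ _ (N ^ M) {{m^n≢0 N M {{>-nonZero N>0}}}} (begin
        N ! * c₂ * W * N ^ M  ≡⟨ cong (λ z → z * c₂ * W * N ^ M) F≡ ⟩
        falling N M * h * (falling g M * h) * W * N ^ M  ≡⟨ lem (falling N M) h (falling g M) W (N ^ M) ⟩
        falling g M * falling N M * N ^ M * (h * h * W)  ≡⟨ cong (λ z → falling g M * falling z M * N ^ M * (h * h * W)) x+D ⟨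
        falling g M * falling (x + D) M * N ^ M * (h * h * W)
          ≤⟨ *-monoˡ-≤ (h * h * W) (falling-correlation N D δ M g x (≤-reflexive (m∸n+n≡m (≤-trans D≤x+δ (m≤m+n x δ)))) N+2M≤2x (≤-reflexive x+D)) ⟩
        falling x M * falling x M * Y ^ M * (h * h * W)  ≡⟨ lem₂ (falling x M) (Y ^ M) h W ⟩
        c₁ * c₁ * (W * Y ^ M)  ≤⟨ *-monoʳ-≤ (c₁ * c₁) (bernoulli⁻ M N (4 * δ)) ⟩
        c₁ * c₁ * (N ^ M * Y)  ≡⟨ lem₃ (c₁ * c₁) (N ^ M) Y ⟩
        c₁ * c₁ * Y * N ^ M  ∎)
        where
        lem : ∀ a h b w m → a * h * (b * h) * w * m ≡ b * a * m * (h * h * w)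
        lem = solve-∀
        lem₂ : ∀ f y h w → f * f * y * (h * h * w) ≡ f * h * (f * h) * (w * y)
        lem₂ = solve-∀
        lem₃ : ∀ a b c → a * (b * c) ≡ a * c * b
        lem₃ = solve-∀
      h₂ : e * (N ! * c₂) ≤ suc e * (c₁ * c₁)
      h₂ = *-cancelʳ-≤ _ _ W {{>-nonZero W>0}} (begin
        e * (N ! * c₂) * W              ≡⟨ *-assoc e _ W ⟩
        e * (N ! * c₂ * W)              ≤⟨ *-monoʳ-≤ e Fc₂W≤ ⟩
        e * (c₁ * c₁ * Y)               ≡⟨ lem e (c₁ * c₁) Y ⟩
        c₁ * c₁ * (e * Y)               ≤⟨ *-monoʳ-≤ (c₁ * c₁) eY≤ ⟩
        c₁ * c₁ * (suc e * W)           ≡⟨ lem (c₁ * c₁) (suc e) W ⟩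
        suc e * (c₁ * c₁ * W)           ≡⟨ *-assoc (suc e) (c₁ * c₁) W ⟨
        suc e * (c₁ * c₁) * W           ∎)
        where
        lem : ∀ a b c → a * (b * c) ≡ b * (a * c)
        lem = solve-∀

-- Binomial and asymptotic estimates

bin-suc-≤ : ∀ n k → bin n k ≤ bin (suc n) k
bin-suc-≤ n zero    = ≤-refl
bin-suc-≤ n (suc k) = m≤n+m (bin n (suc k)) (bin n k)

bin-+-≤ : ∀ c n k → bin n k ≤ bin (c + n) k
bin-+-≤ zero    n k = ≤-refl
bin-+-≤ (suc c) n k = ≤-trans (bin-+-≤ c n k) (bin-suc-≤ (c + n) k)

bin-monoˡ : ∀ {m n} k → m ≤ n → bin m k ≤ bin n k
bin-monoˡ {m} {n} k m≤n = subst (λ z → bin m k ≤ bin z k) (m∸n+n≡m m≤n) (bin-+-≤ (n ∸ m) m k)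

bin-diagonal : ∀ c n k → bin n k ≤ bin (c + n) (c + k)
bin-diagonal zero    n k = ≤-refl
bin-diagonal (suc c) n k = ≤-trans (bin-diagonal c n k) (m≤m+n (bin (c + n) (c + k)) _)

bin-≤-^ : ∀ n k → bin n k ≤ n ^ k
bin-≤-^ n       zero    = ≤-refl
bin-≤-^ zero    (suc k) = z≤n
bin-≤-^ (suc n) (suc k) = begin
  bin n k + bin n (suc k)       ≤⟨ +-mono-≤ (bin-≤-^ n k) (bin-≤-^ n (suc k)) ⟩
  n ^ k + n * n ^ k             ≤⟨ *-monoʳ-≤ (suc n) (^-monoˡ-≤ k (n≤1+n n)) ⟩
  suc n * suc n ^ k             ∎
  where open ≤-Reasoning

bin-absorb : ∀ n k → suc k * bin (suc n) (suc k) ≡ suc n * bin n k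
bin-absorb zero    zero    = refl
bin-absorb zero    (suc k) = *-zeroʳ (suc (suc k))
bin-absorb (suc n) zero    = trans (lem (bin n 1)) (cong suc (trans (cong suc (bin-1 n)) (lem₂ n)))
  where
  lem : ∀ b → suc zero * (1 + (1 + b)) ≡ suc (suc b)
  lem = solve-∀
  lem₂ : ∀ m → 1 + m ≡ suc (m * 1)
  lem₂ = solve-∀
bin-absorb (suc n) (suc k) = begin
  suc (suc k) * (bin (suc n) (suc k) + bin (suc n) (suc (suc k)))  ≡⟨ lem k (bin (suc n) (suc k)) (bin (suc n) (suc (suc k))) ⟩
  suc k * bin (suc n) (suc k) + bin (suc n) (suc k) + suc (suc k) * bin (suc n) (suc (suc k)) ≡⟨ cong₂ (λ y z → y + bin (suc n) (suc k) + z) (bin-absorb n k) (bin-absorb n (suc k)) ⟩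
  suc n * bin n k + bin (suc n) (suc k) + suc n * bin n (suc k)    ≡⟨ lem₂ n (bin n k) (bin n (suc k)) ⟩
  suc (suc n) * (bin n k + bin n (suc k))  ∎
  where
  open ≡-Reasoning
  lem : ∀ k a b → suc (suc k) * (a + b) ≡ suc k * a + a + suc (suc k) * b
  lem = solve-∀
  lem₂ : ∀ m a b → suc m * a + (a + b) + suc m * b ≡ suc (suc m) * (a + b)
  lem₂ = solve-∀

bin-absorbʳ : ∀ y t → suc t * bin y (suc t) + suc t * bin y t ≡ suc y * bin y t
bin-absorbʳ y t = trans (trans (+-comm (suc t * bin y (suc t)) _) (sym (*-distribˡ-+ (suc t) (bin y t) _))) (bin-absorb y t)

bin-linear : ∀ y t → y ≤ bin (t + y) (t + 1)
bin-linear y t = ≤-trans (≤-reflexive (sym (bin-1 y))) (bin-diagonal t y 1)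

bin-increment : ∀ e x t → bin (e + x) (suc t) ≤ bin x (suc t) + e * bin (e + x) t
bin-increment zero    x t = m≤m+n _ 0
bin-increment (suc e) x t = begin
  bin (e + x) t + bin (e + x) (suc t)  ≤⟨ +-mono-≤ (bin-suc-≤ (e + x) t) (≤-trans (bin-increment e x t) (+-monoʳ-≤ (bin x (suc t)) (*-monoʳ-≤ e (bin-suc-≤ (e + x) t)))) ⟩
  bin (suc e + x) t + (bin x (suc t) + e * bin (suc e + x) t)  ≡⟨ lem (bin (suc e + x) t) (bin x (suc t)) e ⟩
  bin x (suc t) + suc e * bin (suc e + x) t  ∎
  where
  open ≤-Reasoning
  lem : ∀ a b e → a + (b + e * a) ≡ b + suc e * a
  lem = solve-∀

-- Factor by factor, y - l ≤ 3 (x - l) for all l ≤ t. The 3 leaves room for lower order terms when x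
-- is about half of y.
bin-triple : ∀ t y x → y + 2 * t ≤ 3 * x → bin y t ≤ 3 ^ t * bin x t
bin-triple zero    y       x       h = ≤-refl
bin-triple (suc t) zero    x       h = z≤n
bin-triple (suc t) (suc y) zero    h with () ← h
bin-triple (suc t) (suc y) (suc x) h = *-cancelˡ-≤ (suc t) (begin
  suc t * bin (suc y) (suc t)            ≡⟨ bin-absorb y t ⟩
  suc y * bin y t  ≤⟨ *-mono-≤ (≤-trans (m≤m+n (suc y) (2 * suc t)) h) (bin-triple t y x h′) ⟩
  3 * suc x * (3 ^ t * bin x t)          ≡⟨ lem (suc x) (3 ^ t) (bin x t) ⟩
  3 * 3 ^ t * (suc x * bin x t)          ≡⟨ cong (3 * 3 ^ t *_) (bin-absorb x t) ⟨
  3 * 3 ^ t * (suc t * bin (suc x) (suc t)) ≡⟨ lem₂ (3 * 3 ^ t) (suc t) (bin (suc x) (suc t)) ⟩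
  suc t * (3 * 3 ^ t * bin (suc x) (suc t)) ∎)
  where
  open ≤-Reasoning
  lem : ∀ x a b → 3 * x * (a * b) ≡ 3 * a * (x * b)
  lem = solve-∀
  lem₂ : ∀ a b c → a * (b * c) ≡ b * (a * c)
  lem₂ = solve-∀
  lem₃ : ∀ y t → 3 + (y + 2 * t) ≡ suc y + 2 * suc t
  lem₃ = solve-∀
  lem₄ : ∀ x → 3 * suc x ≡ 3 + 3 * x
  lem₄ = solve-∀
  h′ : y + 2 * t ≤ 3 * x
  h′ = +-cancelˡ-≤ 3 _ _ (≤-trans (≤-reflexive (lem₃ y t)) (≤-trans h (≤-reflexive (lem₄ x))))

x^j≤j^j*bin : ∀ j x → x ^ j ≤ j ^ j * bin (j + x) j
x^j≤j^j*bin zero    x = ≤-refl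
x^j≤j^j*bin (suc j) x = begin
  x * x ^ j  ≤⟨ *-mono-≤ (≤-trans (m≤n+m x j) (n≤1+n (j + x))) (x^j≤j^j*bin j x) ⟩
  suc (j + x) * (j ^ j * bin (j + x) j)              ≤⟨ *-monoʳ-≤ (suc (j + x)) (*-monoˡ-≤ (bin (j + x) j) (^-monoˡ-≤ j (n≤1+n j))) ⟩
  suc (j + x) * (suc j ^ j * bin (j + x) j)          ≡⟨ lem (suc (j + x)) (suc j ^ j) (bin (j + x) j) ⟩
  suc j ^ j * (suc (j + x) * bin (j + x) j)          ≡⟨ cong (suc j ^ j *_) (bin-absorb (j + x) j) ⟨
  suc j ^ j * (suc j * bin (suc (j + x)) (suc j))    ≡⟨ lem₂ (suc j ^ j) (suc j) (bin (suc (j + x)) (suc j)) ⟩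
  suc j * suc j ^ j * bin (suc (j + x)) (suc j)      ∎
  where
  open ≤-Reasoning
  lem : ∀ a b c → a * (b * c) ≡ b * (a * c)
  lem = solve-∀
  lem₂ : ∀ a b c → a * (b * c) ≡ b * a * c
  lem₂ = solve-∀

n^j≤[2j]^j*bin : ∀ {n} j → 2 * j ≤ n → n ^ j ≤ (2 * j) ^ j * bin n j
n^j≤[2j]^j*bin {n} j 2j≤n = begin
  n ^ j  ≤⟨ ^-monoˡ-≤ j n≤2x ⟩
  (2 * x) ^ j  ≡⟨ ^-distribʳ-* j 2 x ⟩
  2 ^ j * x ^ j               ≤⟨ *-monoʳ-≤ (2 ^ j) (x^j≤j^j*bin j x) ⟩
  2 ^ j * (j ^ j * bin (j + x) j) ≡⟨ *-assoc (2 ^ j) (j ^ j) _ ⟨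
  2 ^ j * j ^ j * bin (j + x) j   ≡⟨ cong₂ (λ y z → y * bin z j) (^-distribʳ-* j 2 j) (sym j+x) ⟨
  (2 * j) ^ j * bin n j       ∎
  where
  open ≤-Reasoning
  x = n ∸ j
  j+x : j + x ≡ n
  j+x = m+[n∸m]≡n (≤-trans (m≤m+n j _) 2j≤n)
  j≤x : j ≤ x
  j≤x = +-cancelˡ-≤ j _ _ (≤-trans (≤-reflexive (cong (j +_) (sym (+-identityʳ j)))) (≤-trans 2j≤n (≤-reflexive (sym j+x))))
  n≤2x : n ≤ 2 * x
  n≤2x = ≤-trans (≤-reflexive (sym j+x)) (≤-trans (+-monoˡ-≤ x j≤x) (≤-reflexive (cong (x +_) (sym (+-identityʳ x)))))

-- The term for s is at most F / A divided by 2 ^ (s + 1). The induction carries the missing tail as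
-- the summand `F`: the first m terms add up to at most (1 - 1 / 2 ^ m) F / A.
geometric : ∀ (x : ℕ → ℕ) A F m → (∀ s → s < m → x s * (A * 2 ^ suc s) ≤ F) → ∑ x (downFrom m) * A ≤ F
geometric x A F m h = *-cancelʳ-≤ _ _ (2 ^ m) {{m^n≢0 2 m}} (≤-trans (≤-reflexive (*-assoc (∑ x (downFrom m)) A (2 ^ m)))
  (≤-trans (m≤m+n _ F) (go m h)))
  where
  go : ∀ m → (∀ s → s < m → x s * (A * 2 ^ suc s) ≤ F) → ∑ x (downFrom m) * (A * 2 ^ m) + F ≤ F * 2 ^ m
  go zero    h = ≤-reflexive (sym (*-identityʳ F))
  go (suc m) h = begin
    (x m + X) * (A * (2 * 2 ^ m)) + F              ≡⟨ lem (x m) X A (2 ^ m) F ⟩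
    x m * (A * (2 * 2 ^ m)) + (2 * (X * (A * 2 ^ m)) + F) ≤⟨ +-monoˡ-≤ _ (h m ≤-refl) ⟩
    F + (2 * (X * (A * 2 ^ m)) + F)  ≡⟨ lem₂ F (X * (A * 2 ^ m)) ⟩
    2 * (X * (A * 2 ^ m) + F)  ≤⟨ *-monoʳ-≤ 2 (go m (λ s s<m → h s (m≤n⇒m≤1+n s<m))) ⟩
    2 * (F * 2 ^ m)  ≡⟨ lem₃ F (2 ^ m) ⟩
    F * (2 * 2 ^ m)  ∎
    where
    open ≤-Reasoning
    X = ∑ x (downFrom m)
    lem : ∀ x X a p F → (x + X) * (a * (2 * p)) + F ≡ x * (a * (2 * p)) + (2 * (X * (a * p)) + F)
    lem = solve-∀
    lem₂ : ∀ F Y → F + (2 * Y + F) ≡ 2 * (Y + F)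
    lem₂ = solve-∀
    lem₃ : ∀ F p → 2 * (F * p) ≡ F * (2 * p)
    lem₃ = solve-∀

-- 3 * 81 = 243 < 256 = 2 * 128, so the quotient exceeds (3 / 2) ^ m, which is at least m / 2 by
-- Bernoulli. Here 81 = 3 ^ 4 and 128 = 2 ^ 7 come from the factor 4 / 7 in `M₁`.
C*81^m≤128^m : ∀ C m → 2 * C ≤ m → C * 81 ^ m ≤ 128 ^ m
C*81^m≤128^m C zero    h with refl ← n≤0⇒n≡0 (≤-trans (m≤m+n C _) h) = z≤n
C*81^m≤128^m C (suc r) h = *-cancelʳ-≤ _ _ (2 ^ m) {{m^n≢0 2 m}} (begin
  C * 81 ^ m * 2 ^ m           ≡⟨ lem C (81 ^ m) (2 ^ m) ⟩
  C * 2 ^ m * 81 ^ m           ≤⟨ *-monoˡ-≤ (81 ^ m) C2^m≤3^m ⟩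
  3 ^ m * 81 ^ m               ≡⟨ ^-distribʳ-* m 3 81 ⟨
  243 ^ m  ≤⟨ ^-monoˡ-≤ m (m≤m+n 243 13) ⟩
  256 ^ m  ≡⟨ ^-distribʳ-* m 128 2 ⟩
  128 ^ m * 2 ^ m              ∎)
  where
  open ≤-Reasoning
  m = suc r
  lem : ∀ a b c → a * b * c ≡ a * c * b
  lem = solve-∀
  lem₂ : ∀ C p → C * (2 * p) ≡ 2 * C * p
  lem₂ = solve-∀
  lem₃ : ∀ r p → suc r * p ≡ suc r * 1 * p
  lem₃ = solve-∀
  C2^m≤3^m : C * 2 ^ m ≤ 3 ^ m
  C2^m≤3^m = begin
    C * (2 * 2 ^ r)  ≡⟨ lem₂ C (2 ^ r) ⟩
    2 * C * 2 ^ r  ≤⟨ *-monoˡ-≤ (2 ^ r) h ⟩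
    suc r * 2 ^ r  ≡⟨ lem₃ r (2 ^ r) ⟩
    suc r * 1 * 2 ^ r  ≤⟨ m≤n+m _ (2 ^ suc r) ⟩
    2 ^ suc r + suc r * 1 * 2 ^ r          ≤⟨ bernoulli r 2 1 ⟩
    3 ^ suc r  ∎

-- Subexponential functions

Eventually : (ℕ → Set) → Set
Eventually P = ∃[ m₀ ] ∀ m → m₀ ≤ m → P m

Eventually-× : {P Q : ℕ → Set} → Eventually P → Eventually Q → Eventually (λ m → P m × Q m)
Eventually-× (a , p) (b , q) = a ⊔ b , λ m h → p m (≤-trans (m≤m⊔n a b) h) , q m (≤-trans (m≤n⊔m a b) h)

-- Asking for all powers `a` closes the class under products: the exponent 2 a is spent on each
-- factor and a square root is taken. As m is about log n, such functions are below every fixed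
-- positive power of n.
Subexponential : (ℕ → ℕ) → Set
Subexponential f = ∀ a → Eventually (λ m → f m ^ a ≤ 2 ^ m)

m≤2^m : ∀ m → m ≤ 2 ^ m
m≤2^m zero    = z≤n
m≤2^m (suc m) = begin
  1 + m              ≤⟨ +-mono-≤ (m^n>0 2 m) (m≤2^m m) ⟩
  2 ^ m + 2 ^ m      ≡⟨ cong (2 ^ m +_) (+-identityʳ (2 ^ m)) ⟨
  2 * 2 ^ m          ∎
  where open ≤-Reasoning

const-sub : ∀ c → Subexponential (λ _ → c)
const-sub c a = c ^ a , λ m h → ≤-trans h (m≤2^m m)

-- Induction on the exponent, with 2 ^ m = 2 ^ ⌊m/2⌋ * 2 ^ ⌈m/2⌉.
C*m^a≤2^m : ∀ a C → Eventually (λ m → C * m ^ a ≤ 2 ^ m)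
C*m^a≤2^m zero    C = C , λ m h → ≤-trans (≤-reflexive (*-identityʳ C)) (≤-trans h (m≤2^m m))
C*m^a≤2^m (suc a) C with h₀ , ih ← C*m^a≤2^m a (C * 3 ^ suc a) = 2 + 2 * h₀ , bound
  where
  open ≤-Reasoning
  bound : ∀ m → 2 + 2 * h₀ ≤ m → C * m ^ suc a ≤ 2 ^ m
  bound m h = begin
    C * m ^ suc a  ≤⟨ *-monoʳ-≤ C (^-monoˡ-≤ (suc a) m≤3p) ⟩
    C * (3 * p) ^ suc a  ≡⟨ cong (C *_) (^-distribʳ-* (suc a) 3 p) ⟩
    C * (3 ^ suc a * (p * p ^ a))          ≡⟨ lem C (3 ^ suc a) p (p ^ a) ⟩
    C * 3 ^ suc a * p ^ a * p              ≤⟨ *-mono-≤ (ih p h₀≤p) (≤-trans (⌊n/2⌋≤⌈n/2⌉ m) (m≤2^m ⌈ m /2⌉)) ⟩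
    2 ^ p * 2 ^ ⌈ m /2⌉  ≡⟨ ^-distribˡ-+-* 2 p ⌈ m /2⌉ ⟨
    2 ^ (p + ⌈ m /2⌉)  ≡⟨ cong (2 ^_) (⌊n/2⌋+⌈n/2⌉≡n m) ⟩
    2 ^ m  ∎
    where
    p = ⌊ m /2⌋
    lem : ∀ C x p y → C * (x * (p * y)) ≡ C * x * y * p
    lem = solve-∀
    half : suc h₀ ≤ p
    half = ≤-trans (≤-reflexive (trans (n≡⌊n+n/2⌋ (suc h₀)) (cong ⌊_/2⌋ (lem₂ h₀)))) (⌊n/2⌋-mono h)
      where
      lem₂ : ∀ h → suc h + suc h ≡ 2 + 2 * h
      lem₂ = solve-∀
    h₀≤p : h₀ ≤ p
    h₀≤p = ≤-trans (n≤1+n h₀) half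
    ⌈⌉≤ : ∀ m → ⌈ m /2⌉ ≤ 1 + ⌊ m /2⌋
    ⌈⌉≤ zero          = z≤n
    ⌈⌉≤ (suc zero)    = ≤-refl
    ⌈⌉≤ (suc (suc m)) = s≤s (⌈⌉≤ m)
    m≤3p : m ≤ 3 * p
    m≤3p = begin
      m  ≡⟨ ⌊n/2⌋+⌈n/2⌉≡n m ⟨
      p + ⌈ m /2⌉        ≤⟨ +-monoʳ-≤ p (≤-trans (⌈⌉≤ m) (+-monoˡ-≤ p (≤-trans (s≤s z≤n) half))) ⟩
      p + (p + p)        ≡⟨ cong (λ z → p + (p + z)) (+-identityʳ p) ⟨
      3 * p              ∎

id-sub : Subexponential (λ m → m)
id-sub a with m₀ , h ← C*m^a≤2^m a 1 = m₀ , λ m le → ≤-trans (≤-reflexive (sym (+-identityʳ (m ^ a)))) (h m le)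

a²≤b²⇒a≤b : ∀ {a b} → a * a ≤ b * b → a ≤ b
a²≤b²⇒a≤b {a} {b} h with ≤-total a b
... | inj₁ a≤b = a≤b
... | inj₂ b≤a with m≤n⇒m<n∨m≡n b≤a
...   | inj₁ b<a  = contradiction h (<⇒≱ (*-mono-< b<a b<a))
...   | inj₂ refl = ≤-refl

*-sub : ∀ {f g} → Subexponential f → Subexponential g → Subexponential (λ m → f m * g m)
*-sub {f} {g} sf sg a with m₀ , h ← Eventually-× (sf (a * 2)) (sg (a * 2)) = m₀ , λ m le → a²≤b²⇒a≤b (begin
  (f m * g m) ^ a * (f m * g m) ^ a  ≡⟨ cong (λ z → z * z) (^-distribʳ-* a (f m) (g m)) ⟩
  f m ^ a * g m ^ a * (f m ^ a * g m ^ a)          ≡⟨ lem (f m ^ a) (g m ^ a) ⟩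
  (f m ^ a) ^ 2 * (g m ^ a) ^ 2  ≡⟨ cong₂ _*_ (^-*-assoc (f m) a 2) (^-*-assoc (g m) a 2) ⟩
  f m ^ (a * 2) * g m ^ (a * 2)  ≤⟨ *-mono-≤ (proj₁ (h m le)) (proj₂ (h m le)) ⟩
  2 ^ m * 2 ^ m  ∎)
  where
  open ≤-Reasoning
  lem : ∀ x y → x * y * (x * y) ≡ x * (x * 1) * (y * (y * 1))
  lem = solve-∀

+-sub : ∀ {f g} → Subexponential f → Subexponential g → Subexponential (λ m → f m + g m)
+-sub {f} {g} sf sg a
  with m₀ , h ← Eventually-× (*-sub (const-sub 2) sf a) (*-sub (const-sub 2) sg a) = m₀ , λ m le → pick m (h m le)
  where
  double : ∀ x → x + x ≡ 2 * x
  double x = cong (x +_) (sym (+-identityʳ x))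
  pick : ∀ m → (2 * f m) ^ a ≤ 2 ^ m × (2 * g m) ^ a ≤ 2 ^ m → (f m + g m) ^ a ≤ 2 ^ m
  pick m (hf , hg) with ≤-total (f m) (g m)
  ... | inj₁ f≤g = ≤-trans (^-monoˡ-≤ a (≤-trans (+-monoˡ-≤ (g m) f≤g) (≤-reflexive (double (g m))))) hg
  ... | inj₂ g≤f = ≤-trans (^-monoˡ-≤ a (≤-trans (+-monoʳ-≤ (f m) g≤f) (≤-reflexive (double (f m))))) hf

-- The parameters

-- Here i = j - 1 and t = k - j, the number n of vertices is about 2 ^ (7 q ℓ), and N is the number of k-sets.  In units
-- of N / D the times M₁ and M₂ are ν and μ₊, about (4/7) j log₂ n and j log₂ n.
module Parameters (i t′ e : ℕ) (e>0 : 0 < e) where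

  -- `q` is the factor lost in the boundary per vertex when a component has up to half of the
  -- vertices. From size `s₀` on, this loss is affordable: n ^ j is then at most 2 ^ (j (ℓ + 1) s),
  -- which spreads it over the s vertices. `C` gathers the constants of `many-sets`.
  j t k q s₀ C : ℕ
  j  = suc i
  t  = suc t′
  k  = j + t
  q  = 3 ^ t
  s₀ = 7 * q
  C  = e * 3 ^ (k + 2) * (2 * j) ^ j

  -- In powers of two, n ^ j has exponent about 7 q j ℓ. The 4 in `μ` satisfies 2 * 4 > 7, which
  -- removes components with two vertices, and 3 ^ 4 < 2 ^ 7, which keeps isolated j-sets; the
  -- factor `q` allows `R * μ` to be regrouped as `R * q` times 4 j ℓ. The `k` in `ν` makes room for
  -- the exploring edges, and `μ₊` exceeds the exponent of n ^ j by a margin for the union bound.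
  -- `α / D` bounds `M₂ / N`, and `K` is the weight of two exploration steps, the share of one
  -- vertex.
  μ ν μ₊ α K : ℕ → ℕ
  μ ℓ  = 4 * q * j * ℓ
  ν ℓ  = μ ℓ + k
  μ₊ ℓ = 7 * q * j * suc ℓ + ℓ + k
  α ℓ  = 3 * μ₊ ℓ
  K ℓ  = suc (α ℓ) * suc (α ℓ)

  record Large (ℓ : ℕ) : Set where
    field
      L₁ : k + α ℓ ≤ 2 ^ ℓ
      L₂ : k + 6 * ν ℓ * (ν ℓ + 2) ≤ 2 ^ ℓ
      L₃ : 2 * k * (7 * ν ℓ + 12) ≤ 2 ^ ℓ
      L₄ : j + 12 * suc e * t * ν ℓ ≤ 2 ^ ℓ
      L₅ : j + t * (1 + suc (ν ℓ) * s₀) ≤ 2 ^ ℓ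
      L₆ : i + s₀ + 2 * j + 4 * t ≤ 2 ^ ℓ
      L₇ : 2 * C ≤ ℓ
      L₈ : 2 ^ (7 * q * j) * (2 * e) * (2 * K ℓ * (2 * K ℓ)) ≤ 2 ^ ℓ
      L₉ : 2 ^ j * (2 * e) * (2 * K ℓ) ≤ 2 ^ ℓ

  eventually-Large : Eventually Large
  eventually-Large = proj₁ conditions , λ m le →
    let c₁ , c₂ , c₃ , c₄ , c₅ , c₆ , c₇ , c₈ , c₉ = proj₂ conditions m le in record
      { L₁ = c₁ ; L₂ = c₂ ; L₃ = c₃ ; L₄ = c₄ ; L₅ = c₅ ; L₆ = c₆ ; L₇ = c₇ ; L₈ = c₈ ; L₉ = c₉ }
    where
    first : {f : ℕ → ℕ} → Subexponential f → Eventually (λ m → f m ≤ 2 ^ m)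
    first {f} sf with m₀ , h ← sf 1 = m₀ , λ m le → ≤-trans (≤-reflexive (sym (*-identityʳ (f m)))) (h m le)
    c = const-sub
    suc-sub : {f : ℕ → ℕ} → Subexponential f → Subexponential (λ m → suc (f m))
    suc-sub sf = +-sub (c 1) sf
    ν-sub : Subexponential ν
    ν-sub = +-sub (*-sub (c (4 * q * j)) id-sub) (c k)
    α-sub : Subexponential α
    α-sub = *-sub (c 3) (+-sub (+-sub (*-sub (c (7 * q * j)) (suc-sub id-sub)) id-sub) (c k))
    2K-sub : Subexponential (λ m → 2 * K m)
    2K-sub = *-sub (c 2) (*-sub (suc-sub α-sub) (suc-sub α-sub))
    s₁ : Subexponential (λ m → k + α m)
    s₁ = +-sub (c k) α-sub
    s₂ : Subexponential (λ m → k + 6 * ν m * (ν m + 2))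
    s₂ = +-sub (c k) (*-sub (*-sub (c 6) ν-sub) (+-sub ν-sub (c 2)))
    s₃ : Subexponential (λ m → 2 * k * (7 * ν m + 12))
    s₃ = *-sub (c (2 * k)) (+-sub (*-sub (c 7) ν-sub) (c 12))
    s₄ : Subexponential (λ m → j + 12 * suc e * t * ν m)
    s₄ = +-sub (c j) (*-sub (c (12 * suc e * t)) ν-sub)
    s₅ : Subexponential (λ m → j + t * (1 + suc (ν m) * s₀))
    s₅ = +-sub (c j) (*-sub (c t) (+-sub (c 1) (*-sub (suc-sub ν-sub) (c s₀))))
    s₆ : Subexponential (λ m → i + s₀ + 2 * j + 4 * t)
    s₆ = c (i + s₀ + 2 * j + 4 * t)
    s₈ : Subexponential (λ m → 2 ^ (7 * q * j) * (2 * e) * (2 * K m * (2 * K m)))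
    s₈ = *-sub (c (2 ^ (7 * q * j) * (2 * e))) (*-sub 2K-sub 2K-sub)
    s₉ : Subexponential (λ m → 2 ^ j * (2 * e) * (2 * K m))
    s₉ = *-sub (c (2 ^ j * (2 * e))) 2K-sub

    conditions = Eventually-× (first s₁) (Eventually-× (first s₂) (Eventually-× (first s₃) (Eventually-× (first s₄)
      (Eventually-× (first s₅) (Eventually-× (first s₆) (Eventually-× (2 * C , λ _ h → h) (Eventually-× (first s₈) (first s₉))))))))

  q>0 : 0 < q
  q>0 = m^n>0 3 t

  module Estimates (n ℓ : ℕ) (2^≤n : 2 ^ (7 * q * ℓ) ≤ n) (n≤2^ : n ≤ 2 ^ (7 * q * suc ℓ)) (large : Large ℓ) where

    open Large large
    open ≤-Reasoning

    private
      mono₂ : ∀ {a b} → a ≤ b → 2 ^ a ≤ 2 ^ b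
      mono₂ = ^-monoʳ-≤ 2

      2^ℓ≤n : 2 ^ ℓ ≤ n
      2^ℓ≤n = ≤-trans (mono₂ (≤-trans (≤-reflexive (sym (*-identityˡ ℓ))) (*-monoˡ-≤ ℓ (*-mono-≤ {1} {7} (s≤s z≤n) q>0)))) 2^≤n

      L₆₁ : i + s₀ ≤ n
      L₆₁ = ≤-trans (≤-trans (m≤m+n (i + s₀) (2 * j)) (m≤m+n _ (4 * t))) (≤-trans L₆ 2^ℓ≤n)

      x = n ∸ j

      j≤n : j ≤ n
      j≤n = ≤-trans (m≤m+n j _) (≤-trans L₄ 2^ℓ≤n)

      j+x : j + x ≡ n
      j+x = m+[n∸m]≡n j≤n

    N D d₀ R M₁ M₂ δ : ℕ
    N  = length (kSets n k)
    D  = bin (n ∸ j) t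
    d₀ = bin (n ∸ (i + s₀)) t
    δ  = bin (n ∸ suc j) t′

    N≡ : N ≡ bin n k
    N≡ = length-kSets n k

    D≤N : D ≤ N
    D≤N = begin
      bin x t               ≤⟨ bin-diagonal j x t ⟩
      bin (j + x) (j + t)   ≡⟨ cong (λ z → bin z k) j+x ⟩
      bin n k               ≡⟨ N≡ ⟨
      N  ∎

    -- Since t is positive, `D` grows at least linearly in n, so it exceeds every power of log n.
    D-≥ : ∀ X → k + X ≤ n → X ≤ D
    D-≥ X h = ≤-trans X≤y (≤-trans (bin-linear y t′) (≤-reflexive (cong₂ bin t′+y (+-comm t′ 1))))
      where
      y = x ∸ t′
      t+X≤x : t + X ≤ x
      t+X≤x = +-cancelˡ-≤ j _ _ (≤-trans (≤-reflexive (sym (+-assoc j t X))) (≤-trans h (≤-reflexive (sym j+x))))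
      t′+y : t′ + y ≡ x
      t′+y = m+[n∸m]≡n (≤-trans (≤-trans (n≤1+n t′) (m≤m+n t X)) t+X≤x)
      X≤y : X ≤ y
      X≤y = +-cancelˡ-≤ t′ _ _ (≤-trans (≤-trans (n≤1+n _) t+X≤x) (≤-reflexive (sym t′+y)))

    α≤D : α ℓ ≤ D
    α≤D = D-≥ (α ℓ) (≤-trans L₁ 2^ℓ≤n)

    k≤μ₊ : k ≤ μ₊ ℓ
    k≤μ₊ = m≤n+m k (7 * q * j * suc ℓ + ℓ)

    D>0 : 0 < D
    D>0 = ≤-trans (≤-trans (s≤s z≤n) (≤-trans k≤μ₊ (m≤m+n (μ₊ ℓ) _))) α≤D

    N>0 : 0 < N
    N>0 = ≤-trans D>0 D≤N

    instance
      nonZero-D : NonZero D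
      nonZero-D = >-nonZero D>0

    -- k N = n bin (n - 1) (k - 1), and the last binomial is at least `D` along the diagonal.
    nD≤kN : n * D ≤ k * N
    nD≤kN = begin
      n * D  ≡⟨ cong (_* D) j+x ⟨
      suc (i + x) * bin x t  ≤⟨ *-monoʳ-≤ (suc (i + x)) (bin-diagonal i x t) ⟩
      suc (i + x) * bin (i + x) (i + t)      ≡⟨ bin-absorb (i + x) (i + t) ⟨
      k * bin (suc (i + x)) k  ≡⟨ cong (λ z → k * bin z k) j+x ⟩
      k * bin n k  ≡⟨ cong (k *_) N≡ ⟨
      k * N  ∎

    -- Removing the boundedly many vertices of a component of size `s₀` loses a share of order 1 / n
    -- of `D`, less than 1 / (ν + 1). Hence small components lose nothing in the leading exponent,
    -- and `M₁` in units of N / D stays within 1 of `ν`, up to rounding.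
    νD≤[1+ν]d₀ : ν ℓ * D ≤ suc (ν ℓ) * d₀
    νD≤[1+ν]d₀ = +-cancelʳ-≤ D _ _ (begin
      ν ℓ * D + D  ≡⟨ +-comm (ν ℓ * D) D ⟩
      suc (ν ℓ) * D  ≤⟨ *-monoʳ-≤ (suc (ν ℓ)) D≤ ⟩
      suc (ν ℓ) * (d₀ + s₀ * b)  ≡⟨ lem (suc (ν ℓ)) d₀ s₀ b ⟩
      suc (ν ℓ) * d₀ + suc (ν ℓ) * s₀ * b      ≤⟨ +-monoʳ-≤ (suc (ν ℓ) * d₀) b≤ ⟩
      suc (ν ℓ) * d₀ + D  ∎)
      where
      b = bin x t′
      x₀ = n ∸ (i + s₀)
      r = s₀ ∸ 1
      lem : ∀ a b c d → a * (b + c * d) ≡ a * b + a * c * d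
      lem = solve-∀
      s₀>0 : 0 < s₀
      s₀>0 = *-mono-≤ {1} {7} (s≤s z≤n) q>0
      r+x₀ : r + x₀ ≡ x
      r+x₀ = +-cancelˡ-≡ j _ _ (trans (trans (sym (lem₂ i r x₀)) (cong (λ z → i + z + x₀) (m+[n∸m]≡n s₀>0))) (trans (m+[n∸m]≡n L₆₁) (sym j+x)))
        where
        lem₂ : ∀ i r x → i + suc r + x ≡ suc i + (r + x)
        lem₂ = solve-∀
      D≤ : D ≤ d₀ + s₀ * b
      D≤ = begin
        bin x t  ≡⟨ cong (λ z → bin z t) r+x₀ ⟨
        bin (r + x₀) (suc t′)  ≤⟨ bin-increment r x₀ t′ ⟩
        d₀ + r * bin (r + x₀) t′               ≡⟨ cong (λ z → d₀ + r * bin z t′) r+x₀ ⟩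
        d₀ + r * b  ≤⟨ +-monoʳ-≤ d₀ (*-monoˡ-≤ b (m∸n≤m s₀ 1)) ⟩
        d₀ + s₀ * b  ∎
      b≤ : suc (ν ℓ) * s₀ * b ≤ D
      b≤ = *-cancelˡ-≤ t (+-cancelʳ-≤ (t * b) _ _ (begin
        t * (suc (ν ℓ) * s₀ * b) + t * b       ≡⟨ lem₃ t (suc (ν ℓ) * s₀) b ⟩
        t * (1 + suc (ν ℓ) * s₀) * b           ≤⟨ *-monoˡ-≤ b (+-cancelˡ-≤ j _ _ (≤-trans L₅ (≤-trans 2^ℓ≤n (≤-trans (≤-reflexive (sym j+x)) (+-monoʳ-≤ j (n≤1+n x)))))) ⟩
        suc x * b  ≡⟨ bin-absorbʳ x t′ ⟨
        t * D + t * b  ∎))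
        where
        lem₃ : ∀ t s b → t * (s * b) + t * b ≡ t * (1 + s) * b
        lem₃ = solve-∀

    k≤ν : k ≤ ν ℓ
    k≤ν = m≤n+m k (μ ℓ)

    ν>0 : 0 < ν ℓ
    ν>0 = ≤-trans (s≤s z≤n) k≤ν

    d₀>0 : 0 < d₀
    d₀>0 with d₀ in eq
    ... | suc _ = s≤s z≤n
    ... | zero  = contradiction (≤-trans νD≤[1+ν]d₀ (≤-reflexive (trans (cong (suc (ν ℓ) *_) eq) (*-zeroʳ (suc (ν ℓ)))))) (<⇒≱ (*-mono-≤ ν>0 D>0))

    instance
      nonZero-d₀ : NonZero d₀
      nonZero-d₀ = >-nonZero d₀>0

    -- One unit of time. It is taken from `d₀` and rounded up, so that N ≤ R d holds for all
    -- component sizes up to `s₀`; rounding down would spoil the factor 1 / 2 per unit.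
    R  = suc (N / d₀)
    M₁ = R * ν ℓ
    M₂ = R * μ₊ ℓ

    N≤Rd₀ : N ≤ R * d₀
    N≤Rd₀ = begin
      N  ≡⟨ m≡m%n+[m/n]*n N d₀ ⟩
      N % d₀ + N / d₀ * d₀     ≤⟨ +-monoˡ-≤ (N / d₀ * d₀) (<⇒≤ (m%n<n N d₀)) ⟩
      d₀ + N / d₀ * d₀         ∎

    d₀≤D : d₀ ≤ D
    d₀≤D = bin-monoˡ t (∸-monoʳ-≤ n (≤-trans (≤-reflexive (+-comm 1 i)) (+-monoʳ-≤ i (*-mono-≤ {1} {7} (s≤s z≤n) q>0))))

    N≤RD : N ≤ R * D
    N≤RD = ≤-trans N≤Rd₀ (*-monoʳ-≤ R d₀≤D)

    n≤Rk : n ≤ R * k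
    n≤Rk = *-cancelʳ-≤ _ _ D (begin
      n * D          ≤⟨ nD≤kN ⟩
      k * N          ≤⟨ *-monoʳ-≤ k N≤RD ⟩
      k * (R * D)    ≡⟨ lem k R D ⟩
      R * k * D      ∎)
      where
      lem : ∀ a b c → a * (b * c) ≡ b * a * c
      lem = solve-∀

    Rμ+s≤M₁ : ∀ {s} → s ≤ n → R * μ ℓ + s ≤ M₁
    Rμ+s≤M₁ s≤n = ≤-trans (+-monoʳ-≤ (R * μ ℓ) (≤-trans s≤n n≤Rk)) (≤-reflexive (sym (*-distribˡ-+ R (μ ℓ) k)))

    M₁≤M₂ : M₁ ≤ M₂
    M₁≤M₂ = *-monoʳ-≤ R (+-monoˡ-≤ k (≤-trans (*-mono-≤ (*-monoˡ-≤ j (*-monoˡ-≤ q (m≤m+n 4 3))) (n≤1+n ℓ)) (m≤m+n _ ℓ)))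

    -- The sharp upper bound on `M₁ * D`, needed because it enters the exponent of 3: passing from
    -- `D` to `d₀` adds one N, rounding up `R` adds ν D. For `M₂`, which enters only through `α`,
    -- the crude factor 3 below suffices.
    νRD≤ : ν ℓ * (R * D) ≤ suc (ν ℓ) * N + ν ℓ * D
    νRD≤ = begin
      ν ℓ * (D + N / d₀ * D)  ≡⟨ lem (ν ℓ) D (N / d₀) ⟩
      N / d₀ * (ν ℓ * D) + ν ℓ * D             ≤⟨ +-monoˡ-≤ (ν ℓ * D) (*-monoʳ-≤ (N / d₀) νD≤[1+ν]d₀) ⟩
      N / d₀ * (suc (ν ℓ) * d₀) + ν ℓ * D      ≡⟨ cong (_+ ν ℓ * D) (lem₂ (N / d₀) (suc (ν ℓ)) d₀) ⟩
      suc (ν ℓ) * (N / d₀ * d₀) + ν ℓ * D      ≤⟨ +-monoˡ-≤ (ν ℓ * D) (*-monoʳ-≤ (suc (ν ℓ)) (m/n*n≤m N d₀)) ⟩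
      suc (ν ℓ) * N + ν ℓ * D  ∎
      where
      lem : ∀ v D a → v * (D + a * D) ≡ a * (v * D) + v * D
      lem = solve-∀
      lem₂ : ∀ a b c → a * (b * c) ≡ b * (a * c)
      lem₂ = solve-∀

    RD≤3N : R * D ≤ 3 * N
    RD≤3N = *-cancelˡ-≤ (ν ℓ) {{>-nonZero ν>0}} (begin
      ν ℓ * (R * D)  ≤⟨ νRD≤ ⟩
      suc (ν ℓ) * N + ν ℓ * D        ≤⟨ +-mono-≤ (*-monoˡ-≤ N (+-monoˡ-≤ (ν ℓ) ν>0)) (*-monoʳ-≤ (ν ℓ) D≤N) ⟩
      (ν ℓ + ν ℓ) * N + ν ℓ * N      ≡⟨ lem (ν ℓ) N ⟩
      ν ℓ * (3 * N)  ∎)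
      where
      lem : ∀ v N → (v + v) * N + v * N ≡ v * (3 * N)
      lem = solve-∀

    scaled : ∀ m → R * m * D ≤ 3 * m * N
    scaled m = begin
      R * m * D       ≡⟨ lem R m D ⟩
      m * (R * D)     ≤⟨ *-monoʳ-≤ m RD≤3N ⟩
      m * (3 * N)     ≡⟨ lem₂ m N ⟩
      3 * m * N       ∎
      where
      lem : ∀ R m D → R * m * D ≡ m * (R * D)
      lem = solve-∀
      lem₂ : ∀ m N → m * (3 * N) ≡ 3 * m * N
      lem₂ = solve-∀

    M₂D≤αN : M₂ * D ≤ α ℓ * N
    M₂D≤αN = scaled (μ₊ ℓ)

    M₂≤N : M₂ ≤ N
    M₂≤N = *-cancelʳ-≤ _ _ D (≤-trans M₂D≤αN (≤-trans (*-monoˡ-≤ N α≤D) (≤-reflexive (*-comm D N))))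

    M₁≤N : M₁ ≤ N
    M₁≤N = ≤-trans M₁≤M₂ M₂≤N

    d≤N : ∀ {s} → 0 < s → bin (n ∸ (i + s)) t ≤ N
    d≤N s>0 = ≤-trans (bin-monoˡ t (∸-monoʳ-≤ n (≤-trans (≤-reflexive (+-comm 1 i)) (+-monoʳ-≤ i s>0)))) D≤N

    N≤Rd-small : ∀ {s} → s ≤ s₀ → N ≤ R * bin (n ∸ (i + s)) t
    N≤Rd-small s≤ = ≤-trans N≤Rd₀ (*-monoʳ-≤ R (bin-monoˡ t (∸-monoʳ-≤ n (+-monoʳ-≤ i s≤))))

    -- At least half of the vertices outside `S` remain outside the component, so `bin-triple`
    -- applies.
    N≤Rd-large : ∀ {s} → 2 * s ≤ n ∸ i → N ≤ R * q * bin (n ∸ (i + s)) t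
    N≤Rd-large {s} 2s≤ = begin
      N  ≤⟨ N≤RD ⟩
      R * D  ≤⟨ *-monoʳ-≤ R (bin-triple t x z (+-cancelˡ-≤ 1 _ _ x+2t≤)) ⟩
      R * (q * bin z t)  ≡⟨ *-assoc R q _ ⟨
      R * q * bin z t  ∎
      where
      z = n ∸ (i + s)
      m = n ∸ i
      i≤n : i ≤ n
      i≤n = ≤-trans (n≤1+n i) j≤n
      s≤m : s ≤ m
      s≤m = ≤-trans (m≤m+n s _) 2s≤
      s+z : s + z ≡ m
      s+z = trans (cong (s +_) (sym (∸-+-assoc n i s))) (m+[n∸m]≡n s≤m)
      1+x : 1 + x ≡ m
      1+x = +-cancelˡ-≡ i _ _ (trans (+-suc i x) (trans j+x (sym (m+[n∸m]≡n i≤n))))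
      m≤2z : m ≤ 2 * z
      m≤2z = +-cancelˡ-≤ (2 * s) _ _ (begin
        2 * s + m         ≤⟨ +-monoˡ-≤ m 2s≤ ⟩
        m + m             ≡⟨ cong₂ _+_ s+z s+z ⟨
        s + z + (s + z)   ≡⟨ lem s z ⟩
        2 * s + 2 * z     ∎)
        where
        lem : ∀ s z → s + z + (s + z) ≡ 2 * s + 2 * z
        lem = solve-∀
      4t≤m : 4 * t ≤ m
      4t≤m = +-cancelˡ-≤ i _ _ (≤-trans (+-monoˡ-≤ (4 * t) (≤-trans (m≤m+n i s₀) (m≤m+n (i + s₀) (2 * j)))) (≤-trans L₆ (≤-trans 2^ℓ≤n (≤-reflexive (sym (m+[n∸m]≡n i≤n))))))
      2t≤z : 2 * t ≤ z
      2t≤z = *-cancelˡ-≤ 2 (≤-trans (≤-reflexive (lem t)) (≤-trans 4t≤m m≤2z))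
        where
        lem : ∀ t → 2 * (2 * t) ≡ 4 * t
        lem = solve-∀
      x+2t≤ : 1 + (x + 2 * t) ≤ 1 + 3 * z
      x+2t≤ = begin
        1 + x + 2 * t     ≡⟨ cong (_+ 2 * t) 1+x ⟩
        m + 2 * t         ≤⟨ +-mono-≤ m≤2z 2t≤z ⟩
        2 * z + z         ≡⟨ lem z ⟩
        3 * z             ≤⟨ n≤1+n (3 * z) ⟩
        1 + 3 * z         ∎
        where
        lem : ∀ z → 2 * z + z ≡ 3 * z
        lem = solve-∀

    n^j≤ : n ^ j ≤ 2 ^ (7 * q * j * suc ℓ)
    n^j≤ = begin
      n ^ j  ≤⟨ ^-monoˡ-≤ j n≤2^ ⟩
      (2 ^ (7 * q * suc ℓ)) ^ j       ≡⟨ ^-*-assoc 2 (7 * q * suc ℓ) j ⟩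
      2 ^ (7 * q * suc ℓ * j)         ≡⟨ cong (2 ^_) (lem q (suc ℓ) j) ⟩
      2 ^ (7 * q * j * suc ℓ)         ∎
      where
      lem : ∀ q l j → 7 * q * l * j ≡ 7 * q * j * l
      lem = solve-∀

    2e>0 : 0 < 2 * e
    2e>0 = *-mono-≤ {1} {2} (s≤s z≤n) e>0

    K>0 : 0 < K ℓ
    K>0 = s≤s z≤n

    e≤2^ℓ : e ≤ 2 ^ ℓ
    e≤2^ℓ = begin
      e  ≤⟨ m≤m+n e _ ⟩
      2 * e  ≤⟨ ≤-trans (≤-reflexive (sym (*-identityˡ (2 * e)))) (*-monoˡ-≤ (2 * e) (m^n>0 2 j)) ⟩
      2 ^ j * (2 * e)  ≤⟨ ≤-trans (≤-reflexive (sym (*-identityʳ _))) (*-monoʳ-≤ (2 ^ j * (2 * e)) (*-mono-≤ {1} {2} (s≤s z≤n) K>0)) ⟩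
      2 ^ j * (2 * e) * (2 * K ℓ)        ≤⟨ L₉ ⟩
      2 ^ ℓ  ∎

    -- n ^ j bounds the number of pairs (S , v), K ^ s the weight of the runs; e * 2 ^ suc s makes the sum over s small.
    weight-small : ∀ s → 2 ≤ s → n ^ j * e * 2 ^ suc s * K ℓ ^ s ≤ 2 ^ (s * μ ℓ)
    weight-small (suc zero) (s≤s ())
    weight-small (suc (suc s)) _ = begin
      n ^ j * e * (2 * 2 ^ (2 + s)) * K ℓ ^ (2 + s)            ≤⟨ *-monoˡ-≤ _ (*-monoˡ-≤ _ (*-monoˡ-≤ e n^j≤′)) ⟩
      a * b * e * (2 * 2 ^ (2 + s)) * K ℓ ^ (2 + s)            ≡⟨ cong (λ z → a * b * e * (2 * (2 * (2 * 2 ^ s))) * (K ℓ * (K ℓ * z))) refl ⟩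
      a * b * e * (2 * (2 * (2 * 2 ^ s))) * (K ℓ * (K ℓ * K ℓ ^ s)) ≡⟨ lem a b e (2 ^ s) (K ℓ) (K ℓ ^ s) ⟩
      b * (a * (2 * e) * (2 * K ℓ * (2 * K ℓ))) * (2 ^ s * K ℓ ^ s) ≡⟨ cong (b * (a * (2 * e) * (2 * K ℓ * (2 * K ℓ))) *_) (^-distribʳ-* s 2 (K ℓ)) ⟨
      b * (a * (2 * e) * (2 * K ℓ * (2 * K ℓ))) * (2 * K ℓ) ^ s ≤⟨ *-mono-≤ (*-monoʳ-≤ b (≤-trans L₈ (mono₂ ℓ≤qjℓ))) (^-monoˡ-≤ s (≤-trans 2K≤ (mono₂ ℓ≤μ))) ⟩
      b * 2 ^ (q * j * ℓ) * (2 ^ μ ℓ) ^ s  ≡⟨ cong₂ _*_ (sym (^-distribˡ-+-* 2 (7 * q * j * ℓ) (q * j * ℓ))) (trans (^-*-assoc 2 (μ ℓ) s) (cong (2 ^_) (*-comm (μ ℓ) s))) ⟩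
      -- 7 + 1 = 2 * 4: the first two vertices pay for n ^ j and leave q j ℓ in the exponent for
      -- constants and powers of log n.
      2 ^ (7 * q * j * ℓ + q * j * ℓ) * 2 ^ (s * μ ℓ)          ≡⟨ cong (λ z → 2 ^ z * 2 ^ (s * μ ℓ)) (lem₂ q j ℓ) ⟩
      2 ^ (μ ℓ + μ ℓ) * 2 ^ (s * μ ℓ)  ≡⟨ ^-distribˡ-+-* 2 (μ ℓ + μ ℓ) (s * μ ℓ) ⟨
      2 ^ (μ ℓ + μ ℓ + s * μ ℓ)  ≡⟨ cong (2 ^_) (+-assoc (μ ℓ) (μ ℓ) (s * μ ℓ)) ⟩
      2 ^ ((2 + s) * μ ℓ)  ∎
      where
      a = 2 ^ (7 * q * j)
      b = 2 ^ (7 * q * j * ℓ)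
      n^j≤′ : n ^ j ≤ a * b
      n^j≤′ = ≤-trans n^j≤ (≤-reflexive (trans (cong (2 ^_) (*-suc (7 * q * j) ℓ)) (^-distribˡ-+-* 2 (7 * q * j) _)))
      lem : ∀ a b e p k r → a * b * e * (2 * (2 * (2 * p))) * (k * (k * r)) ≡ b * (a * (2 * e) * (2 * k * (2 * k))) * (p * r)
      lem = solve-∀
      lem₂ : ∀ q j l → 7 * q * j * l + q * j * l ≡ 4 * q * j * l + 4 * q * j * l
      lem₂ = solve-∀
      ℓ≤qjℓ : ℓ ≤ q * j * ℓ
      ℓ≤qjℓ = ≤-trans (≤-reflexive (sym (*-identityˡ ℓ))) (*-monoˡ-≤ ℓ (*-mono-≤ q>0 (s≤s (z≤n {i}))))
      ℓ≤μ : ℓ ≤ μ ℓ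
      ℓ≤μ = ≤-trans ℓ≤qjℓ (*-monoˡ-≤ ℓ (*-monoˡ-≤ j (m≤m+n q _)))
      2K≤ : 2 * K ℓ ≤ 2 ^ ℓ
      2K≤ = begin
        2 * K ℓ  ≤⟨ m≤m*n (2 * K ℓ) (2 * K ℓ) {{>-nonZero (*-mono-≤ {1} {2} (s≤s z≤n) K>0)}} ⟩
        2 * K ℓ * (2 * K ℓ)  ≤⟨ m≤n*m (2 * K ℓ * (2 * K ℓ)) (a * (2 * e)) {{>-nonZero (*-mono-≤ (m^n>0 2 (7 * q * j)) 2e>0)}} ⟩
        a * (2 * e) * (2 * K ℓ * (2 * K ℓ))          ≤⟨ L₈ ⟩
        2 ^ ℓ  ∎

    -- Of the exponent 4 j ℓ per vertex, j ℓ pays for a share of n ^ j, since s ≥ 7 q, and 3 j ℓ for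
    -- the other factors.
    weight-large : ∀ s → s₀ ≤ s → n ^ j * e * 2 ^ suc s * K ℓ ^ s ≤ 2 ^ (s * (4 * j * ℓ))
    weight-large s s₀≤s = begin
      n ^ j * e * (2 * 2 ^ s) * K ℓ ^ s  ≤⟨ *-monoˡ-≤ _ (*-monoˡ-≤ _ (*-monoˡ-≤ e n^j≤′)) ⟩
      X ^ s * e * (2 * 2 ^ s) * K ℓ ^ s  ≡⟨ lem (X ^ s) e (2 ^ s) (K ℓ ^ s) ⟩
      X ^ s * (2 * e) * (2 ^ s * K ℓ ^ s)              ≤⟨ *-mono-≤ (*-monoʳ-≤ (X ^ s) 2e≤) (≤-reflexive (sym (^-distribʳ-* s 2 (K ℓ)))) ⟩
      X ^ s * (2 * e) ^ s * (2 * K ℓ) ^ s              ≡⟨ trans (cong (_* (2 * K ℓ) ^ s) (sym (^-distribʳ-* s X (2 * e)))) (sym (^-distribʳ-* s (X * (2 * e)) (2 * K ℓ))) ⟩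
      (X * (2 * e) * (2 * K ℓ)) ^ s  ≡⟨ cong (_^ s) (trans (cong (λ z → z * (2 * e) * (2 * K ℓ)) X≡) (lem₂ (2 ^ (j * ℓ)) (2 ^ j) (2 * e) (2 * K ℓ))) ⟩
      (2 ^ (j * ℓ) * (2 ^ j * (2 * e) * (2 * K ℓ))) ^ s ≤⟨ ^-monoˡ-≤ s (*-monoʳ-≤ (2 ^ (j * ℓ)) (≤-trans L₉ (mono₂ ℓ≤3jℓ))) ⟩
      (2 ^ (j * ℓ) * 2 ^ (3 * j * ℓ)) ^ s              ≡⟨ cong (_^ s) (trans (sym (^-distribˡ-+-* 2 (j * ℓ) (3 * j * ℓ))) (cong (2 ^_) (lem₃ j ℓ))) ⟩
      (2 ^ (4 * j * ℓ)) ^ s  ≡⟨ trans (^-*-assoc 2 (4 * j * ℓ) s) (cong (2 ^_) (*-comm (4 * j * ℓ) s)) ⟩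
      2 ^ (s * (4 * j * ℓ))  ∎
      where
      X = 2 ^ (j * suc ℓ)
      X≡ : X ≡ 2 ^ j * 2 ^ (j * ℓ)
      X≡ = trans (cong (2 ^_) (*-suc j ℓ)) (^-distribˡ-+-* 2 j (j * ℓ))
      n^j≤′ : n ^ j ≤ X ^ s
      n^j≤′ = begin
        n ^ j  ≤⟨ n^j≤ ⟩
        2 ^ (7 * q * j * suc ℓ)        ≤⟨ mono₂ (≤-trans (*-monoˡ-≤ (suc ℓ) (*-monoˡ-≤ j s₀≤s)) (≤-reflexive (lem₀ s j (suc ℓ)))) ⟩
        2 ^ (j * suc ℓ * s)            ≡⟨ ^-*-assoc 2 (j * suc ℓ) s ⟨
        X ^ s  ∎
        where
        lem₀ : ∀ s j l → s * j * l ≡ j * l * s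
        lem₀ = solve-∀
      lem : ∀ x e p r → x * e * (2 * p) * r ≡ x * (2 * e) * (p * r)
      lem = solve-∀
      lem₂ : ∀ a b c d → b * a * c * d ≡ a * (b * c * d)
      lem₂ = solve-∀
      lem₃ : ∀ j l → j * l + 3 * j * l ≡ 4 * j * l
      lem₃ = solve-∀
      ℓ≤3jℓ : ℓ ≤ 3 * j * ℓ
      ℓ≤3jℓ = ≤-trans (≤-reflexive (sym (*-identityˡ ℓ))) (*-monoˡ-≤ ℓ {1} {3 * j} (s≤s z≤n))
      2e≤ : 2 * e ≤ (2 * e) ^ s
      2e≤ = x≤x^s s (≤-trans (*-mono-≤ {1} {7} (s≤s z≤n) q>0) s₀≤s)
        where
        x≤x^s : ∀ s → 0 < s → 2 * e ≤ (2 * e) ^ s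
        x≤x^s (suc s) _ = m≤m*n (2 * e) ((2 * e) ^ s) {{m^n≢0 (2 * e) s {{>-nonZero 2e>0}}}}

    -- The total of the rounding errors in `M₁≤[ν+2]6y`. They fit into a single N because D / N is
    -- of order at most 1 / n, and M₁ / N is at most 3 ν / D.
    budget : (ν ℓ + 2) * (6 * D + M₁) + ν ℓ * D ≤ N
    budget = *-cancelˡ-≤ 2 (begin
      2 * ((ν ℓ + 2) * (6 * D + M₁) + ν ℓ * D)            ≡⟨ lem (ν ℓ) D M₁ ⟩
      2 * (7 * ν ℓ + 12) * D + 2 * (ν ℓ + 2) * M₁         ≤⟨ +-mono-≤ firstHalf secondHalf ⟩
      N + N  ≡⟨ cong (N +_) (+-identityʳ N) ⟨
      2 * N  ∎)
      where
      lem : ∀ v D M → 2 * ((v + 2) * (6 * D + M) + v * D) ≡ 2 * (7 * v + 12) * D + 2 * (v + 2) * M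
      lem = solve-∀
      firstHalf : 2 * (7 * ν ℓ + 12) * D ≤ N
      firstHalf = *-cancelˡ-≤ k (begin
        k * (2 * (7 * ν ℓ + 12) * D)       ≡⟨ lem₁ k (7 * ν ℓ + 12) D ⟩
        2 * k * (7 * ν ℓ + 12) * D         ≤⟨ *-monoˡ-≤ D (≤-trans L₃ 2^ℓ≤n) ⟩
        n * D  ≤⟨ nD≤kN ⟩
        k * N  ∎)
        where
        lem₁ : ∀ k a D → k * (2 * a * D) ≡ 2 * k * a * D
        lem₁ = solve-∀
      secondHalf : 2 * (ν ℓ + 2) * M₁ ≤ N
      secondHalf = *-cancelʳ-≤ _ _ D (begin
        2 * (ν ℓ + 2) * M₁ * D             ≡⟨ *-assoc (2 * (ν ℓ + 2)) M₁ D ⟩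
        2 * (ν ℓ + 2) * (M₁ * D)           ≤⟨ *-monoʳ-≤ (2 * (ν ℓ + 2)) (scaled (ν ℓ)) ⟩
        2 * (ν ℓ + 2) * (3 * ν ℓ * N)      ≡⟨ lem₂ (ν ℓ) N ⟩
        6 * ν ℓ * (ν ℓ + 2) * N            ≤⟨ *-monoˡ-≤ N (D-≥ _ (≤-trans L₂ 2^ℓ≤n)) ⟩
        D * N  ≡⟨ *-comm D N ⟩
        N * D  ∎)
        where
        lem₂ : ∀ v N → 2 * (v + 2) * (3 * v * N) ≡ 6 * v * (v + 2) * N
        lem₂ = solve-∀

    2D+2M₁≤N : N + 2 * M₁ ≤ 2 * (N ∸ D)
    2D+2M₁≤N = +-cancelʳ-≤ (2 * D) _ _ (begin
      N + 2 * M₁ + 2 * D  ≡⟨ lem N M₁ D ⟩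
      N + 2 * (D + M₁)  ≤⟨ +-monoʳ-≤ N (≤-trans (*-mono-≤ (m≤n+m 2 (ν ℓ)) (+-monoˡ-≤ M₁ (m≤m+n D _))) (≤-trans (m≤m+n _ (ν ℓ * D)) budget)) ⟩
      N + N  ≡⟨ cong₂ _+_ (m∸n+n≡m D≤N) (m∸n+n≡m D≤N) ⟨
      N ∸ D + D + (N ∸ D + D)  ≡⟨ lem₂ (N ∸ D) D ⟩
      2 * (N ∸ D) + 2 * D  ∎)
      where
      lem : ∀ N M D → N + 2 * M + 2 * D ≡ N + 2 * (D + M)
      lem = solve-∀
      lem₂ : ∀ a D → a + D + (a + D) ≡ 2 * a + 2 * D
      lem₂ = solve-∀

    -- Counting pairs of a k-set containing a given j-set and a further vertex in it gives (n - j) δ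
    -- = t D. So `M₁ * δ` is of order ν N / n.
    correlation : suc e * (M₁ * (4 * δ)) ≤ N
    correlation = *-cancelʳ-≤ _ _ x {{>-nonZero x>0}} (begin
      suc e * (M₁ * (4 * δ)) * x           ≡⟨ lem (suc e) M₁ δ x ⟩
      4 * suc e * M₁ * (x * δ)             ≡⟨ cong (4 * suc e * M₁ *_) xδ ⟩
      4 * suc e * M₁ * (t * D)             ≡⟨ lem₂ (suc e) M₁ t D ⟩
      4 * suc e * t * (M₁ * D)             ≤⟨ *-monoʳ-≤ (4 * suc e * t) (scaled (ν ℓ)) ⟩
      4 * suc e * t * (3 * ν ℓ * N)        ≡⟨ lem₃ (suc e) t (ν ℓ) N ⟩
      12 * suc e * t * ν ℓ * N             ≤⟨ *-monoˡ-≤ N X≤x ⟩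
      x * N  ≡⟨ *-comm x N ⟩
      N * x  ∎)
      where
      X≤x : 12 * suc e * t * ν ℓ ≤ x
      X≤x = +-cancelˡ-≤ j _ _ (≤-trans L₄ (≤-trans 2^ℓ≤n (≤-reflexive (sym j+x))))
      x>0 : 0 < x
      x>0 = ≤-trans (*-mono-≤ {1} {12 * suc e * t} (s≤s z≤n) ν>0) X≤x
      xδ : x * δ ≡ t * D
      xδ = trans (cong₂ (λ y z → y * bin z t′) (sym 1+x′) (trans (cong (n ∸_) (+-comm 1 j)) (sym (∸-+-assoc n j 1))))
             (trans (sym (bin-absorb (x ∸ 1) t′)) (cong (λ z → t * bin z t) 1+x′))
        where
        1+x′ : suc (x ∸ 1) ≡ x
        1+x′ = m+[n∸m]≡n x>0
      lem : ∀ e M d x → e * (M * (4 * d)) * x ≡ 4 * e * M * (x * d)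
      lem = solve-∀
      lem₂ : ∀ e M t D → 4 * e * M * (t * D) ≡ 4 * e * t * (M * D)
      lem₂ = solve-∀
      lem₃ : ∀ e t v N → 4 * e * t * (3 * v * N) ≡ 12 * e * t * v * N
      lem₃ = solve-∀

    -- 6 y is about (N - M₁) / D: after `M₁` draws a given j-set is still hit with probability of at
    -- most about 1 / (6 y). The multiple of 6 is what the bound 1 / 3 was proved for.
    y : ℕ
    y = ((N ∸ M₁) / (6 * D)) {{m*n≢0 6 D}}

    6yD+M₁≤N : 6 * y * D + M₁ ≤ N
    6yD+M₁≤N = begin
      6 * y * D + M₁         ≡⟨ cong (_+ M₁) (lem y D) ⟩
      y * (6 * D) + M₁       ≤⟨ +-monoˡ-≤ M₁ (m/n*n≤m (N ∸ M₁) (6 * D) {{m*n≢0 6 D}}) ⟩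
      N ∸ M₁ + M₁            ≡⟨ m∸n+n≡m M₁≤N ⟩
      N  ∎
      where
      lem : ∀ y D → 6 * y * D ≡ y * (6 * D)
      lem = solve-∀

    -- `M₁ * D` is at most (ν + 1) N + ν D. Going up to ν + 2 frees one N, which absorbs the
    -- rounding of `y` and the `M₁` sets already drawn.
    M₁≤[ν+2]6y : M₁ ≤ (ν ℓ + 2) * (6 * y)
    M₁≤[ν+2]6y = *-cancelʳ-≤ _ _ D (+-cancelʳ-≤ N _ _ (begin
      R * ν ℓ * D + N  ≡⟨ cong (_+ N) (lem R (ν ℓ) D) ⟩
      ν ℓ * (R * D) + N  ≤⟨ +-monoˡ-≤ N νRD≤ ⟩
      suc (ν ℓ) * N + ν ℓ * D + N  ≡⟨ lem₂ (ν ℓ) N D ⟩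
      (ν ℓ + 2) * N + ν ℓ * D  ≤⟨ +-monoˡ-≤ (ν ℓ * D) (*-monoʳ-≤ (ν ℓ + 2) N≤) ⟩
      (ν ℓ + 2) * (y * (6 * D) + (6 * D + M₁)) + ν ℓ * D   ≡⟨ lem₃ (ν ℓ + 2) y D (6 * D + M₁) (ν ℓ) ⟩
      (ν ℓ + 2) * (6 * y) * D + ((ν ℓ + 2) * (6 * D + M₁) + ν ℓ * D) ≤⟨ +-monoʳ-≤ ((ν ℓ + 2) * (6 * y) * D) budget ⟩
      (ν ℓ + 2) * (6 * y) * D + N  ∎))
      where
      lem : ∀ R v D → R * v * D ≡ v * (R * D)
      lem = solve-∀
      lem₂ : ∀ v N D → suc v * N + v * D + N ≡ (v + 2) * N + v * D
      lem₂ = solve-∀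
      lem₃ : ∀ w y D z v → w * (y * (6 * D) + z) + v * D ≡ w * (6 * y) * D + (w * z + v * D)
      lem₃ = solve-∀
      N≤ : N ≤ y * (6 * D) + (6 * D + M₁)
      N≤ = begin
        N  ≡⟨ m∸n+n≡m M₁≤N ⟨
        N ∸ M₁ + M₁  ≡⟨ cong (_+ M₁) (m≡m%n+[m/n]*n (N ∸ M₁) (6 * D) {{m*n≢0 6 D}}) ⟩
        r + y * (6 * D) + M₁             ≤⟨ +-monoˡ-≤ M₁ (+-monoˡ-≤ (y * (6 * D)) (<⇒≤ (m%n<n (N ∸ M₁) (6 * D) {{m*n≢0 6 D}}))) ⟩
        6 * D + y * (6 * D) + M₁         ≡⟨ lem₄ (6 * D) y M₁ ⟩
        y * (6 * D) + (6 * D + M₁)       ∎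
        where
        r = ((N ∸ M₁) % (6 * D)) {{m*n≢0 6 D}}
        lem₄ : ∀ a y M → a + y * a + M ≡ y * a + (a + M)
        lem₄ = solve-∀

    y>0 : 0 < y
    y>0 with y in eq
    ... | suc _ = s≤s z≤n
    ... | zero  = contradiction (≤-trans M₁≤[ν+2]6y (≤-reflexive (trans (cong (λ z → (ν ℓ + 2) * (6 * z)) eq) (*-zeroʳ (ν ℓ + 2)))))
                    (<⇒≱ (*-mono-≤ {1} {R} (s≤s z≤n) ν>0))

    -- With m = q j ℓ, the left side is a constant times 81 ^ m, and n ^ j is at least 128 ^ m.
    many-sets : e * 3 ^ (ν ℓ + 2) ≤ length (kSets n j)
    many-sets = *-cancelˡ-≤ ((2 * j) ^ j) {{m^n≢0 (2 * j) j}} (begin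
      (2 * j) ^ j * (e * 3 ^ (ν ℓ + 2))            ≡⟨ cong (λ z → (2 * j) ^ j * (e * z)) (trans (cong (3 ^_) (+-assoc (μ ℓ) k 2)) (^-distribˡ-+-* 3 (μ ℓ) (k + 2))) ⟩
      (2 * j) ^ j * (e * (3 ^ μ ℓ * 3 ^ (k + 2)))  ≡⟨ lem ((2 * j) ^ j) e (3 ^ μ ℓ) (3 ^ (k + 2)) ⟩
      C * 3 ^ μ ℓ  ≡⟨ cong (C *_) (trans (cong (3 ^_) (lem₂ q j ℓ)) (sym (^-*-assoc 3 4 m))) ⟩
      C * 81 ^ m  ≤⟨ C*81^m≤128^m C m (≤-trans L₇ ℓ≤m) ⟩
      128 ^ m  ≡⟨ trans (^-*-assoc 2 7 m) (trans (cong (2 ^_) (lem₃ q j ℓ)) (sym (^-*-assoc 2 (7 * q * ℓ) j))) ⟩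
      (2 ^ (7 * q * ℓ)) ^ j  ≤⟨ ^-monoˡ-≤ j 2^≤n ⟩
      n ^ j  ≤⟨ n^j≤[2j]^j*bin j (≤-trans (≤-trans (m≤n+m (2 * j) (i + s₀)) (m≤m+n _ (4 * t))) (≤-trans L₆ 2^ℓ≤n)) ⟩
      (2 * j) ^ j * bin n j  ≡⟨ cong ((2 * j) ^ j *_) (length-kSets n j) ⟨
      (2 * j) ^ j * length (kSets n j)             ∎)
      where
      m = q * j * ℓ
      lem : ∀ a e x y → a * (e * (x * y)) ≡ e * y * a * x
      lem = solve-∀
      lem₂ : ∀ q j l → 4 * q * j * l ≡ 4 * (q * j * l)
      lem₂ = solve-∀
      lem₃ : ∀ q j l → 7 * (q * j * l) ≡ 7 * q * l * j
      lem₃ = solve-∀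
      ℓ≤m : ℓ ≤ m
      ℓ≤m = ≤-trans (≤-reflexive (sym (*-identityˡ ℓ))) (*-monoˡ-≤ ℓ (*-mono-≤ q>0 (s≤s (z≤n {i}))))

-- Good orderings

any-∈ : (P : A → Bool) → ∀ xs {x} → x ∈ xs → P x ≡ true → any P xs ≡ true
any-∈ P (x ∷ xs) (here refl) h rewrite h = refl
any-∈ P (x ∷ xs) (there x∈) h with P x
... | true  = refl
... | false = any-∈ P xs x∈ h

#≢0 : (P : A → Bool) → ∀ xs → (# P xs ≡ᵇ 0) ≡ false → ∃[ x ] (x ∈ xs × P x ≡ true)
#≢0 P (x ∷ xs) h with P x in Px
... | true  = x , here refl , Px
... | false with y , y∈ , Py ← #≢0 P xs h = y , there y∈ , Py

all-not⁺ : (P : A → Bool) → ∀ {xs} → All (λ x → P x ≡ false) xs → all (not ∘ P) xs ≡ true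
all-not⁺ P []        = refl
all-not⁺ P (px ∷ ps) rewrite px = all-not⁺ P ps

all-not⁻ : (P : A → Bool) → ∀ xs → all (not ∘ P) xs ≡ true → ∀ {x} → x ∈ xs → P x ≡ false
all-not⁻ P (x ∷ xs) h x∈ with P x in Px
all-not⁻ P (x ∷ xs) h (here refl) | false = Px
all-not⁻ P (x ∷ xs) h (there x∈)  | false = all-not⁻ P xs h x∈

∈-take-mono : ∀ {M M′} → M ≤ M′ → ∀ (σ : List A) {x} → x ∈ take M σ → x ∈ take M′ σ
∈-take-mono (s≤s h) (y ∷ σ) (here px)  = here px
∈-take-mono (s≤s h) (y ∷ σ) (there x∈) = there (∈-take-mono h σ x∈)

∈-take : ∀ M (σ : List A) {x} → x ∈ take M σ → x ∈ σ
∈-take M σ {x} x∈ = subst (x ∈_) (take++drop≡id M σ) (∈-++⁺ˡ x∈)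

∈-take⇒∉-drop : ∀ M {σ : List A} → Unique σ → ∀ {x} → x ∈ take M σ → x ∉ drop M σ
∈-take⇒∉-drop (suc M) {y ∷ σ} (y∉ ∷ uq) (here refl) x∈ =
  All.lookup y∉ (subst (_ ∈_) (take++drop≡id M σ) (∈-++⁺ʳ (take M σ) x∈)) refl
∈-take⇒∉-drop (suc M) {y ∷ σ} (y∉ ∷ uq) (there x∈t) x∈ = ∈-take⇒∉-drop M uq x∈t x∈

isolated⇒avoids : ∀ {M} {σ : List (Subset n)} {J} → Isolated (take M σ) J → avoids M (⊇ᵇ J) σ ≡ true
isolated⇒avoids {J = J} iso = all-not⁺ (⊇ᵇ J) (All.tabulate (λ {e} e∈ → dec-false (J ⊆? e) (iso e e∈)))

avoids⇒isolated : ∀ {M} {σ : List (Subset n)} {J} → avoids M (⊇ᵇ J) σ ≡ true → Isolated (take M σ) J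
avoids⇒isolated {M = M} {σ} {J} h e e∈ J⊆e with () ← trans (sym (dec-true (J ⊆? e) J⊆e)) (all-not⁻ (⊇ᵇ J) (take M σ) h e∈)

module Events (i t M₁ M₂ : ℕ) where

  private
    j = suc i
    k = j + t

  inRange : ℕ → ℕ → Bool
  inRange n s = does (2 ≤? s) ∧ does (2 * s ≤? n ∸ i)

  someIsolated : List (Subset n) → Bool
  someIsolated {n} σ = any (λ J → avoids M₂ (⊇ᵇ J) σ) (kSets n j)

  someSmallAt : Subset n → Fin n → List (Subset n) → Bool
  someSmallAt {n} S v σ = not (does (v ∈? S)) ∧ any (λ s → inRange n s ∧ small k M₁ M₂ S v s σ) (downFrom (suc n))

  someSmall : List (Subset n) → Bool
  someSmall {n} σ = any (λ S → any (λ v → someSmallAt S v σ) (allFin n)) (kSets n i)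

  module _ (1≤t : 1 ≤ t) {σ : List (Subset n)} (σ↭ : σ ↭ kSets n k) where

    private
      σ-unique : Unique σ
      σ-unique = Permₛ.Unique-resp-↭ (setoid (Subset n)) (↭⇒↭ₛ (↭-sym σ↭)) (Unique-kSets n k)

    -- The isolation hypotheses give M₁ ≤ Mi ≤ M₂. If the criterion `connected` failed at `Mi`, its
    -- witness would move to the fixed times: absence of the boundary back to `M₁`, presence of the
    -- edges on to `M₂`. The converse inequality is that a j-connected hypergraph has no isolated
    -- j-set.
    τ-equal : someIsolated σ ≡ false → someSmall σ ≡ false →
      ∃[ J ] (∣ J ∣ ≡ j × Isolated (take M₁ σ) J) → TauEq j σ
    τ-equal noIsolated₂ noSmall (J , ∣J∣ , isolated₁) Mc Mi (connMc , minMc) (noIsoMi , minMi) =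
      ≤-antisym (≮⇒≥ (λ Mi<Mc → minMc Mi Mi<Mc conn)) (≮⇒≥ (λ Mc<Mi → minMi Mc Mc<Mi (JConnected⇒NoIsolatedJSet connMc)))
      where
      H = take Mi σ
      M₁≤Mi : M₁ ≤ Mi
      M₁≤Mi = ≮⇒≥ (λ Mi<M₁ → noIsoMi J ∣J∣ (λ e e∈ → isolated₁ e (∈-take-mono (<⇒≤ Mi<M₁) σ e∈)))
      noIso₂ : NoIsolatedJSet (take M₂ σ) j
      noIso₂ J′ ∣J′∣ iso with () ← trans (sym noIsolated₂) (any-∈ _ (kSets n j) {J′} (∈-kSets⁺ ∣J′∣) (isolated⇒avoids {σ = σ} {J = J′} iso))
      Mi≤M₂ : Mi ≤ M₂
      Mi≤M₂ = ≮⇒≥ (λ M₂<Mi → minMi M₂ M₂<Mi noIso₂)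
      conn : JConnected H j
      conn = connected (s≤s (≤-trans (≤-reflexive (+-comm 1 i)) (+-monoʳ-≤ i 1≤t)))
        (λ e∈ → ∈-kSets⁻ (∈-resp-↭ σ↭ (∈-take Mi σ e∈))) noIsoMi noWitness
        where
        noWitness : ∀ S v s Xf Tf → ∣ S ∣ ≡ i → v ∉ˢ S → 2 ≤ s → 2 * s ≤ n ∸ i →
          (Xf , Tf) ∈ runs k S (2 * s) (S ∪ ⁅ v ⁆) (v ∷ []) [] → ∣ Xf ∣ ≡ i + s →
          All (_∈ H) Tf → ¬ All (λ e → boundary S Xf e ≡ false) H
        noWitness S v s Xf Tf ∣S∣ v∉S 2≤s 2s≤ run ∣Xf∣ Tf⊆H noBoundary = false≢true (trans (sym noSmall) yesSmall)
          where
          false≢true : false ≢ true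
          false≢true ()
          ∧-true : ∀ {a b} → a ≡ true → b ≡ true → a ∧ b ≡ true
          ∧-true refl refl = refl
          ≡ᵇ-true : ∀ {a b} → a ≡ b → (a ≡ᵇ b) ≡ true
          ≡ᵇ-true {zero}  refl = refl
          ≡ᵇ-true {suc a} refl = ≡ᵇ-true {a} refl
          yesAvoids : avoids M₁ (boundary S Xf) σ ≡ true
          yesAvoids = all-not⁺ (boundary S Xf) (All.tabulate (λ e∈ → All.lookup noBoundary (∈-take-mono M₁≤Mi σ e∈)))
          yesContains : contains M₂ (member _≟ˢ_ Tf) σ ≡ true
          yesContains = all-not⁺ (member _≟ˢ_ Tf) (All.tabulate (λ e∈ → member-∉ _≟ˢ_ Tf
            (λ e∈T → ∈-take⇒∉-drop M₂ σ-unique (∈-take-mono Mi≤M₂ σ (All.lookup Tf⊆H e∈T)) e∈)))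
          yesSmallAt : small k M₁ M₂ S v s σ ≡ true
          yesSmallAt = any-∈ _ (runs k S (2 * s) (S ∪ ⁅ v ⁆) (v ∷ []) []) run
            (∧-true (≡ᵇ-true (trans ∣Xf∣ (cong (_+ s) (sym ∣S∣)))) (∧-true yesAvoids yesContains))
          s≤n : s ≤ n
          s≤n = ≤-trans (m≤m+n s _) (≤-trans 2s≤ (m∸n≤m n i))
          yesSmall : someSmall σ ≡ true
          yesSmall = any-∈ _ (kSets n i) (∈-kSets⁺ ∣S∣) (any-∈ _ (allFin n) (∈-allFin v)
            (∧-true (cong not (dec-false (v ∈? S) v∉S)) (any-∈ _ (downFrom (suc n)) (∈-downFrom⁺ (s≤s s≤n))
              (∧-true (∧-true (dec-true (2 ≤? s) 2≤s) (dec-true (2 * s ≤? n ∸ i) 2s≤)) yesSmallAt))))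

length-filter-# : (P : A → Bool) → ∀ xs → length (filter (λ x → P x Bool.≟ false) xs) + # P xs ≡ length xs
length-filter-# P []       = refl
length-filter-# P (x ∷ xs) with P x
... | true  = trans (+-suc _ _) (cong suc (length-filter-# P xs))
... | false = cong suc (length-filter-# P xs)

log-bracket : ∀ a → 0 < a → ∀ ℓ₀ n → 2 ^ (a * ℓ₀) ≤ n → ∃[ ℓ ] (ℓ₀ ≤ ℓ × 2 ^ (a * ℓ) ≤ n × n ≤ 2 ^ (a * suc ℓ))
log-bracket a a>0 ℓ₀ n h = search n ℓ₀ h (≤-trans (m≤2^m n) (^-monoʳ-≤ 2 (≤-trans (m≤n+m n ℓ₀) (≤-trans (≤-reflexive (sym (*-identityˡ _))) (*-monoˡ-≤ (ℓ₀ + n) a>0)))))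
  where
  search : ∀ m ℓ → 2 ^ (a * ℓ) ≤ n → n ≤ 2 ^ (a * (ℓ + m)) → ∃[ ℓ′ ] (ℓ ≤ ℓ′ × 2 ^ (a * ℓ′) ≤ n × n ≤ 2 ^ (a * suc ℓ′))
  search zero    ℓ lo hi = ℓ , ≤-refl , lo , ≤-trans hi (^-monoʳ-≤ 2 (*-monoʳ-≤ a (≤-trans (≤-reflexive (+-identityʳ ℓ)) (n≤1+n ℓ))))
  search (suc m) ℓ lo hi with n ≤? 2 ^ (a * suc ℓ)
  ... | yes n≤ = ℓ , ≤-refl , lo , n≤
  ... | no  n≰ with ℓ′ , ℓ<ℓ′ , bounds ← search m (suc ℓ) (<⇒≤ (≰⇒> n≰)) (subst (λ z → n ≤ 2 ^ (a * z)) (+-suc ℓ m) hi) =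
    ℓ′ , ≤-trans (n≤1+n ℓ) ℓ<ℓ′ , bounds

#small-size : ∀ {i t′ M₁ M₂ s α v} (let t = suc t′) (let k = suc i + t) (S : Subset n) R μ → ∣ S ∣ ≡ i → v ∉ˢ S →
  (let N = length (kSets n k)) (let D = bin (n ∸ suc i) t) (let d = bin (n ∸ (i + s)) t) →
  α ≤ D → 0 < D → M₂ * D ≤ α * N → N ≤ R * d → d ≤ N → 0 < N → R * μ + s ≤ M₁ → M₁ ≤ M₂ → M₁ ≤ N →
  # (small k M₁ M₂ S v s) (perms N (kSets n k)) * 2 ^ (s * μ) ≤ N ! * suc α ^ (2 * s)
#small-size {t′ = t′} {M₁} {M₂} {s} {α} S R μ refl v∉S h₁ h₂ h₃ h₄ h₅ h₆ h₇ h₈ h₉ =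
  #small _ M₁ M₂ S (suc t′) s R μ α refl (s≤s z≤n) h₁ h₂ h₃ h₄ h₅ h₆ h₇ h₈ h₉ v∉S

#-guarded : ∀ b (P : A → Bool) xs {w F} → (b ≡ true → # P xs * w ≤ F) → # (λ x → b ∧ P x) xs * w ≤ F
#-guarded true  P xs     h = h refl
#-guarded false P xs {w} h = ≤-trans (≤-reflexive (cong (_* w) (∑-0 _ (λ _ → refl) xs))) z≤n

∧-trueˡ : ∀ {a b} → a ∧ b ≡ true → a ≡ true
∧-trueˡ {true} _ = refl

∧-trueʳ : ∀ a {b} → a ∧ b ≡ true → b ≡ true
∧-trueʳ true h = h

module Process (i t′ e : ℕ) (e>0 : 0 < e) where

  open Parameters i t′ e e>0

  module At (n ℓ : ℕ) (2^≤n : 2 ^ (7 * q * ℓ) ≤ n) (n≤2^ : n ≤ 2 ^ (7 * q * suc ℓ)) (large : Large ℓ) where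

    open Estimates n ℓ 2^≤n n≤2^ large
    open Events i t M₁ M₂

    private
      Ω = perms N (kSets n k)

    noneIsolated bad : List (Subset n) → Bool
    noneIsolated σ = #isolatedSets n k j t′ M₁ (+-suc j t′) M₁≤N D≤N σ ≡ᵇ 0
    bad σ = someIsolated σ ∨ (someSmall σ ∨ noneIsolated σ)

    -- 2 ^ μ₊ pays for all j-sets, of which there are at most `P`, and a factor 2 ^ ℓ ≥ e remains.
    #someIsolated : e * # (someIsolated) Ω ≤ N !
    #someIsolated = *-cancelʳ-≤ _ _ P {{m^n≢0 2 (7 * q * j * suc ℓ)}} (begin
      e * X * P  ≡⟨ lem e X P ⟩
      X * (P * e)  ≤⟨ *-monoʳ-≤ X (*-monoʳ-≤ P (≤-trans e≤2^ℓ (m≤m*n (2 ^ ℓ) (2 ^ k) {{m^n≢0 2 k}}))) ⟩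
      X * (P * (2 ^ ℓ * 2 ^ k))  ≡⟨ cong (X *_) (trans (sym (*-assoc P (2 ^ ℓ) (2 ^ k))) (trans (cong (_* 2 ^ k) (sym (^-distribˡ-+-* 2 (7 * q * j * suc ℓ) ℓ))) (sym (^-distribˡ-+-* 2 (7 * q * j * suc ℓ + ℓ) k)))) ⟩
      X * 2 ^ μ₊ ℓ  ≤⟨ *-monoˡ-≤ (2 ^ μ₊ ℓ) union ⟩
      ∑ (λ J → # (avoids M₂ (⊇ᵇ J)) Ω) (kSets n j) * 2 ^ μ₊ ℓ ≡⟨ ∑-*ʳ (2 ^ μ₊ ℓ) _ (kSets n j) ⟨
      ∑ (λ J → # (avoids M₂ (⊇ᵇ J)) Ω * 2 ^ μ₊ ℓ) (kSets n j) ≤⟨ ∑-mono-∈ (kSets n j) each ⟩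
      ∑ (λ _ → N !) (kSets n j)  ≡⟨ ∑-const (N !) (kSets n j) ⟩
      length (kSets n j) * N !  ≤⟨ *-monoˡ-≤ (N !) (≤-trans (≤-reflexive (length-kSets n j)) (≤-trans (bin-≤-^ n j) n^j≤)) ⟩
      P * N !  ≡⟨ *-comm P (N !) ⟩
      N ! * P  ∎)
      where
      open ≤-Reasoning
      P = 2 ^ (7 * q * j * suc ℓ)
      X = # (someIsolated) Ω
      lem : ∀ e X P → e * X * P ≡ X * (P * e)
      lem = solve-∀
      union : X ≤ ∑ (λ J → # (avoids M₂ (⊇ᵇ J)) Ω) (kSets n j)
      union = ≤-trans (∑-mono-∈ Ω (λ σ _ → ⟦any⟧≤# _ (kSets n j))) (≤-reflexive (∑-swap _ Ω (kSets n j)))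
      each : ∀ J → J ∈ kSets n j → # (avoids M₂ (⊇ᵇ J)) Ω * 2 ^ μ₊ ℓ ≤ N !
      each J J∈ = #isolated n k J t R (μ₊ ℓ) (cong (_+ t) (sym ∣J∣)) N>0
        (subst (λ z → bin (n ∸ z) t ≤ N) (sym ∣J∣) D≤N) (subst (λ z → N ≤ R * bin (n ∸ z) t) (sym ∣J∣) N≤RD) M₂≤N
        where
        ∣J∣ : ∣ J ∣ ≡ j
        ∣J∣ = ∈-kSets⁻ J∈

    private
      s≤n : ∀ s → 2 * s ≤ n ∸ i → s ≤ n
      s≤n s 2s≤ = ≤-trans (m≤m+n s _) (≤-trans 2s≤ (m∸n≤m n i))

      compare : ∀ S v s μ → n ^ j * e * 2 ^ suc s * K ℓ ^ s ≤ 2 ^ (s * μ) →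
        # (small k M₁ M₂ S v s) Ω * 2 ^ (s * μ) ≤ N ! * suc (α ℓ) ^ (2 * s) →
        # (small k M₁ M₂ S v s) Ω * (n ^ j * e * 2 ^ suc s) ≤ N !
      compare S v s μ weight bound = *-cancelʳ-≤ _ _ (K ℓ ^ s) {{m^n≢0 (K ℓ) s}} (begin
        c * (n ^ j * e * 2 ^ suc s) * K ℓ ^ s    ≡⟨ *-assoc c _ (K ℓ ^ s) ⟩
        c * (n ^ j * e * 2 ^ suc s * K ℓ ^ s)    ≤⟨ *-monoʳ-≤ c weight ⟩
        c * 2 ^ (s * μ)  ≤⟨ bound ⟩
        N ! * suc (α ℓ) ^ (2 * s)  ≡⟨ cong (N ! *_) (trans (sym (^-*-assoc (suc (α ℓ)) 2 s)) (cong (λ z → (suc (α ℓ) * z) ^ s) (*-identityʳ (suc (α ℓ))))) ⟩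
        N ! * K ℓ ^ s  ∎)
        where
        open ≤-Reasoning
        c = # (small k M₁ M₂ S v s) Ω

    -- The same `R * μ ℓ` steps are read in two ways: up to size `s₀` as μ units of length `R`,
    -- beyond it as 4 j ℓ units of length `R * q`, since the boundary per vertex may then be smaller
    -- by the factor `q`.
    #small-weighted : ∀ (S : Subset n) v s → ∣ S ∣ ≡ i → v ∉ˢ S → 2 ≤ s → 2 * s ≤ n ∸ i →
      # (small k M₁ M₂ S v s) Ω * (n ^ j * e * 2 ^ suc s) ≤ N !
    #small-weighted S v s ∣S∣ v∉S 2≤s 2s≤ with ≤-total s s₀
    ... | inj₁ s≤s₀ = compare S v s (μ ℓ) (weight-small s 2≤s)
      (#small-size S R (μ ℓ) ∣S∣ v∉S α≤D D>0 M₂D≤αN (N≤Rd-small s≤s₀) (d≤N (≤-trans (s≤s z≤n) 2≤s)) N>0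
        (Rμ+s≤M₁ (s≤n s 2s≤)) M₁≤M₂ M₁≤N)
    ... | inj₂ s₀≤s = compare S v s (4 * j * ℓ) (weight-large s s₀≤s)
      (#small-size S (R * q) (4 * j * ℓ) ∣S∣ v∉S α≤D D>0 M₂D≤αN (N≤Rd-large 2s≤) (d≤N (≤-trans (s≤s z≤n) 2≤s)) N>0
        (≤-trans (≤-reflexive (cong (_+ s) (lem R q j ℓ))) (Rμ+s≤M₁ (s≤n s 2s≤))) M₁≤M₂ M₁≤N)
      where
      lem : ∀ R q j l → R * q * (4 * j * l) ≡ R * (4 * q * j * l)
      lem = solve-∀

    #someSmallAt : ∀ S v → S ∈ kSets n i → # (someSmallAt S v) Ω * (n ^ j * e) ≤ N !
    #someSmallAt S v S∈ with v ∈? S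
    ... | yes _  = ≤-trans (≤-reflexive (cong (_* (n ^ j * e)) (∑-0 _ (λ _ → refl) Ω))) z≤n
    ... | no v∉S = ≤-trans (*-monoˡ-≤ (n ^ j * e) union) (geometric size (n ^ j * e) (N !) (suc n) (λ s _ → weighted s))
      where
      event : ℕ → List (Subset n) → Bool
      event s σ = inRange n s ∧ small k M₁ M₂ S v s σ
      size : ℕ → ℕ
      size s = # (event s) Ω
      union : # (λ σ → any (λ s → event s σ) (downFrom (suc n))) Ω ≤ ∑ size (downFrom (suc n))
      union = ≤-trans (∑-mono-∈ Ω (λ σ _ → ⟦any⟧≤# (λ s → event s σ) (downFrom (suc n)))) (≤-reflexive (∑-swap _ Ω (downFrom (suc n))))
      weighted : ∀ s → size s * (n ^ j * e * 2 ^ suc s) ≤ N !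
      weighted s = #-guarded (inRange n s) _ Ω λ h → #small-weighted S v s (∈-kSets⁻ S∈) v∉S
        (does-true (2 ≤? s) (∧-trueˡ h)) (does-true (2 * s ≤? n ∸ i) (∧-trueʳ (does (2 ≤? s)) h))

    #someSmall : e * # someSmall Ω ≤ N !
    #someSmall = *-cancelʳ-≤ _ _ (n ^ j) {{m^n≢0 n j {{>-nonZero n>0}}}} (begin
      e * # someSmall Ω * n ^ j  ≡⟨ lem e (# someSmall Ω) (n ^ j) ⟩
      # someSmall Ω * (n ^ j * e)  ≤⟨ *-monoˡ-≤ (n ^ j * e) union ⟩
      ∑ (λ S → ∑ (λ v → # (someSmallAt S v) Ω) (allFin n)) (kSets n i) * (n ^ j * e) ≡⟨ ∑-*ʳ (n ^ j * e) _ (kSets n i) ⟨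
      ∑ (λ S → ∑ (λ v → # (someSmallAt S v) Ω) (allFin n) * (n ^ j * e)) (kSets n i) ≤⟨ ∑-mono-∈ (kSets n i) row ⟩
      ∑ (λ _ → n * N !) (kSets n i)  ≡⟨ ∑-const (n * N !) (kSets n i) ⟩
      length (kSets n i) * (n * N !)  ≤⟨ *-monoˡ-≤ (n * N !) (≤-trans (≤-reflexive (length-kSets n i)) (bin-≤-^ n i)) ⟩
      n ^ i * (n * N !)  ≡⟨ lem₂ (n ^ i) n (N !) ⟩
      N ! * n ^ j  ∎)
      where
      open ≤-Reasoning
      n>0 : 0 < n
      n>0 = ≤-trans (m^n>0 2 (7 * q * ℓ)) 2^≤n
      lem : ∀ e X P → e * X * P ≡ X * (P * e)
      lem = solve-∀
      lem₂ : ∀ a m F → a * (m * F) ≡ F * (m * a)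
      lem₂ = solve-∀
      union : # someSmall Ω ≤ ∑ (λ S → ∑ (λ v → # (someSmallAt S v) Ω) (allFin n)) (kSets n i)
      union = begin
        # someSmall Ω  ≤⟨ ∑-mono-∈ Ω (λ σ _ → ≤-trans (⟦any⟧≤# _ (kSets n i))
          (∑-mono-∈ (kSets n i) (λ S _ → ⟦any⟧≤# (λ v → someSmallAt S v σ) (allFin n)))) ⟩
        ∑ (λ σ → ∑ (λ S → ∑ (λ v → ⟦ someSmallAt S v σ ⟧) (allFin n)) (kSets n i)) Ω ≡⟨ ∑-swap _ Ω (kSets n i) ⟩
        ∑ (λ S → ∑ (λ σ → ∑ (λ v → ⟦ someSmallAt S v σ ⟧) (allFin n)) Ω) (kSets n i) ≡⟨ ∑-cong (λ S → ∑-swap _ Ω (allFin n)) (kSets n i) ⟩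
        ∑ (λ S → ∑ (λ v → # (someSmallAt S v) Ω) (allFin n)) (kSets n i)     ∎
      row : ∀ S → S ∈ kSets n i → ∑ (λ v → # (someSmallAt S v) Ω) (allFin n) * (n ^ j * e) ≤ n * N !
      row S S∈ = begin
        ∑ (λ v → # (someSmallAt S v) Ω) (allFin n) * (n ^ j * e)             ≡⟨ ∑-*ʳ (n ^ j * e) _ (allFin n) ⟨
        ∑ (λ v → # (someSmallAt S v) Ω * (n ^ j * e)) (allFin n)             ≤⟨ ∑-mono-∈ (allFin n) (λ v _ → #someSmallAt S v S∈) ⟩
        ∑ (λ _ → N !) (allFin n)  ≡⟨ ∑-const (N !) (allFin n) ⟩
        length (allFin n) * N !  ≡⟨ cong (_* N !) {length (allFin n)} {n} (length-tabulate (λ x → x)) ⟩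
        n * N !  ∎

    #bad : e * # bad Ω ≤ 4 * N !
    #bad = begin
      e * # bad Ω  ≤⟨ *-monoʳ-≤ e (≤-trans (∑-mono-∈ Ω (λ σ _ → split σ)) (≤-reflexive (trans (∑-+ _ _ Ω) (cong (# someIsolated Ω +_) (∑-+ _ _ Ω))))) ⟩
      e * (# someIsolated Ω + (# someSmall Ω + # noneIsolated Ω))           ≡⟨ lem e (# someIsolated Ω) (# someSmall Ω) (# noneIsolated Ω) ⟩
      e * # someIsolated Ω + (e * # someSmall Ω + e * # noneIsolated Ω)     ≤⟨ +-mono-≤ #someIsolated (+-mono-≤ #someSmall #noneIsolated) ⟩
      N ! + (N ! + 2 * N !)  ≡⟨ lem₂ (N !) ⟩
      4 * N !  ∎
      where
      open ≤-Reasoning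
      lem : ∀ e a b c → e * (a + (b + c)) ≡ e * a + (e * b + e * c)
      lem = solve-∀
      lem₂ : ∀ F → F + (F + 2 * F) ≡ 4 * F
      lem₂ = solve-∀
      split : ∀ σ → ⟦ bad σ ⟧ ≤ ⟦ someIsolated σ ⟧ + (⟦ someSmall σ ⟧ + ⟦ noneIsolated σ ⟧)
      split σ = ≤-trans (⟦∨⟧≤ (someIsolated σ) _) (+-monoʳ-≤ ⟦ someIsolated σ ⟧ (⟦∨⟧≤ (someSmall σ) _))
      #noneIsolated : e * # noneIsolated Ω ≤ 2 * N !
      #noneIsolated = #noIsolated n k j t′ M₁ (+-suc j t′) M₁≤N D≤N e y (ν ℓ + 2) e>0 y>0 N>0
        2D+2M₁≤N correlation M₁≤[ν+2]6y 6yD+M₁≤N many-sets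

    good⇒τ-equal : ∀ {σ} → σ ↭ kSets n k → bad σ ≡ false → TauEq j σ
    good⇒τ-equal {σ} σ↭ good = τ-equal (s≤s z≤n) σ↭ (∨-falseˡ good) (∨-falseˡ (∨-falseʳ (someIsolated σ) good))
      (J , ∈-kSets⁻ J∈ , avoids⇒isolated {σ = σ} isolated)
      where
      ∨-falseˡ : ∀ {a b} → a ∨ b ≡ false → a ≡ false
      ∨-falseˡ {false} _ = refl
      ∨-falseʳ : ∀ a {b} → a ∨ b ≡ false → b ≡ false
      ∨-falseʳ false h = h
      found = #≢0 (λ J → avoids M₁ (⊇ᵇ J) σ) (kSets n j) (∨-falseʳ (someSmall σ) (∨-falseʳ (someIsolated σ) good))
      J = proj₁ found
      J∈ = proj₁ (proj₂ found)
      isolated = proj₂ (proj₂ found)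

    goodOrderings : List (List (Subset n))
    goodOrderings = filter (λ σ → bad σ Bool.≟ false) Ω

    goodOrderings-unique : Unique goodOrderings
    goodOrderings-unique = Uniqueₚ.filter⁺ (λ σ → bad σ Bool.≟ false) (Unique-perms N (kSets n k) (Unique-kSets n k))

    goodOrderings-good : All (λ σ → (σ ↭ kSets n k) × TauEq j σ) goodOrderings
    goodOrderings-good = All.tabulate λ σ∈ →
      let σ∈Ω , good = ∈-filter⁻ (λ σ → bad σ Bool.≟ false) {xs = Ω} σ∈
          σ↭ = perms-↭ N (kSets n k) refl σ∈Ω
      in σ↭ , good⇒τ-equal σ↭ good

    -- The bad orderings are a share of at most 4 / e = 1 / (r + 1), and p is at least 1. The
    -- successor keeps `e` positive when r = 0.
    goodOrderings-many : ∀ p r → 0 < p → e ≡ 4 * suc r → r * N ! ≤ length goodOrderings * r + p * N !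
    goodOrderings-many p r p>0 e≡ = begin
      r * N !  ≡⟨ cong (r *_) total ⟩
      r * (g + b)  ≡⟨ trans (*-distribˡ-+ r g b) (cong (_+ r * b) (*-comm r g)) ⟩
      g * r + r * b  ≤⟨ +-monoʳ-≤ (g * r) (≤-trans rb≤ (≤-trans (≤-reflexive (sym (*-identityˡ (N !)))) (*-monoˡ-≤ (N !) p>0))) ⟩
      g * r + p * N !  ∎
      where
      open ≤-Reasoning
      g = length goodOrderings
      b = # bad Ω
      total : N ! ≡ g + b
      total = sym (trans (length-filter-# bad Ω) (trans (sym (length-∑ Ω)) (length-perms N (kSets n k) refl)))
      rb≤ : r * b ≤ N !
      rb≤ = *-cancelˡ-≤ 4 (begin
        4 * (r * b)            ≡⟨ *-assoc 4 r b ⟨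
        4 * r * b              ≤⟨ *-monoˡ-≤ b (*-monoʳ-≤ 4 (n≤1+n r)) ⟩
        4 * suc r * b          ≡⟨ cong (_* b) e≡ ⟨
        e * b  ≤⟨ #bad ⟩
        4 * N !  ∎)

  whp : Eventually Large → ∀ p r → 0 < p → e ≡ 4 * suc r →
    ∃[ n₀ ] ∀ (n : ℕ) → n₀ ≤ n →
    ∃[ L ] (Unique {A = List (Subset n)} L
    × All (λ σ → (σ ↭ kSets n k) × TauEq j σ) L
    × r * (length (kSets n k) !) ≤ length L * r + p * (length (kSets n k) !))
  whp (ℓ₀ , large) p r p>0 e≡ = 2 ^ (7 * q * ℓ₀) , λ n n₀≤n →
    let ℓ , ℓ₀≤ℓ , lo , hi = log-bracket (7 * q) (*-mono-≤ {1} {7} (s≤s z≤n) q>0) ℓ₀ n n₀≤n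
        large-ℓ = large ℓ ℓ₀≤ℓ
    in At.goodOrderings n ℓ lo hi large-ℓ , At.goodOrderings-unique n ℓ lo hi large-ℓ
     , At.goodOrderings-good n ℓ lo hi large-ℓ , At.goodOrderings-many n ℓ lo hi large-ℓ p r p>0 e≡

-- Here p / q is an arbitrary ε > 0. The process is a uniformly random ordering of the k-sets, so a
-- repetition-free list `L` of orderings with equal hitting times, of length at least (1 - p / q)
-- `N !` where N is the number of k-sets, says that the probability is at least 1 - ε for all n ≥
-- `n₀`.
theorem1p1 : ∀ (k j : ℕ) → 3 ≤ k → 1 ≤ j → j < k →
    ∀ (p q : ℕ) → 0 < p →
    ∃[ n₀ ] ∀ (n : ℕ) → n₀ ≤ n →
    ∃[ L ] (Unique {A = List (Subset n)} L
    × All (λ σ → (σ ↭ kSets n k) × TauEq j σ) L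
    × q * (length (kSets n k) !) ≤ length L * q + p * (length (kSets n k) !))
theorem1p1 k (suc i) 3≤k 1≤j j<k p q p>0 =
  subst (λ k → ∃[ n₀ ] ∀ (n : ℕ) → n₀ ≤ n →
    ∃[ L ] (Unique {A = List (Subset n)} L
    × All (λ σ → (σ ↭ kSets n k) × TauEq (suc i) σ) L
    × q * (length (kSets n k) !) ≤ length L * q + p * (length (kSets n k) !)))
    (trans (+-suc (suc i) t′) (m+[n∸m]≡n j<k))
    (Process.whp i t′ (4 * suc q) (s≤s z≤n) (Parameters.eventually-Large i t′ (4 * suc q) (s≤s z≤n)) p q p>0 refl)
  where
  t′ = k ∸ suc (suc i)
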